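{- For every integer $t\geq 10^{391}+3$ and every real $\varepsilon>0$, $$s_t(n)\geq n^{\,1-\frac{1+\varepsilon}{t-10^{391}-1+\varepsilon}}$$ for all sufficiently large $n$.
   Context: All graphs are finite and simple; $\delta(F)$ denotes the minimum degree and $\chi(F)$ the chromatic number of a graph $F$. For an integer $t\geq5$, the extremal deficiency is $$s_t(n):=\frac{n}{3}-\max\{\delta(F): |V(F)|=n,\ F\text{ is triangle-free},\ \chi(F)\geq t\},$$ which is defined for all sufficiently large $n$ (those for which such an $F$ exists). -}

module Defs where

open import Algebra.Definitions.RawSemiring as Exp using ()
open import Data.Bool.Base using (Bool; false; T)
open import Data.Bool.Properties using (T?)
open import Data.Fin.Base using (Fin; finToFun; funToFin)
open import Data.Fin.Properties as Fin using (finToFun-funToFin)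
open import Data.Fin.Subset as Subset using (Subset)
open import Data.Integer.Base as ℤ using (ℤ; +_; -[1+_])
import Data.Integer.Properties as ℤ
open import Data.Nat.Base as ℕ using (ℕ; zero; suc; z≤n; s≤s)
import Data.Nat.Properties as ℕ
import Data.Rational.Base
open import Data.Product.Base using (Σ; ∃; _×_; _,_; proj₁)
open import Data.Rational.Base as ℚ
  using (ℚ; 0ℚ; 1ℚ; ½; ∣_∣; ↥_; ↧ₙ_; toℚᵘ; Positive; NonNegative; NonZero; 1/_)
import Data.Rational.Literals as ℚ using (fromℤ)
import Data.Rational.Properties as ℚ
open import Data.Rational.Solver using (module +-*-Solver)
import Data.Rational.Unnormalised.Base as ℚᵘ
import Data.Rational.Unnormalised.Properties as ℚᵘ
import Data.Vec.Base as Vec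
import Data.Vec.Functional as Vector
open import Function.Base using (_∘_; id)
open import Relation.Binary.PropositionalEquality
open import Relation.Nullary using (¬_; Dec; yes; no; contradiction)
open import Relation.Nullary.Decidable using (map′; ¬?; _→-dec_)
open import Relation.Unary using (Pred; Decidable)

------------------------------------------------------------------------
-- Graphs

record Graph (n : ℕ) : Set where
  field
    adjacent    : Fin n → Fin n → Bool
    symmetric   : ∀ u v → adjacent u v ≡ adjacent v u
    irreflexive : ∀ v → adjacent v v ≡ false

  infix 4 _~_
  _~_ : Fin n → Fin n → Set
  u ~ v = T (adjacent u v)

  neighbours : Fin n → Subset n
  neighbours v = Vec.tabulate (adjacent v)

  degree : Fin n → ℕ
  degree v = Subset.∣ neighbours v ∣

-- The starting value n of the fold exceeds every degree, so for n > 0 it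
-- does not affect the minimum.
δ : ∀ {n} → Graph n → ℕ
δ {n} F = Vector.foldr ℕ._⊓_ n (Graph.degree F)

TriangleFree : ∀ {n} → Graph n → Set
TriangleFree F = ∀ u v w → ¬ (u ~ v × v ~ w × u ~ w)
  where open Graph F

Colourable : ∀ {n} → Graph n → ℕ → Set
Colourable {n} F k = Σ (Fin n → Fin k) λ c → ∀ u v → u ~ v → c u ≢ c v
  where open Graph F

colourable? : ∀ {n} (F : Graph n) → Decidable (Colourable F)
colourable? {n} F k = map′ to from (Fin.any? λ i → proper? (finToFun {k} {n} i))
  where
  open Graph F
  Proper : (Fin n → Fin k) → Set
  Proper c = ∀ u v → u ~ v → c u ≢ c v
  proper? : ∀ c → Dec (Proper c)
  proper? c = Fin.all? λ u → Fin.all? λ v →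
    T? (adjacent u v) →-dec ¬? (c u Fin.≟ c v)
  to : (∃ λ i → Proper (finToFun {k} {n} i)) → Colourable F k
  to (i , p) = finToFun i , p
  from : Colourable F k → ∃ λ i → Proper (finToFun {k} {n} i)
  from (c , p) = funToFin c , λ u v u~v eq → p u v u~v
    (trans (sym (finToFun-funToFin c u)) (trans eq (finToFun-funToFin c v)))

n-colourable : ∀ {n} (F : Graph n) → Colourable F n
n-colourable F = id , λ { u _ u~u refl → subst T (irreflexive u) u~u }
  where open Graph F

IsLeast : ∀ {ℓ} → Pred ℕ ℓ → ℕ → Set ℓ
IsLeast P k = P k × (∀ j → P j → k ℕ.≤ j)

least : ∀ {ℓ} {P : Pred ℕ ℓ} → Decidable P → ∀ n → P n → ∃ (IsLeast P)
least P? zero    p = 0 , p , λ _ _ → z≤n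
least P? (suc n) p with P? 0
... | yes p₀ = 0 , p₀ , λ _ _ → z≤n
... | no ¬p₀ with least (P? ∘ suc) n p
...   | k , pₖ , min = suc k , pₖ , λ where
        zero    p₀ → contradiction p₀ ¬p₀
        (suc j) pⱼ → s≤s (min j pⱼ)

chromaticNumber : ∀ {n} (F : Graph n) → ∃ (IsLeast (Colourable F))
chromaticNumber {n} F = least (colourable? F) n (n-colourable F)

χ : ∀ {n} → Graph n → ℕ
χ F = proj₁ (chromaticNumber F)

Admissible : ∀ {n} → ℕ → Graph n → Set
Admissible t F = TriangleFree F × t ℕ.≤ χ F

IsMaxMinDegree : ℕ → ℕ → ℕ → Set
IsMaxMinDegree t n d =
  (Σ (Graph n) λ F → Admissible t F × δ F ≡ d) ×
  (∀ (F : Graph n) → Admissible t F → δ F ℕ.≤ d)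

-- s_t(n) is a partial function of n: IsDeficiency t n s says that it is
-- defined at n and that its value is s.
IsDeficiency : ℕ → ℕ → ℚ → Set
IsDeficiency t n s = ∃ λ d →
  IsMaxMinDegree t n d × s ≡ (+ n ℚ./ 3) ℚ.- (+ d ℚ./ 1)

------------------------------------------------------------------------
-- Lemmas on rational numbers

private
  module ℚ-lemmas where
    open import Data.Rational.Base
    open import Data.Rational.Properties hiding (_≤?_; _<?_)
    open +-*-Solver
    open ≤-Reasoning

    instance
      positive-½ : Positive ½
      positive-½ = _

    0<½* : ∀ {d} → 0ℚ < d → 0ℚ < ½ * d
    0<½* {d} 0<d = positive⁻¹ (½ * d) {{pos*pos⇒pos ½ d {{ℚ.positive 0<d}}}}

    halves : ∀ d → ½ * d + ½ * d ≡ d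
    halves d = trans (sym (*-distribʳ-+ d ½ ½)) (*-identityˡ d)

    0<* : ∀ {p q} → 0ℚ < p → 0ℚ < q → 0ℚ < p * q
    0<* {p} {q} 0<p 0<q =
      positive⁻¹ (p * q) {{pos*pos⇒pos p {{ℚ.positive 0<p}} q {{ℚ.positive 0<q}}}}

    +-difference : ∀ a b c d → (a + b) - (c + d) ≡ (a - c) + (b - d)
    +-difference = solve 4 (λ a b c d →
      (a :+ b) :- (c :+ d) := (a :- c) :+ (b :- d)) refl

    *-difference : ∀ a b c d → a * b - c * d ≡ a * (b - d) + d * (a - c)
    *-difference = solve 4 (λ a b c d →
      a :* b :- c :* d := a :* (b :- d) :+ d :* (a :- c)) refl

    neg-difference : ∀ a b → - a - - b ≡ - (a - b)
    neg-difference = solve 2 (λ a b → :- a :- :- b := :- (a :- b)) refl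

    1/-difference : ∀ a b .{{_ : NonZero a}} .{{_ : NonZero b}} →
      1/ a - 1/ b ≡ (b - a) * (1/ a * 1/ b)
    1/-difference a b = begin-equality
      1/ a - 1/ b                              ≡⟨ cong₂ _-_ (sym (*-identityˡ (1/ a))) (sym (*-identityˡ (1/ b))) ⟩
      1ℚ * 1/ a - 1ℚ * 1/ b                    ≡⟨ cong₂ (λ x y → x * 1/ a - y * 1/ b) (sym (*-inverseʳ b)) (sym (*-inverseʳ a)) ⟩
      (b * 1/ b) * 1/ a - (a * 1/ a) * 1/ b    ≡⟨ rearrange a b (1/ a) (1/ b) ⟩
      (b - a) * (1/ a * 1/ b)                  ∎
      where
      rearrange : ∀ a b x y → (b * y) * x - (a * x) * y ≡ (b - a) * (x * y)
      rearrange = solve 4 (λ a b x y →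
        (b :* y) :* x :- (a :* x) :* y := (b :- a) :* (x :* y)) refl

    1/-nonNeg : ∀ p .{{_ : Positive p}} .{{p≢0 : NonZero p}} → NonNegative ((1/ p) {{p≢0}})
    1/-nonNeg p {{_}} {{p≢0}} = pos⇒nonNeg ((1/ p) {{p≢0}}) {{1/pos⇒pos p}}

    1/-antimono-≤ : ∀ {d a} .{{_ : Positive d}} .{{_ : Positive a}}
      .{{_ : NonZero d}} .{{_ : NonZero a}} → d ≤ a → 1/ a ≤ 1/ d
    1/-antimono-≤ {d} {a} d≤a = begin
      1/ a                    ≡⟨ *-identityʳ (1/ a) ⟨
      1/ a * 1ℚ               ≡⟨ cong (1/ a *_) (*-inverseʳ d) ⟨
      1/ a * (d * 1/ d)       ≤⟨ *-monoˡ-≤-nonNeg (1/ a) {{1/-nonNeg a}}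
                                  (*-monoʳ-≤-nonNeg (1/ d) {{1/-nonNeg d}} d≤a) ⟩
      1/ a * (a * 1/ d)       ≡⟨ *-assoc (1/ a) a (1/ d) ⟨
      (1/ a * a) * 1/ d       ≡⟨ cong (_* 1/ d) (*-inverseˡ a) ⟩
      1ℚ * 1/ d               ≡⟨ *-identityˡ (1/ d) ⟩
      1/ d                    ∎

    fromℕ : ℕ → ℚ
    fromℕ n = ℚ.fromℤ (+ n)

    fromℕ-mono : ∀ {m n} → m ℕ.≤ n → fromℕ m ≤ fromℕ n
    fromℕ-mono m≤n = *≤* (subst₂ ℤ._≤_ (sym (ℤ.*-identityʳ _)) (sym (ℤ.*-identityʳ _)) (ℤ.+≤+ m≤n))

    fromℕ-suc : ∀ n → fromℕ n + 1ℚ ≡ fromℕ (suc n)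
    fromℕ-suc n = toℚᵘ-injective (ℚᵘ.≃-trans (toℚᵘ-homo-+ (fromℕ n) 1ℚ) (ℚᵘ.*≡* eq))
      where
      eq : (+ n ℤ.* + 1 ℤ.+ + 1 ℤ.* + 1) ℤ.* + 1 ≡ + suc n ℤ.* + 1
      eq = cong (ℤ._* + 1) (trans (cong (ℤ._+ + 1) (ℤ.*-identityʳ (+ n))) (cong +_ (ℕ.+-comm n 1)))

open ℚ-lemmas

------------------------------------------------------------------------
-- Real numbers, as Cauchy sequences of rational numbers

private
  open module ℚ-Notation = Data.Rational.Base using () renaming (_<_ to _<ℚ_; _≤_ to _≤ℚ_)

record ℝ : Set where
  field
    seq    : ℕ → ℚ
    cauchy : ∀ {d} → 0ℚ <ℚ d → ∃ λ N → ∀ m n → N ℕ.≤ m → N ℕ.≤ n →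
             ∣ seq m ℚ.- seq n ∣ <ℚ d

open ℝ

infix 4 _<_
_<_ : ℝ → ℝ → Set
x < y = ∃ λ d → 0ℚ <ℚ d × ∃ λ N → ∀ n → N ℕ.≤ n → seq x n ℚ.+ d ≤ℚ seq y n

fromℚ : ℚ → ℝ
fromℚ q .seq _ = q
fromℚ q .cauchy {d} 0<d = 0 , λ _ _ _ _ →
  subst (λ z → ∣ z ∣ <ℚ d) (sym (ℚ.+-inverseʳ q)) 0<d

0ℝ 1ℝ : ℝ
0ℝ = fromℚ 0ℚ
1ℝ = fromℚ 1ℚ

fromNat : ℕ → ℝ
fromNat n = fromℚ (ℚ.fromℤ (+ n))

infixl 6 _+_ _-_
infixl 7 _*_ _/_
infix  8 -_

_+_ : ℝ → ℝ → ℝ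
(x + y) .seq n = seq x n ℚ.+ seq y n
(x + y) .cauchy {d} 0<d =
  let M , x-close = cauchy x (0<½* 0<d)
      N , y-close = cauchy y (0<½* 0<d)
  in M ℕ.⊔ N , λ m n ≤m ≤n → begin-strict
  ∣ (seq x m ℚ.+ seq y m) ℚ.- (seq x n ℚ.+ seq y n) ∣
    ≡⟨ cong ∣_∣ (+-difference (seq x m) (seq y m) (seq x n) (seq y n)) ⟩
  ∣ (seq x m ℚ.- seq x n) ℚ.+ (seq y m ℚ.- seq y n) ∣
    ≤⟨ ℚ.∣p+q∣≤∣p∣+∣q∣ (seq x m ℚ.- seq x n) (seq y m ℚ.- seq y n) ⟩
  ∣ seq x m ℚ.- seq x n ∣ ℚ.+ ∣ seq y m ℚ.- seq y n ∣
    <⟨ ℚ.+-mono-< (x-close m n (ℕ.m⊔n≤o⇒m≤o M N ≤m) (ℕ.m⊔n≤o⇒m≤o M N ≤n))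
                  (y-close m n (ℕ.m⊔n≤o⇒n≤o M N ≤m) (ℕ.m⊔n≤o⇒n≤o M N ≤n)) ⟩
  ½ ℚ.* d ℚ.+ ½ ℚ.* d
    ≡⟨ halves d ⟩
  d ∎
  where open ℚ.≤-Reasoning

-_ : ℝ → ℝ
(- x) .seq n = ℚ.- seq x n
(- x) .cauchy {d} 0<d = let N , close = cauchy x 0<d in N , λ m n ≤m ≤n →
  subst (_<ℚ d)
    (sym (trans (cong ∣_∣ (neg-difference (seq x m) (seq x n)))
                (ℚ.∣-p∣≡∣p∣ (seq x m ℚ.- seq x n))))
    (close m n ≤m ≤n)

_-_ : ℝ → ℝ → ℝ
x - y = x + - y

eventuallyBounded : ∀ x → ∃ λ B → 0ℚ <ℚ B ×
  ∃ λ N → ∀ n → N ℕ.≤ n → ∣ seq x n ∣ ≤ℚ B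
eventuallyBounded x = let N , close = cauchy x (ℚ.positive⁻¹ 1ℚ) in
  1ℚ ℚ.+ ∣ seq x N ∣ ,
  ℚ.<-≤-trans (ℚ.positive⁻¹ 1ℚ)
    (subst (_≤ℚ 1ℚ ℚ.+ ∣ seq x N ∣) (ℚ.+-identityʳ 1ℚ)
      (ℚ.+-monoʳ-≤ 1ℚ (ℚ.0≤∣p∣ (seq x N)))) ,
  N , λ n ≤n → begin
    ∣ seq x n ∣
      ≡⟨ cong ∣_∣ (split (seq x n) (seq x N)) ⟩
    ∣ (seq x n ℚ.- seq x N) ℚ.+ seq x N ∣
      ≤⟨ ℚ.∣p+q∣≤∣p∣+∣q∣ (seq x n ℚ.- seq x N) (seq x N) ⟩
    ∣ seq x n ℚ.- seq x N ∣ ℚ.+ ∣ seq x N ∣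
      ≤⟨ ℚ.+-monoˡ-≤ ∣ seq x N ∣ (ℚ.<⇒≤ (close n N ≤n ℕ.≤-refl)) ⟩
    1ℚ ℚ.+ ∣ seq x N ∣ ∎
  where
  open ℚ.≤-Reasoning
  open +-*-Solver
  split : ∀ a b → a ≡ (a ℚ.- b) ℚ.+ b
  split = solve 2 (λ a b → a := (a :- b) :+ b) refl

private
  -- If a is bounded by B and b is smaller than d/(2B), then a b is smaller
  -- than d/2.
  product-small : ∀ {B d a b} (0<B : 0ℚ <ℚ B) →
    let instance B≢0 = ℚ.pos⇒nonZero B {{ℚ.positive 0<B}} in
    ∣ a ∣ ≤ℚ B → ∣ b ∣ <ℚ 1/ B ℚ.* (½ ℚ.* d) →
    ∣ a ℚ.* b ∣ <ℚ ½ ℚ.* d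
  product-small {B} {d} {a} {b} 0<B a≤ b< = begin-strict
    ∣ a ℚ.* b ∣                     ≡⟨ ℚ.∣p*q∣≡∣p∣*∣q∣ a b ⟩
    ∣ a ∣ ℚ.* ∣ b ∣                 ≤⟨ ℚ.*-monoʳ-≤-nonNeg ∣ b ∣ {{ℚ.∣-∣-nonNeg b}} a≤ ⟩
    B ℚ.* ∣ b ∣                     <⟨ ℚ.*-monoʳ-<-pos B b< ⟩
    B ℚ.* (1/ B ℚ.* (½ ℚ.* d))      ≡⟨ ℚ.*-assoc B (1/ B) (½ ℚ.* d) ⟨
    (B ℚ.* 1/ B) ℚ.* (½ ℚ.* d)      ≡⟨ cong (ℚ._* (½ ℚ.* d)) (ℚ.*-inverseʳ B) ⟩
    1ℚ ℚ.* (½ ℚ.* d)                ≡⟨ ℚ.*-identityˡ (½ ℚ.* d) ⟩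
    ½ ℚ.* d                         ∎
    where
    open ℚ.≤-Reasoning
    instance
      B>0 = ℚ.positive 0<B
      B≢0 = ℚ.pos⇒nonZero B

  0<1/* : ∀ {B e} (0<B : 0ℚ <ℚ B) →
    let instance B≢0 = ℚ.pos⇒nonZero B {{ℚ.positive 0<B}} in
    0ℚ <ℚ e → 0ℚ <ℚ 1/ B ℚ.* e
  0<1/* {B} 0<B 0<e = 0<* (ℚ.positive⁻¹ (1/ B) {{ℚ.1/pos⇒pos B}}) 0<e
    where instance
      B>0 = ℚ.positive 0<B
      B≢0 = ℚ.pos⇒nonZero B

_*_ : ℝ → ℝ → ℝ
(x * y) .seq n = seq x n ℚ.* seq y n
(x * y) .cauchy {d} 0<d =
  let A , 0<A , K , x≤A = eventuallyBounded x
      B , 0<B , L , y≤B = eventuallyBounded y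
      M , x-close = cauchy x (0<1/* 0<B (0<½* 0<d))
      N , y-close = cauchy y (0<1/* 0<A (0<½* 0<d))
  in
  (K ℕ.⊔ L) ℕ.⊔ (M ℕ.⊔ N) , λ m n ≤m ≤n →
  let KL≤m = ℕ.m⊔n≤o⇒m≤o (K ℕ.⊔ L) (M ℕ.⊔ N) ≤m
      KL≤n = ℕ.m⊔n≤o⇒m≤o (K ℕ.⊔ L) (M ℕ.⊔ N) ≤n
      MN≤m = ℕ.m⊔n≤o⇒n≤o (K ℕ.⊔ L) (M ℕ.⊔ N) ≤m
      MN≤n = ℕ.m⊔n≤o⇒n≤o (K ℕ.⊔ L) (M ℕ.⊔ N) ≤n
      xm = seq x m
      xn = seq x n
      ym = seq y m
      yn = seq y n
  in begin-strict
  ∣ xm ℚ.* ym ℚ.- xn ℚ.* yn ∣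
    ≡⟨ cong ∣_∣ (*-difference xm ym xn yn) ⟩
  ∣ xm ℚ.* (ym ℚ.- yn) ℚ.+ yn ℚ.* (xm ℚ.- xn) ∣
    ≤⟨ ℚ.∣p+q∣≤∣p∣+∣q∣ (xm ℚ.* (ym ℚ.- yn)) (yn ℚ.* (xm ℚ.- xn)) ⟩
  ∣ xm ℚ.* (ym ℚ.- yn) ∣ ℚ.+ ∣ yn ℚ.* (xm ℚ.- xn) ∣
    <⟨ ℚ.+-mono-<
         (product-small {d = d} 0<A (x≤A m (ℕ.m⊔n≤o⇒m≤o K L KL≤m))
           (y-close m n (ℕ.m⊔n≤o⇒n≤o M N MN≤m) (ℕ.m⊔n≤o⇒n≤o M N MN≤n)))
         (product-small {d = d} 0<B (y≤B n (ℕ.m⊔n≤o⇒n≤o K L KL≤n))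
           (x-close m n (ℕ.m⊔n≤o⇒m≤o M N MN≤m) (ℕ.m⊔n≤o⇒m≤o M N MN≤n))) ⟩
  ½ ℚ.* d ℚ.+ ½ ℚ.* d
    ≡⟨ halves d ⟩
  d ∎
  where open ℚ.≤-Reasoning

-- The terms of y are bounded away from 0 only from some index N on, so the
-- sequence of inverses starts there.
inverse : (y : ℝ) → 0ℝ < y → ℝ
inverse y (d , 0<d , N , d≤y) = record
  { seq    = λ n → 1/ (y′ n)
  ; cauchy = λ {e} 0<e → let M , close = cauchy y (0<* (0<* 0<e 0<d) 0<d) in
      M , λ m n ≤m ≤n → begin-strict
        ∣ 1/ (y′ m) ℚ.- 1/ (y′ n) ∣
          ≡⟨ cong ∣_∣ (1/-difference (y′ m) (y′ n)) ⟩
        ∣ (y′ n ℚ.- y′ m) ℚ.* (1/ (y′ m) ℚ.* 1/ (y′ n)) ∣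
          ≡⟨ ℚ.∣p*q∣≡∣p∣*∣q∣ (y′ n ℚ.- y′ m) (1/ (y′ m) ℚ.* 1/ (y′ n)) ⟩
        ∣ y′ n ℚ.- y′ m ∣ ℚ.* ∣ 1/ (y′ m) ℚ.* 1/ (y′ n) ∣
          ≤⟨ ℚ.*-monoˡ-≤-nonNeg ∣ y′ n ℚ.- y′ m ∣ {{ℚ.∣-∣-nonNeg (y′ n ℚ.- y′ m)}} (inverses≤ m n) ⟩
        ∣ y′ n ℚ.- y′ m ∣ ℚ.* (1/ d ℚ.* 1/ d)
          <⟨ ℚ.*-monoˡ-<-pos (1/ d ℚ.* 1/ d)
               (close (N ℕ.+ n) (N ℕ.+ m) (ℕ.m≤n⇒m≤o+n N ≤n) (ℕ.m≤n⇒m≤o+n N ≤m)) ⟩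
        ((e ℚ.* d) ℚ.* d) ℚ.* (1/ d ℚ.* 1/ d)
          ≡⟨ regroup e d (1/ d) ⟩
        e ℚ.* ((d ℚ.* 1/ d) ℚ.* (d ℚ.* 1/ d))
          ≡⟨ cong (λ z → e ℚ.* (z ℚ.* z)) (ℚ.*-inverseʳ d) ⟩
        e ℚ.* (1ℚ ℚ.* 1ℚ)
          ≡⟨ ℚ.*-identityʳ e ⟩
        e ∎
  }
  where
  open ℚ.≤-Reasoning

  y′ : ℕ → ℚ
  y′ n = seq y (N ℕ.+ n)

  d≤y′ : ∀ n → d ≤ℚ y′ n
  d≤y′ n = subst (_≤ℚ y′ n) (ℚ.+-identityˡ d) (d≤y (N ℕ.+ n) (ℕ.m≤m+n N n))

  instance
    d>0 : Positive d
    d>0 = ℚ.positive 0<d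
    d≢0 : NonZero d
    d≢0 = ℚ.pos⇒nonZero d
    y′>0 : ∀ {n} → Positive (y′ n)
    y′>0 {n} = ℚ.positive (ℚ.<-≤-trans 0<d (d≤y′ n))
    y′≢0 : ∀ {n} → NonZero (y′ n)
    y′≢0 {n} = ℚ.pos⇒nonZero (y′ n)
    1/d>0 : Positive (1/ d)
    1/d>0 = ℚ.1/pos⇒pos d
    1/d²>0 : Positive (1/ d ℚ.* 1/ d)
    1/d²>0 = ℚ.pos*pos⇒pos (1/ d) (1/ d)
    1/y′>0 : ∀ {n} → Positive (1/ (y′ n))
    1/y′>0 {n} = ℚ.1/pos⇒pos (y′ n)

  inverses≤ : ∀ m n → ∣ 1/ (y′ m) ℚ.* 1/ (y′ n) ∣ ≤ℚ 1/ d ℚ.* 1/ d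
  inverses≤ m n = begin
    ∣ 1/ (y′ m) ℚ.* 1/ (y′ n) ∣
      ≡⟨ ℚ.0≤p⇒∣p∣≡p (ℚ.<⇒≤ (0<* (ℚ.positive⁻¹ (1/ (y′ m))) (ℚ.positive⁻¹ (1/ (y′ n))))) ⟩
    1/ (y′ m) ℚ.* 1/ (y′ n)
      ≤⟨ ℚ.*-monoʳ-≤-nonNeg (1/ (y′ n)) {{ℚ.pos⇒nonNeg (1/ (y′ n))}} (1/-antimono-≤ (d≤y′ m)) ⟩
    1/ d ℚ.* 1/ (y′ n)
      ≤⟨ ℚ.*-monoˡ-≤-nonNeg (1/ d) {{ℚ.pos⇒nonNeg (1/ d)}} (1/-antimono-≤ (d≤y′ n)) ⟩
    1/ d ℚ.* 1/ d ∎

  regroup : ∀ e d z → ((e ℚ.* d) ℚ.* d) ℚ.* (z ℚ.* z) ≡ e ℚ.* ((d ℚ.* z) ℚ.* (d ℚ.* z))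
  regroup = solve 3 (λ e d z →
    ((e :* d) :* d) :* (z :* z) := e :* ((d :* z) :* (d :* z))) refl
    where open +-*-Solver

_/_ : ℝ → (y : ℝ) → {0ℝ < y} → ℝ
(x / y) {0<y} = x * inverse y 0<y

------------------------------------------------------------------------
-- Real powers

private
  open module ℚ-Exp = Exp ℚ.+-*-rawSemiring using () renaming (_^_ to _^ℚ_)

-- n ^ r ≤ s for a rational exponent r = a / b in lowest terms, b > 0, and
-- n ≥ 1: n ^ r is the non-negative b-th root of n ^ a, so the inequality
-- means s ≥ 0 and n ^ a ≤ s ^ b.  If a is negative, both sides are
-- multiplied by n ^ (- a).
RationalPower≤ : ℕ → ℚ → ℚ → Set
RationalPower≤ n r s = 0ℚ ≤ℚ s × compare (↥ r)
  where
  b = ↧ₙ r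
  compare : ℤ → Set
  compare (+ a)    = ℚ.fromℤ (+ n) ^ℚ a ≤ℚ s ^ℚ b
  compare -[1+ a ] = 1ℚ ≤ℚ (s ^ℚ b) ℚ.* (ℚ.fromℤ (+ n) ^ℚ suc a)

-- For n ≥ 1 and x real, n ^ x is the supremum of the n ^ r over all
-- rationals r < x; it is at most s iff s is an upper bound of these powers.
Power≤ : ℕ → ℝ → ℚ → Set
Power≤ n x s = ∀ r → fromℚ r < x → RationalPower≤ n r s

------------------------------------------------------------------------
-- The exponent 1 - (1 + ε) / (t - c - 1 + ε)

denominator : (c t : ℕ) → ℝ → ℝ
denominator c t ε = fromNat t - fromNat c - 1ℝ + ε

0<denominator : ∀ c t ε → c ℕ.+ 3 ℕ.≤ t → 0ℝ < ε → 0ℝ < denominator c t ε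
0<denominator c t ε c+3≤t (d , 0<d , N , d≤ε) = d , 0<d , N , λ n ≤n →
  ℚ.+-mono-≤ 0≤t-c-1 (subst (_≤ℚ seq ε n) (ℚ.+-identityˡ d) (d≤ε n ≤n))
  where
  open +-*-Solver
  c+1≤t : fromℕ c ℚ.+ 1ℚ ≤ℚ fromℕ t
  c+1≤t = subst (_≤ℚ fromℕ t) (sym (fromℕ-suc c))
    (fromℕ-mono (ℕ.≤-trans (subst (ℕ._≤ c ℕ.+ 3) (ℕ.+-comm c 1) (ℕ.+-monoʳ-≤ c (s≤s z≤n))) c+3≤t))
  0≤t-c-1 : 0ℚ ≤ℚ (fromℕ t ℚ.- fromℕ c) ℚ.- 1ℚ
  0≤t-c-1 = subst₂ _≤ℚ_ (ℚ.+-inverseʳ (fromℕ c ℚ.+ 1ℚ)) (shift (fromℕ t) (fromℕ c) 1ℚ)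
    (ℚ.+-monoˡ-≤ (ℚ.- (fromℕ c ℚ.+ 1ℚ)) c+1≤t)
    where
    shift : ∀ t c u → t ℚ.- (c ℚ.+ u) ≡ (t ℚ.- c) ℚ.- u
    shift = solve 3 (λ t c u → t :- (c :+ u) := (t :- c) :- u) refl

exponent : (c t : ℕ) → c ℕ.+ 3 ℕ.≤ t → (ε : ℝ) → 0ℝ < ε → ℝ
exponent c t c+3≤t ε 0<ε =
  1ℝ - ((1ℝ + ε) / denominator c t ε) {0<denominator c t ε c+3≤t 0<ε}

{-# OPTIONS --safe #-}

-- Let F be triangle-free with minimum degree m, where n ≤ 3 m + σ and σ = o(n).
--
-- Take a partition of the vertices into atoms.  The vertices whose neighbourhood
-- fills more than half of some atom are coloured by such an atom.  If a vertex
-- w remains, the conditional expectation φ of its neighbourhood on the atoms is at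
-- most 1/2 everywhere.  Either the number of edges weighted by φ ⊗ φ is large, and
-- refining the partition by the neighbourhood, which is independent, decreases an
-- energy by a constant fraction, or 2 φ is a fractional set of measure 2/3 spanning
-- few edges.  The first case occurs less than 1290 times, which gives at most 2 ^ 1290
-- colours.  In the second case F is close to a complete bipartite graph: it has a
-- large independent set, and its complement D has m + τ vertices.
--
-- If τ > 10 σ, then D can be coloured by boundedly many colours, as the edges in D
-- join vertices of large degree sum and there is no 5-cycle in D.  If τ ≤ 10 σ,
-- then only O(σ) vertices of D have neighbours in D, and the neighbourhoods of
-- adjacent ones among them are complementary in the independent set up to O(σ)
-- vertices.  Hence odd cycles in D have length at least of order n / σ, and, by a
-- ball-growing argument in the spirit of Kierstead, Szemerédi and Trotter, D has
-- a colouring with j + 1 colours as soon as σ (σ / n) ^ j is smaller than a suitable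
-- negative power of log n.
module Submission where

open import Defs using (ℝ; 0ℝ; _<_; IsDeficiency; Power≤; exponent)
open import Defs using (Graph; TriangleFree; Colourable; δ; χ; chromaticNumber; IsLeast; least; Admissible; IsMaxMinDegree)
open import Defs using (fromℚ; inverse; denominator; 0<denominator; RationalPower≤)
open import Data.Nat.Base using (ℕ; _+_; _^_; _≤_)
open import Data.Product.Base using (∃; _×_)

import Algebra.Definitions.RawSemiring as Exp
import Algebra.Properties.Semiring.Sum
open import Data.Bool.Base using (Bool; true; false; T; _∧_; _∨_; not)
open import Data.Bool.Properties using (T?; T-∧; T-∨; ∨-comm; ∧-comm; ∧-zeroʳ; ¬-not)
open import Data.Empty using (⊥; ⊥-elim)
open import Data.Fin.Base as Fin using (Fin; zero; suc; fromℕ<; toℕ; finToFun; funToFin)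
import Data.Fin.Properties as Fin
import Data.Fin.Subset as Subset
open import Data.Integer.Base as ℤ using (ℤ; +_; -[1+_]; 0ℤ)
import Data.Integer.Properties as ℤ
open import Data.Integer.Tactic.RingSolver using () renaming (solve-∀ to solve-∀ᶻ)
open import Data.List.Base using ([]; _∷_)
open import Data.Nat.Base using (zero; suc; pred; _*_; _∸_; _⊔_; _⊓_; _!; _≡ᵇ_; _<ᵇ_; z≤n; s≤s; s≤s⁻¹; NonZero; >-nonZero) renaming (_<_ to _<ⁿ_)
open import Data.Nat.Divisibility using (_∣_; ∣-trans; m∣m*n; m≤n⇒m!∣n!; quotient)
open import Data.Nat.DivMod using (_/_; _%_; m≡m%n+[m/n]*n; m%n<n; m/n*n≤m; m*n/n≡m; /-monoˡ-≤; m<n⇒m%n≡m; [m+kn]%n≡m%n)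
open import Data.Nat.Properties
open import Data.Nat.Tactic.RingSolver using (solve-∀; solve)
open import Data.Product.Base using (Σ; _,_; _,′_; proj₁; proj₂)
open import Data.Rational.Base as ℚ using (ℚ; 0ℚ; 1ℚ)
import Data.Rational.Literals as ℚ using (fromℤ)
import Data.Rational.Properties as ℚ
open import Data.Rational.Solver using (module +-*-Solver)
import Data.Rational.Unnormalised.Base as ℚᵘ
import Data.Rational.Unnormalised.Properties as ℚᵘ
open import Data.Sum.Base using (_⊎_; inj₁; inj₂; [_,_]′)
open import Data.Unit.Base using (tt)
import Data.Vec.Base as Vec
import Data.Vec.Functional as Vector
open import Function.Base using (_∘_; id; _$_; case_of_)
open import Function.Bundles using (Inverse; Injection; module Equivalence)
open import Function.Properties.Inverse using (↔-sym; ↔⇒↣)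
open import Relation.Binary.PropositionalEquality
open import Relation.Nullary using (¬_; Dec; yes; no; contradiction)
open import Relation.Nullary.Decidable using (⌊_⌋; toWitness; fromWitness; map′; ¬?; _×-dec_)

open ℝ using (seq; cauchy)

private module ∑ℕ = Algebra.Properties.Semiring.Sum +-*-semiring
open ∑ℕ using (sum; sum-cong-≗; ∑-distrib-+; ∑-comm)

-- The bounds 2 ^ 1290, 11 and j + 3 are alternatives, not summands. With c = 10 ^ 391 and j = t - c
-- - 2 each of them is at most j + 1 + c = t - 1, so a graph of too small defect has χ < t. The
-- exponent is decided by the price of a round of ball growing. The O(σ) vertices to be coloured
-- shrink by a factor q in each round, for balls of radius q l with l about log n. The length n / σ
-- of odd cycles leaves room for q of order n / (σ l), so σ < q ^ j amounts to σ ^ (j + 1) < n ^ j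
-- up to logarithms, which ε absorbs. Two new colours per round would halve j. Therefore the even
-- layers are shielded by the odd ones: the colour of the even layers can be used again, and a round
-- costs a single new colour. The passage from the fractional set to a bipartition rests on x (1 -
-- x) < 0.1716 = 0.22 · 0.78, which excludes 0.22 ≤ x ≤ 0.78; this decides how few edges are few
-- enough, and so the size of an energy step and the number 1290.

infixl 6 _⊕_
infixl 7 _⊗_

-- Inequalities between natural numbers

_⊕_ : ∀ {a b c d} → a ≤ b → c ≤ d → a + c ≤ b + d
_⊕_ = +-mono-≤

_⊗_ : ∀ {a b} k → a ≤ b → k * a ≤ k * b
_⊗_ k = *-monoʳ-≤ k

-- A Farkas certificate: l ≤ r is a combination of the hypotheses, and the
-- equation is an identity for the ring solver.
linear : ∀ {a b l r} k → l ≤ r → a + r + k ≡ b + l → a ≤ b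
linear {a} {b} {l} {r} k l≤r eq = +-cancelʳ-≤ r a b $ begin
  a + r     ≤⟨ m≤m+n (a + r) k ⟩
  a + r + k ≡⟨ eq ⟩
  b + l     ≤⟨ +-monoʳ-≤ b l≤r ⟩
  b + r     ∎
  where open ≤-Reasoning

^-distrib-* : ∀ a b k → (a * b) ^ k ≡ a ^ k * b ^ k
^-distrib-* a b zero    = refl
^-distrib-* a b (suc k) = trans (cong (a * b *_) (^-distrib-* a b k)) (regroup a b (a ^ k) (b ^ k))
  where
  regroup : ∀ a b c d → a * b * (c * d) ≡ a * c * (b * d)
  regroup = solve-∀

-- Finite sums

∑-mono : ∀ {n} {f g : Fin n → ℕ} → (∀ i → f i ≤ g i) → sum f ≤ sum g
∑-mono {zero}  f≤g = z≤n
∑-mono {suc n} f≤g = +-mono-≤ (f≤g zero) (∑-mono (f≤g ∘ suc))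

∑-const : ∀ n c → sum {n} (λ _ → c) ≡ n * c
∑-const zero    c = refl
∑-const (suc n) c = cong (_+_ c) (∑-const n c)

term≤∑ : ∀ {n} (f : Fin n → ℕ) i → f i ≤ sum f
term≤∑ f zero    = m≤m+n _ _
term≤∑ f (suc i) = m≤n⇒m≤o+n (f zero) (term≤∑ (f ∘ suc) i)

∑-*ˡ : ∀ {n} c (f : Fin n → ℕ) → c * sum f ≡ sum (λ i → c * f i)
∑-*ˡ = ∑ℕ.*-distribˡ-sum

∑-*ʳ : ∀ {n} c (f : Fin n → ℕ) → sum f * c ≡ sum (λ i → f i * c)
∑-*ʳ = ∑ℕ.*-distribʳ-sum

∑-product : ∀ {m n} (f : Fin m → ℕ) (g : Fin n → ℕ) →
  sum f * sum g ≡ sum λ i → sum λ j → f i * g j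
∑-product f g = trans (∑-*ʳ (sum g) f)
  (sum-cong-≗ λ i → ∑-*ˡ (f i) g)

-- Sets of vertices

⟦_⟧ : Bool → ℕ
⟦ false ⟧ = 0
⟦ true ⟧  = 1

⟦⟧≤1 : ∀ b → ⟦ b ⟧ ≤ 1
⟦⟧≤1 false = z≤n
⟦⟧≤1 true  = ≤-refl

⟦⟧-true : ∀ {b} → T b → ⟦ b ⟧ ≡ 1
⟦⟧-true {true} _ = refl

⟦⟧-false : ∀ {b} → ¬ T b → ⟦ b ⟧ ≡ 0
⟦⟧-false {false} _ = refl
⟦⟧-false {true}  f = contradiction tt f

⟦⟧-mono : ∀ {a b} → (T a → T b) → ⟦ a ⟧ ≤ ⟦ b ⟧
⟦⟧-mono {false}         f = z≤n
⟦⟧-mono {true}  {true}  f = ≤-refl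
⟦⟧-mono {true}  {false} f = ⊥-elim (f tt)

⟦⟧-idem : ∀ b → ⟦ b ⟧ * ⟦ b ⟧ ≡ ⟦ b ⟧
⟦⟧-idem false = refl
⟦⟧-idem true  = refl

⟦⟧-∧ : ∀ a b → ⟦ a ∧ b ⟧ ≡ ⟦ a ⟧ * ⟦ b ⟧
⟦⟧-∧ false b = refl
⟦⟧-∧ true  b = sym (+-identityʳ ⟦ b ⟧)

⟦⟧-not : ∀ b → ⟦ b ⟧ + ⟦ not b ⟧ ≡ 1
⟦⟧-not false = refl
⟦⟧-not true  = refl

⟦⟧*-mono : ∀ b {x y} → (T b → x ≤ y) → ⟦ b ⟧ * x ≤ ⟦ b ⟧ * y
⟦⟧*-mono false f = z≤n
⟦⟧*-mono true  f = *-monoʳ-≤ 1 (f tt)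

T-not : ∀ {b} → ¬ T b → T (not b)
T-not {false} _ = tt
T-not {true}  f = f tt

not-T : ∀ {b} → T (not b) → ¬ T b
not-T {false} _ ()

∧-intro : ∀ {a b} → T a → T b → T (a ∧ b)
∧-intro p q = Equivalence.from T-∧ (p , q)

∧-elim : ∀ {a b} → T (a ∧ b) → T a × T b
∧-elim = Equivalence.to T-∧

∨-elim : ∀ {a b} → T (a ∨ b) → T a ⊎ T b
∨-elim = Equivalence.to T-∨

∨-introˡ : ∀ {a b} → T a → T (a ∨ b)
∨-introˡ = Equivalence.from T-∨ ∘ inj₁

∨-introʳ : ∀ {a b} → T b → T (a ∨ b)
∨-introʳ = Equivalence.from T-∨ ∘ inj₂

VertexSet : ℕ → Set
VertexSet n = Fin n → Bool

infix 4 _∈_ _∉_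
_∈_ _∉_ : ∀ {n} → Fin n → VertexSet n → Set
x ∈ X = T (X x)
x ∉ X = ¬ x ∈ X

infixr 6 _∪_
infixr 7 _∩_
infixl 7 _∖_
_∪_ _∩_ _∖_ : ∀ {n} → VertexSet n → VertexSet n → VertexSet n
(X ∪ Y) x = X x ∨ Y x
(X ∩ Y) x = X x ∧ Y x
(X ∖ Y) x = X x ∧ not (Y x)

∁ : ∀ {n} → VertexSet n → VertexSet n
∁ X x = not (X x)

exists : ∀ {n} → (Fin n → Bool) → Bool
exists p = ⌊ Fin.any? (λ x → T? (p x)) ⌋

exists-intro : ∀ {n} {p : Fin n → Bool} x → T (p x) → T (exists p)
exists-intro x px = fromWitness (x , px)

exists-elim : ∀ {n} {p : Fin n → Bool} → T (exists p) → ∃ λ x → T (p x)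
exists-elim = toWitness

card : ∀ {n} → VertexSet n → ℕ
card X = sum λ x → ⟦ X x ⟧

card-mono : ∀ {n} {X Y : VertexSet n} → (∀ x → x ∈ X → x ∈ Y) → card X ≤ card Y
card-mono f = ∑-mono λ x → ⟦⟧-mono (f x)

module _ {n} {X Y W : VertexSet n} where

  card-cover : (∀ x → x ∈ W → x ∈ X ⊎ x ∈ Y) → card W ≤ card X + card Y
  card-cover f = ≤-trans (∑-mono λ x → pointwise (f x)) (≤-reflexive (∑-distrib-+ (⟦_⟧ ∘ X) (⟦_⟧ ∘ Y)))
    where
    pointwise : ∀ {w x y} → (T w → T x ⊎ T y) → ⟦ w ⟧ ≤ ⟦ x ⟧ + ⟦ y ⟧
    pointwise {false} f = z≤n
    pointwise {true} {true} f = s≤s z≤n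
    pointwise {true} {false} {true} f = ≤-refl
    pointwise {true} {false} {false} f = ⊥-elim ([ id , id ]′ (f tt))

  card-disjoint : (∀ x → x ∈ X → x ∈ W) → (∀ x → x ∈ Y → x ∈ W) →
    (∀ x → x ∈ X → x ∉ Y) → card X + card Y ≤ card W
  card-disjoint f g d = ≤-trans (≤-reflexive (sym (∑-distrib-+ (⟦_⟧ ∘ X) (⟦_⟧ ∘ Y))))
    (∑-mono λ x → pointwise (f x) (g x) (d x))
    where
    pointwise : ∀ {w x y} → (T x → T w) → (T y → T w) → (T x → ¬ T y) → ⟦ x ⟧ + ⟦ y ⟧ ≤ ⟦ w ⟧
    pointwise {w}     {false} {false} f g d = z≤n
    pointwise {true}  {false} {true}  f g d = ≤-refl
    pointwise {true}  {true}  {false} f g d = ≤-refl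
    pointwise {false} {false} {true}  f g d = ⊥-elim (g tt)
    pointwise {false} {true}          f g d = ⊥-elim (f tt)
    pointwise {true}  {true}  {true}  f g d = ⊥-elim (d tt tt)

card≤n : ∀ {n} (X : VertexSet n) → card X ≤ n
card≤n {n} X = ≤-trans (∑-mono λ x → ⟦⟧≤1 (X x)) (≤-reflexive (trans (∑-const n 1) (*-identityʳ n)))

card-∁ : ∀ {n} (X : VertexSet n) → card X + card (∁ X) ≡ n
card-∁ {n} X = trans (sym (∑-distrib-+ (⟦_⟧ ∘ X) (⟦_⟧ ∘ ∁ X)))
  (trans (sum-cong-≗ λ x → ⟦⟧-not (X x)) (trans (∑-const n 1) (*-identityʳ n)))

card-pos : ∀ {n} {X : VertexSet n} x → x ∈ X → 1 ≤ card X
card-pos {X = X} x x∈X = ≤-trans (≤-reflexive (sym (⟦⟧-true x∈X))) (term≤∑ (⟦_⟧ ∘ X) x)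

card-nonempty : ∀ {n} (X : VertexSet n) → 1 ≤ card X → ∃ λ x → x ∈ X
card-nonempty {n} X pos with Fin.any? (λ x → T? (X x))
... | yes p = p
... | no ¬p = contradiction (≤-trans pos (≤-reflexive
  (trans (sum-cong-≗ λ x → ⟦⟧-false λ x∈X → ¬p (x , x∈X)) (trans (∑-const n 0) (*-zeroʳ n))))) λ ()

-- Graphs

module Adjacency {n} (F : Graph n) where
  open Graph F public

  A : Fin n → Fin n → ℕ
  A x y = ⟦ adjacent x y ⟧

  A-sym : ∀ x y → A x y ≡ A y x
  A-sym x y = cong ⟦_⟧ (symmetric x y)

  ~-sym : ∀ {x y} → x ~ y → y ~ x
  ~-sym {x} {y} = subst T (symmetric x y)

  deg : Fin n → ℕ
  deg x = card (adjacent x)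

  Independent : VertexSet n → Set
  Independent X = ∀ u v → u ∈ X → v ∈ X → ¬ u ~ v

  -- Colours are natural numbers and the values outside `X` are arbitrary, so colourings of pieces
  -- can be combined by shifting one of them.
  ColourableOn : VertexSet n → ℕ → Set
  ColourableOn X k = Σ (Fin n → ℕ) λ c →
    (∀ x → x ∈ X → c x <ⁿ k) × (∀ u v → u ∈ X → v ∈ X → u ~ v → c u ≢ c v)

  independent⇒colourableOn : ∀ {X} → Independent X → ColourableOn X 1
  independent⇒colourableOn ind = (λ _ → 0) , (λ _ _ → s≤s z≤n) ,
    λ u v u∈X v∈X u~v _ → ind u v u∈X v∈X u~v

  colourableOn-∪ : ∀ {X Y W k l} → (∀ x → x ∈ W → x ∈ X ⊎ x ∈ Y) →
    ColourableOn X k → ColourableOn Y l → ColourableOn W (k + l)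
  colourableOn-∪ {X} {Y} {W} {k} {l} cover (c , c< , c-proper) (d , d< , d-proper) =
    e , e< , e-proper
    where
    e : Fin n → ℕ
    e x with T? (X x)
    ... | yes _ = c x
    ... | no  _ = k + d x
    e< : ∀ x → x ∈ W → e x <ⁿ k + l
    e< x x∈W with T? (X x) | cover x x∈W
    ... | yes x∈X | _         = <-≤-trans (c< x x∈X) (m≤m+n k l)
    ... | no  _   | inj₂ x∈Y  = +-monoʳ-< k (d< x x∈Y)
    ... | no  x∉X | inj₁ x∈X  = contradiction x∈X x∉X
    e-proper : ∀ u v → u ∈ W → v ∈ W → u ~ v → e u ≢ e v
    e-proper u v u∈W v∈W u~v eq with T? (X u) | T? (X v) | cover u u∈W | cover v v∈W
    ... | yes p | yes q | _ | _ = c-proper u v p q u~v eq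
    ... | yes p | no  _ | _ | _ = <-irrefl eq (<-≤-trans (c< u p) (m≤m+n k (d v)))
    ... | no  _ | yes q | _ | _ = <-irrefl (sym eq) (<-≤-trans (c< v q) (m≤m+n k (d u)))
    ... | no  p | no  q | inj₂ r | inj₂ s = d-proper u v r s u~v (+-cancelˡ-≡ k _ _ eq)
    ... | no  p | no  q | inj₁ r | _ = contradiction r p
    ... | no  p | no  q | _ | inj₁ s = contradiction s q

  colourableOn⇒colourable : ∀ {X k} → (∀ x → x ∈ X) → ColourableOn X k → Colourable F k
  colourableOn⇒colourable all (c , c< , proper) = (λ x → fromℕ< (c< x (all x))) ,
    λ u v u~v eq → proper u v (all u) (all v) u~v
      (trans (sym (Fin.toℕ-fromℕ< _)) (trans (cong toℕ eq) (Fin.toℕ-fromℕ< _)))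

colourable-mono : ∀ {n} (F : Graph n) {k l} → k ≤ l → Colourable F k → Colourable F l
colourable-mono F k≤l (c , proper) = (λ x → Fin.inject≤ (c x) k≤l) ,
  λ u v u~v eq → proper u v u~v (Fin.inject≤-injective k≤l k≤l (c u) (c v) eq)

-- Exponential growth

bernoulli : ∀ q k → q ^ k + k * q ^ pred k ≤ suc q ^ k
bernoulli q zero          = ≤-refl
bernoulli q (suc zero)    = ≤-reflexive (identity q)
  where
  identity : ∀ q → q * 1 + 1 * 1 ≡ suc q * 1
  identity = solve-∀
bernoulli q (suc (suc k)) = linear (suc k * q ^ k) (suc q ⊗ bernoulli q (suc k))
  (identity q k (q ^ k) (suc q ^ suc k))
  where
  identity : ∀ q k a b → q * (q * a) + (suc (suc k)) * (q * a) + suc q * b + suc k * a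
                       ≡ suc q * b + suc q * (q * a + suc k * a)
  identity = solve-∀

double≤pow : ∀ q → .{{NonZero q}} → 2 * q ^ q ≤ suc q ^ q
double≤pow q@(suc p) = ≤-trans (≤-reflexive (cong (λ c → q ^ q + c) (+-identityʳ (q ^ q)))) (bernoulli q q)

-- By Bernoulli (1 + 1 / q) ^ q ≥ 2; the l-th power is taken and cleared of denominators.
pow-growth : ∀ q l → .{{NonZero q}} → 2 ^ l * q ^ (q * l) ≤ suc q ^ (q * l)
pow-growth q l = begin
  2 ^ l * q ^ (q * l)   ≡⟨ cong (2 ^ l *_) (sym (^-*-assoc q q l)) ⟩
  2 ^ l * (q ^ q) ^ l   ≡⟨ sym (^-distrib-* 2 (q ^ q) l) ⟩
  (2 * q ^ q) ^ l       ≤⟨ ^-monoˡ-≤ l (double≤pow q) ⟩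
  (suc q ^ q) ^ l       ≡⟨ ^-*-assoc (suc q) q l ⟩
  suc q ^ (q * l)       ∎
  where open ≤-Reasoning

-- Without a slow step every step gains more than the factor `suc q` / `q`, and these factors
-- multiply.
slow-step : ∀ q (b : ℕ → ℕ) r →
  (∃ λ i → i <ⁿ r × q * b (suc i) ≤ suc q * b i) ⊎ suc q ^ r * b 0 ≤ q ^ r * b r
slow-step q b zero    = inj₂ ≤-refl
slow-step q b (suc r) with slow-step q b r
... | inj₁ (i , i<r , slow) = inj₁ (i , m<n⇒m<1+n i<r , slow)
... | inj₂ fast with q * b (suc r) ≤? suc q * b r
...   | yes slow  = inj₁ (r , ≤-refl , slow)
...   | no  ¬slow = inj₂ $ begin
  suc q * suc q ^ r * b 0   ≡⟨ *-assoc (suc q) (suc q ^ r) (b 0) ⟩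
  suc q * (suc q ^ r * b 0) ≤⟨ *-monoʳ-≤ (suc q) fast ⟩
  suc q * (q ^ r * b r)     ≡⟨ swap (suc q) (q ^ r) (b r) ⟩
  q ^ r * (suc q * b r)     ≤⟨ *-monoʳ-≤ (q ^ r) (<⇒≤ (≰⇒> ¬slow)) ⟩
  q ^ r * (q * b (suc r))   ≡⟨ regroup (q ^ r) q (b (suc r)) ⟩
  q * q ^ r * b (suc r)     ∎
  where
  open ≤-Reasoning
  swap : ∀ x y z → x * (y * z) ≡ y * (x * z)
  swap = solve-∀
  regroup : ∀ x y z → x * (y * z) ≡ y * x * z
  regroup = solve-∀

-- Graphs without short odd cycles

-- Near i v x and Far i v x stand for the existence of a walk from v to x of
-- even length at most 2i, respectively of odd length at most 2i + 1, and the
-- last two hypotheses for the absence of short closed walks of odd length.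
module LocallyBipartite {n} (F : Graph n) (Z : VertexSet n) (Near Far : ℕ → Fin n → Fin n → Set)
  (near-refl : ∀ {v} → Near 0 v v)
  (near-suc  : ∀ {i v x} → Near i v x → Near (suc i) v x)
  (near-step : ∀ {i v x y} → x ∈ Z → y ∈ Z → Near i v x → T (Graph.adjacent F x y) → Far i v y)
  (far-step  : ∀ {i v x y} → x ∈ Z → y ∈ Z → Far i v x → T (Graph.adjacent F x y) → Near (suc i) v y)
  (r : ℕ)
  (near-far : ∀ {i v x} → i <ⁿ r → v ∈ Z → x ∈ Z → Near i v x → ¬ Far i v x)
  (far-far  : ∀ {i v x y} → i <ⁿ r → v ∈ Z → x ∈ Z → y ∈ Z →
     Far i v x → Far i v y → ¬ T (Graph.adjacent F x y))
  where
  open Adjacency F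

  N : VertexSet n → VertexSet n → VertexSet n
  N R X y = R y ∧ exists λ x → X x ∧ adjacent x y

  N-intro : ∀ R X {x y} → y ∈ R → x ∈ X → x ~ y → y ∈ N R X
  N-intro R X y∈R x∈X x~y = ∧-intro y∈R (exists-intro _ (∧-intro x∈X x~y))

  N-elim : ∀ R X {y} → y ∈ N R X → y ∈ R × ∃ λ x → x ∈ X × x ~ y
  N-elim R X {y} p =
    let y∈R , q = ∧-elim {R y} p
        x , s   = exists-elim q
    in y∈R , x , ∧-elim s

  module Balls (R : VertexSet n) (R⊆Z : ∀ x → x ∈ R → x ∈ Z) (v : Fin n) (v∈R : v ∈ R) where

    -- The sets are cumulative, and `Odd i` contains all neighbours of `Even i` in `R`. Hence the
    -- edges that leave a ball start in `Odd i` and end in `Even (suc i)`.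
    Even Odd : ℕ → VertexSet n
    Even zero    x = ⌊ x Fin.≟ v ⌋
    Even (suc i)   = Even i ∪ N R (Odd i)
    Odd i          = N R (Even i)

    Even⊆R : ∀ i x → x ∈ Even i → x ∈ R
    Even⊆R zero    x p = subst (_∈ R) (sym (toWitness p)) v∈R
    Even⊆R (suc i) x p = [ Even⊆R i x , proj₁ ∘ N-elim R (Odd i) ]′ (∨-elim p)

    Odd⊆R : ∀ i x → x ∈ Odd i → x ∈ R
    Odd⊆R i x p = proj₁ (N-elim R (Even i) p)

    even-near : ∀ i x → x ∈ Even i → Near i v x
    odd-far   : ∀ i x → x ∈ Odd i → Far i v x
    even-near zero    x p = subst (Near 0 v) (sym (toWitness p)) near-refl
    even-near (suc i) x p with ∨-elim {Even i x} p
    ... | inj₁ q = near-suc (even-near i x q)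
    ... | inj₂ q = let x∈R , y , y∈O , y~x = N-elim R (Odd i) q in
      far-step (R⊆Z y (Odd⊆R i y y∈O)) (R⊆Z x x∈R) (odd-far i y y∈O) y~x
    odd-far i x p = let x∈R , y , y∈E , y~x = N-elim R (Even i) p in
      near-step (R⊆Z y (Even⊆R i y y∈E)) (R⊆Z x x∈R) (even-near i y y∈E) y~x

    even⇒odd : ∀ i {x y} → x ∈ Even i → y ∈ R → x ~ y → y ∈ Odd i
    even⇒odd i x∈E y∈R x~y = N-intro R (Even i) y∈R x∈E x~y

    odd⇒even : ∀ i {x y} → x ∈ Odd i → y ∈ R → x ~ y → y ∈ Even (suc i)
    odd⇒even i {y = y} x∈O y∈R x~y = ∨-introʳ {Even i y} (N-intro R (Odd i) y∈R x∈O x~y)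

    even-suc : ∀ i {x} → x ∈ Even i → x ∈ Even (suc i)
    even-suc i = ∨-introˡ

    odd-suc : ∀ i {x} → x ∈ Odd i → x ∈ Odd (suc i)
    odd-suc i p = let x∈R , y , y∈E , y~x = N-elim R (Even i) p in
      N-intro R (Even (suc i)) x∈R (even-suc i y∈E) y~x

    even-odd-disjoint : ∀ {i x} → i <ⁿ r → x ∈ Even i → x ∉ Odd i
    even-odd-disjoint {i} {x} i<r p q = near-far i<r (R⊆Z v v∈R) (R⊆Z x (Even⊆R i x p))
      (even-near i x p) (odd-far i x q)

    odd-independent : ∀ {i} → i <ⁿ r → Independent (Odd i)
    odd-independent {i} i<r x y p q = far-far i<r (R⊆Z v v∈R) (R⊆Z x (Odd⊆R i x p))
      (R⊆Z y (Odd⊆R i y q)) (odd-far i x p) (odd-far i y q)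

    size : ℕ → ℕ
    size i = card (Even i) + card (Odd i)

    1≤size : 1 ≤ size 0
    1≤size = ≤-trans (card-pos {X = Even 0} v (fromWitness refl)) (m≤m+n _ _)

    size≤2n : ∀ i → size i ≤ 2 * n
    size≤2n i = subst (size i ≤_) (cong (_+_ n) (sym (+-identityʳ n)))
      (+-mono-≤ (card≤n (Even i)) (card≤n (Odd i)))

  -- E consists of the even and O of the odd layers of disjoint balls.  The layer
  -- after the last odd layer of a ball is given up.  Its further neighbours are
  -- collected in M and may not enter E later, whence all neighbours of E lie in O
  -- and the colour of E can be used again outside E ∪ O.
  record Carving (q : ℕ) (R M : VertexSet n) : Set where
    field
      E O     : VertexSet n
      E⊆R     : ∀ x → x ∈ E → x ∈ R
      O⊆R     : ∀ x → x ∈ O → x ∈ R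
      E∩M     : ∀ x → x ∈ E → x ∉ M
      E-nbrs  : ∀ x y → x ∈ E → y ∈ R → x ~ y → y ∈ O
      O-indep : Independent O
      small   : q * card (R ∖ (E ∪ O)) ≤ q * card M + card R

  module _ (q l : ℕ) .{{_ : NonZero q}} (r≡ : r ≡ q * l) (l-large : 2 * n <ⁿ 2 ^ l) where

    -- If all r = q l steps were fast, the ball would grow by a factor 2 ^ l > 2 n.
    slow-radius : (R : VertexSet n) (R⊆Z : ∀ x → x ∈ R → x ∈ Z) (v : Fin n) (v∈R : v ∈ R) →
      let open Balls R R⊆Z v v∈R in ∃ λ i → i <ⁿ r × q * size (suc i) ≤ suc q * size i
    slow-radius R R⊆Z v v∈R with slow-step q (Balls.size R R⊆Z v v∈R) r
    ... | inj₁ p    = p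
    ... | inj₂ fast = ⊥-elim $ <-irrefl refl $ begin-strict
      2 ^ l * q ^ r         ≡⟨ cong (λ r → 2 ^ l * q ^ r) r≡ ⟩
      2 ^ l * q ^ (q * l)   ≤⟨ pow-growth q l ⟩
      suc q ^ (q * l)       ≡⟨ cong (suc q ^_) (sym r≡) ⟩
      suc q ^ r             ≡⟨ *-identityʳ _ ⟨
      suc q ^ r * 1         ≤⟨ *-monoʳ-≤ (suc q ^ r) 1≤size ⟩
      suc q ^ r * size 0    ≤⟨ fast ⟩
      q ^ r * size r        ≤⟨ *-monoʳ-≤ (q ^ r) (size≤2n r) ⟩
      q ^ r * (2 * n)       <⟨ *-monoʳ-< (q ^ r) {{m^n≢0 q r}} l-large ⟩
      q ^ r * 2 ^ l         ≡⟨ *-comm (q ^ r) (2 ^ l) ⟩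
      2 ^ l * q ^ r         ∎
      where
      open ≤-Reasoning
      open Balls R R⊆Z v v∈R

    module Step (R M : VertexSet n) (R⊆Z : ∀ x → x ∈ R → x ∈ Z) (v : Fin n) (v∈R : v ∈ R) where
      open Balls R R⊆Z v v∈R
      i∃ = slow-radius R R⊆Z v v∈R
      i = proj₁ i∃
      i<r = proj₁ (proj₂ i∃)
      slow = proj₂ (proj₂ i∃)

      ∂ M₁ R′ M′ : VertexSet n
      ∂  = Even (suc i) ∖ Even i
      M₁ = Odd (suc i) ∖ Odd i
      R′ = R ∖ (Even (suc i) ∪ Odd i)
      M′ = (M ∩ R′) ∪ M₁

      R′⊆R : ∀ x → x ∈ R′ → x ∈ R
      R′⊆R x = proj₁ ∘ ∧-elim

      R′∉Even : ∀ x → x ∈ R′ → x ∉ Even (suc i)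
      R′∉Even x p q = not-T (proj₂ (∧-elim {R x} p)) (∨-introˡ q)

      R′∉Odd : ∀ x → x ∈ R′ → x ∉ Odd i
      R′∉Odd x p q = not-T (proj₂ (∧-elim {R x} p)) (∨-introʳ {Even (suc i) x} q)

      R′-intro : ∀ x → x ∈ R → x ∉ Even (suc i) → x ∉ Odd i → x ∈ R′
      R′-intro x x∈R ¬e ¬o = ∧-intro x∈R (T-not λ p → [ ¬e , ¬o ]′ (∨-elim {Even (suc i) x} p))

      disjoint : card (Even i) + card (Odd i) + card R′ ≤ card R
      disjoint = ≤-trans (+-monoˡ-≤ (card R′) (card-disjoint {X = Even i} {Y = Odd i} {W = Even i ∪ Odd i}
          (λ x → ∨-introˡ) (λ x → ∨-introʳ {Even i x}) (λ x → even-odd-disjoint i<r)))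
        (card-disjoint {X = Even i ∪ Odd i} {Y = R′} {W = R}
          (λ x p → [ Even⊆R i x , Odd⊆R i x ]′ (∨-elim p)) R′⊆R
          (λ x p q → [ R′∉Even x q ∘ even-suc i , R′∉Odd x q ]′ (∨-elim p)))

      R′<R : suc (card R′) ≤ card R
      R′<R = ≤-trans (+-monoˡ-≤ (card R′) (≤-trans (card-pos {X = Even i} v (v∈Even i)) (m≤m+n _ (card (Odd i))))) disjoint
        where
        v∈Even : ∀ i → v ∈ Even i
        v∈Even zero    = fromWitness refl
        v∈Even (suc i) = even-suc i (v∈Even i)

      module _ (C : Carving q R′ M′) where
        private module C = Carving C

        E O : VertexSet n
        E = C.E ∪ (Even i ∖ M)
        O = C.O ∪ Odd i

        E-nbrs : ∀ x y → x ∈ E → y ∈ R → x ~ y → y ∈ O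
        E-nbrs x y x∈E y∈R x~y = case ∨-elim {C.E x} x∈E of λ where
          (inj₂ q) → ∨-introʳ {C.O y} (even⇒odd i (proj₁ (∧-elim {Even i x} q)) y∈R x~y)
          (inj₁ q) → let x∈R′ = C.E⊆R x q in case T? (Even (suc i) y) ,′ T? (Odd i y) of λ where
            (_     , yes o) → ∨-introʳ {C.O y} o
            (no ¬e , no ¬o) → ∨-introˡ (C.E-nbrs x y q (R′-intro y y∈R ¬e ¬o) x~y)
            -- Here `y` lies in the layer that was given up, so its neighbour `x` has been marked in
            -- `M₁` and was barred from `C.E`.
            (yes e , no ¬o) → contradiction
              (∨-introʳ {(M ∩ R′) x} (∧-intro (even⇒odd (suc i) e (R′⊆R x x∈R′) (~-sym x~y)) (T-not (R′∉Odd x x∈R′))))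
              (C.E∩M x q)

        O-indep : Independent O
        O-indep x y x∈O y∈O x~y = case ∨-elim {C.O x} x∈O ,′ ∨-elim {C.O y} y∈O of λ where
          (inj₁ p , inj₁ q) → C.O-indep x y p q x~y
          (inj₂ p , inj₂ q) → odd-independent i<r x y p q x~y
          (inj₁ p , inj₂ q) → R′∉Even x (C.O⊆R x p) (odd⇒even i q (R′⊆R x (C.O⊆R x p)) (~-sym x~y))
          (inj₂ p , inj₁ q) → R′∉Even y (C.O⊆R y q) (odd⇒even i p (R′⊆R y (C.O⊆R y q)) x~y)

        cover : card (R ∖ (E ∪ O)) ≤ card (R′ ∖ (C.E ∪ C.O)) + (card ∂ + card (M ∩ Even i))
        cover = ≤-trans
          (card-cover {X = R′ ∖ (C.E ∪ C.O)} {Y = ∂ ∪ (M ∩ Even i)} {W = R ∖ (E ∪ O)} split)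
          (+-monoʳ-≤ (card (R′ ∖ (C.E ∪ C.O))) (card-cover {X = ∂} {Y = M ∩ Even i} {W = ∂ ∪ (M ∩ Even i)} λ x → ∨-elim))
          where
          split : ∀ x → x ∈ R ∖ (E ∪ O) → x ∈ R′ ∖ (C.E ∪ C.O) ⊎ x ∈ ∂ ∪ (M ∩ Even i)
          split x p =
            let x∈R , x∉EO = ∧-elim {R x} p
                ¬o : x ∉ Odd i
                ¬o o = not-T x∉EO (∨-introʳ {E x} (∨-introʳ {C.O x} o))
            in case T? (Even i x) ,′ T? (M x) ,′ T? (Even (suc i) x) of λ where
              (yes e , yes m , _)      → inj₂ (∨-introʳ {∂ x} (∧-intro m e))
              (yes e , no ¬m , _)      → contradiction (∨-introˡ (∨-introʳ {C.E x} (∧-intro e (T-not ¬m)))) (not-T x∉EO)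
              (no ¬e , _     , yes e′) → inj₂ (∨-introˡ (∧-intro e′ (T-not ¬e)))
              (no ¬e , _     , no ¬e′) → inj₁ (∧-intro (R′-intro x x∈R ¬e′ ¬o)
                (T-not λ c → not-T x∉EO ([ (λ z → ∨-introˡ (∨-introˡ z)) , (λ z → ∨-introʳ {E x} (∨-introˡ z)) ]′ (∨-elim {C.E x} c))))

        marked : card M′ ≤ card (M ∩ R′) + card M₁
        marked = card-cover {X = M ∩ R′} {Y = M₁} {W = M′} λ x → ∨-elim

        M-split : card (M ∩ R′) + card (M ∩ Even i) ≤ card M
        M-split = card-disjoint {X = M ∩ R′} {Y = M ∩ Even i} {W = M} (λ x → proj₁ ∘ ∧-elim) (λ x → proj₁ ∘ ∧-elim)
          λ x p q → R′∉Even x (proj₂ (∧-elim {M x} p)) (even-suc i (proj₂ (∧-elim {M x} q)))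

        ∂-size : card (Even i) + card ∂ ≤ card (Even (suc i))
        ∂-size = card-disjoint {X = Even i} {Y = ∂} {W = Even (suc i)} (λ x → even-suc i) (λ x → proj₁ ∘ ∧-elim)
          λ x p q → not-T (proj₂ (∧-elim {Even (suc i) x} q)) p

        M₁-size : card (Odd i) + card M₁ ≤ card (Odd (suc i))
        M₁-size = card-disjoint {X = Odd i} {Y = M₁} {W = Odd (suc i)} (λ x → odd-suc i) (λ x → proj₁ ∘ ∧-elim)
          λ x p q → not-T (proj₂ (∧-elim {Odd (suc i) x} q)) p

        -- The step loses `∂` and the marked part of `Even i`. The latter is paid for by marks that
        -- disappear from `M`. By slow growth q (|∂| + |M₁|) is at most the number of vertices of
        -- the ball, which leave `R` for good; this pays for `∂` now and for the new marks later.
        small : q * card (R ∖ (E ∪ O)) ≤ q * card M + card R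
        small = linear 0
          (q ⊗ cover ⊕ C.small ⊕ q ⊗ marked ⊕ q ⊗ M-split ⊕ q ⊗ ∂-size ⊕ q ⊗ M₁-size ⊕ slow ⊕ disjoint)
          (identity q (card (R ∖ (E ∪ O))) (card (R′ ∖ (C.E ∪ C.O))) (card ∂) (card (M ∩ Even i))
            (card M′) (card R′) (card (M ∩ R′)) (card M₁) (card M) (card (Even i)) (card (Even (suc i)))
            (card (Odd i)) (card (Odd (suc i))) (card R))
          where
          identity : ∀ q w w′ d me m′ r′ mr m₁ m e e′ o o′ r →
            q * w + (q * (w′ + (d + me)) + (q * m′ + r′) + q * (mr + m₁) + q * m + q * e′ + q * o′ + suc q * (e + o) + r) + 0
            ≡ q * m + r + (q * w + q * w′ + q * m′ + q * (mr + me) + q * (e + d) + q * (o + m₁) + q * (e′ + o′) + (e + o + r′))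
          identity = solve-∀

        extend : Carving q R M
        extend = record
          { E = E ; O = O
          ; E⊆R = λ x p → [ R′⊆R x ∘ C.E⊆R x , Even⊆R i x ∘ proj₁ ∘ ∧-elim ]′ (∨-elim p)
          ; O⊆R = λ x p → [ R′⊆R x ∘ C.O⊆R x , Odd⊆R i x ]′ (∨-elim p)
          ; E∩M = λ x p x∈M → [ (λ q → C.E∩M x q (∨-introˡ (∧-intro x∈M (C.E⊆R x q))))
                              , (λ q → not-T (proj₂ (∧-elim {Even i x} q)) x∈M) ]′ (∨-elim p)
          ; E-nbrs = E-nbrs
          ; O-indep = O-indep
          ; small = small
          }

    carve : ∀ k R M → card R ≤ k → (∀ x → x ∈ R → x ∈ Z) → Carving q R M
    carve k R M R≤k R⊆Z with 1 ≤? card R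
    ... | no R-empty = record
      { E = λ _ → false ; O = λ _ → false
      ; E⊆R = λ _ () ; O⊆R = λ _ () ; E∩M = λ _ () ; E-nbrs = λ _ _ () ; O-indep = λ _ _ ()
      ; small = ≤-trans (≤-trans (*-monoʳ-≤ q (≤-trans
          (card-mono {X = R ∖ ((λ _ → false) ∪ (λ _ → false))} {Y = R} λ x → proj₁ ∘ ∧-elim {R x})
          (≤-reflexive (n<1⇒n≡0 (≰⇒> R-empty)))))
          (≤-reflexive (*-zeroʳ q))) z≤n
      }
    carve zero R M R≤k R⊆Z | yes pos = contradiction (≤-trans pos R≤k) λ ()
    carve (suc k) R M R≤k R⊆Z | yes pos =
      let v , v∈R = card-nonempty R pos
          open Step R M R⊆Z v v∈R
      in extend (carve k R′ M′ (s≤s⁻¹ (≤-trans R′<R R≤k)) (λ x → R⊆Z x ∘ R′⊆R x))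

    -- With no marks at the start, carving leaves a part `Y` of size at most |X| / q, so j rounds
    -- exhaust `X`. `O` receives the new colour `suc j`, whereas `E` takes the colour 0 that `Y` may
    -- also use: all neighbours of `E` in `X` are in `O`. The one colour granted to an empty `X` is
    -- this shared one.
    colour : ∀ j X → (∀ x → x ∈ X → x ∈ Z) → card X <ⁿ q ^ j → ColourableOn X (suc j)
    colour zero    X X⊆Z X<1 = (λ _ → 0) , (λ _ _ → s≤s z≤n) ,
      λ u _ u∈X _ _ _ → contradiction (<-≤-trans X<1 (card-pos {X = X} u u∈X)) (<-irrefl refl)
    colour (suc j) X X⊆Z X<q^ = c , c< , proper
      where
      module C = Carving (carve (card X) X (λ _ → false) ≤-refl X⊆Z)
      Y = X ∖ (C.E ∪ C.O)
      Y-small : card Y <ⁿ q ^ j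
      Y-small = *-cancelˡ-< q (card Y) (q ^ j) (≤-<-trans C.small (≤-<-trans (≤-reflexive eq) X<q^))
        where
        eq : q * card {n} (λ _ → false) + card X ≡ card X
        eq = cong (_+ card X) (trans (cong (q *_) (trans (∑-const n 0) (*-zeroʳ n))) (*-zeroʳ q))
      Y-col = colour j Y (λ x → X⊆Z x ∘ proj₁ ∘ ∧-elim) Y-small
      d = proj₁ Y-col
      d< = proj₁ (proj₂ Y-col)
      d-proper = proj₂ (proj₂ Y-col)
      Y-intro : ∀ {x} → x ∈ X → x ∉ C.E → x ∉ C.O → x ∈ Y
      Y-intro {x} x∈X ¬e ¬o = ∧-intro x∈X (T-not λ p → [ ¬e , ¬o ]′ (∨-elim {C.E x} p))
      c : Fin n → ℕ
      c x with T? (C.O x) | T? (C.E x)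
      ... | yes _ | _     = suc j
      ... | no _  | yes _ = 0
      ... | no _  | no _  = d x
      c< : ∀ x → x ∈ X → c x <ⁿ suc (suc j)
      c< x x∈X with T? (C.O x) | T? (C.E x)
      ... | yes _ | _     = ≤-refl
      ... | no _  | yes _ = s≤s z≤n
      ... | no ¬o | no ¬e = m<n⇒m<1+n (d< x (Y-intro x∈X ¬e ¬o))
      proper : ∀ u v → u ∈ X → v ∈ X → u ~ v → c u ≢ c v
      proper u v u∈X v∈X u~v eq with T? (C.O u) | T? (C.E u) | T? (C.O v) | T? (C.E v)
      ... | yes o | _     | yes o′ | _      = C.O-indep u v o o′ u~v
      ... | no ¬o | yes e | no ¬o′ | _      = ¬o′ (C.E-nbrs u v e v∈X u~v)
      ... | no ¬o | _     | no ¬o′ | yes e′ = ¬o (C.E-nbrs v u e′ u∈X (~-sym u~v))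
      ... | no ¬o | no ¬e | no ¬o′ | no ¬e′ = d-proper u v (Y-intro u∈X ¬e ¬o) (Y-intro v∈X ¬e′ ¬o′) u~v eq
      ... | yes o | _     | no ¬o′ | no ¬e′ = <-irrefl (sym eq) (d< v (Y-intro v∈X ¬e′ ¬o′))
      ... | no ¬o | no ¬e | yes o′ | _      = <-irrefl eq (d< u (Y-intro u∈X ¬e ¬o))

-- Certificates for nearly bipartite graphs

m-positive : ∀ m σ → 2000 * σ ≤ m → 1 ≤ σ → 1 ≤ m
m-positive m σ h1 h2 =
  linear (1999) (h1 ⊕ 2000 ⊗ h2) (solve (m ∷ σ ∷ []))

∁D-positive : ∀ D a n m σ → 50 * D ≤ 61 * m + 50 * σ → 3 * m ≤ n → n ≤ D + a → 2000 * σ ≤ m →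
  1 ≤ σ → 1 ≤ a
∁D-positive D a n m σ h1 h2 h3 h4 h5 =
  *-cancelˡ-≤ 50 (linear (177900) (h1 ⊕ 50 ⊗ h2 ⊕ 50 ⊗ h3 ⊕ 89 ⊗ h4 ⊕ 177950 ⊗ h5)
    (solve (D ∷ a ∷ n ∷ m ∷ σ ∷ [])))

excess-bound : ∀ τ m σ → 50 * (m + τ) ≤ 61 * m + 50 * σ → 50 * τ ≤ 11 * m + 50 * σ
excess-bound τ m σ h1 =
  linear (0) (h1) (solve (τ ∷ m ∷ σ ∷ []))

∁D-bound : ∀ τ a n m σ → m + τ + a ≤ n → n ≤ 3 * m + σ → a + τ ≤ 2 * m + σ
∁D-bound τ a n m σ h1 h2 =
  linear (0) (h1 ⊕ h2) (solve (τ ∷ a ∷ n ∷ m ∷ σ ∷ []))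

Z-bound : ∀ z τ a m σ → 28 * m * z ≤ 50 * τ * a → a + τ ≤ 2 * m + σ → 2000 * σ ≤ m →
  m * z ≤ m * (4 * τ)
Z-bound z τ a m σ h1 h2 h3 =
  *-cancelˡ-≤ 1120 (linear (479 * m * τ + 2000 * τ * τ) (40 ⊗ h1 ⊕ (2000 * τ) ⊗ h2 ⊕ τ ⊗ h3)
    (solve (z ∷ τ ∷ a ∷ m ∷ σ ∷ [])))

-- The two neighbourhoods have at least 2 m - d - d2 vertices outside `D`, so at most σ + d + d2 ≤ σ
-- + 8 τ ≤ 81 σ remain.
remainder-bound : ∀ rest f f2 d d2 z τ a m σ → rest + (f + f2) ≤ a → m ≤ f + d → m ≤ f2 + d2 →
  d ≤ z → d2 ≤ z → z ≤ 4 * τ → τ ≤ 10 * σ → a + τ ≤ 2 * m + σ → rest ≤ 81 * σ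
remainder-bound rest f f2 d d2 z τ a m σ h1 h2 h3 h4 h5 h6 h7 h8 =
  *-cancelˡ-≤ 4 (linear (d) (4 ⊗ h1 ⊕ 4 ⊗ h2 ⊕ 4 ⊗ h3 ⊕ 5 ⊗ h4 ⊕ 4 ⊗ h5 ⊕ 9 ⊗ h6 ⊕ 32 ⊗ h7
    ⊕ 4 ⊗ h8)
    (solve (rest ∷ f ∷ f2 ∷ d ∷ d2 ∷ z ∷ τ ∷ a ∷ m ∷ σ ∷ [])))

low-bound : ∀ f f2 d d2 τ a m σ → f + f2 ≤ a → m ≤ f + d → m ≤ f2 + d2 → a + τ ≤ 2 * m + σ →
  1 + 2 * d + σ ≤ τ → 1 + 2 * d2 + σ ≤ τ → 1 ≤ 0
low-bound f f2 d d2 τ a m σ h1 h2 h3 h4 h5 h6 =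
  *-cancelˡ-≤ 2 (linear (0) (2 ⊗ h1 ⊕ 2 ⊗ h2 ⊕ 2 ⊗ h3 ⊕ 2 ⊗ h4 ⊕ h5 ⊕ h6)
    (solve (f ∷ f2 ∷ d ∷ d2 ∷ τ ∷ a ∷ m ∷ σ ∷ [])))

high-bound : ∀ d τ σ → τ ≤ 2 * d + σ → 10 * σ ≤ τ → 9 * τ ≤ 20 * d
high-bound d τ σ h1 h2 =
  linear (0) (10 ⊗ h1 ⊕ h2) (solve (d ∷ τ ∷ σ ∷ []))

pentagon-defect : ∀ f1 f2 f3 f4 f5 d1 d2 d3 d4 d5 a m → m ≤ f1 + d1 → m ≤ f2 + d2 → m ≤ f3 + d3 →
  m ≤ f4 + d4 → m ≤ f5 + d5 → f1 + f2 + f3 + f4 + f5 ≤ 2 * a →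
  5 * m ≤ 2 * a + (d1 + d2 + d3 + d4 + d5)
pentagon-defect f1 f2 f3 f4 f5 d1 d2 d3 d4 d5 a m h1 h2 h3 h4 h5 h6 =
  linear (0) (h1 ⊕ h2 ⊕ h3 ⊕ h4 ⊕ h5 ⊕ h6)
    (solve (f1 ∷ f2 ∷ f3 ∷ f4 ∷ f5 ∷ d1 ∷ d2 ∷ d3 ∷ d4 ∷ d5 ∷ a ∷ m ∷ []))

pentagon-complement : ∀ u v a τ m σ → 78 * m + 100 * σ ≤ u + v → u + v ≤ 78 * m + 100 * σ →
  100 * τ + 56 * m ≤ u → u ≤ 100 * τ + 56 * m → a + τ ≤ 2 * m + σ → 100 * a ≤ 178 * m + v
pentagon-complement u v a τ m σ h1 h2 h3 h4 h5 =
  linear (0) (h1 ⊕ h4 ⊕ 100 ⊗ h5) (solve (u ∷ v ∷ a ∷ τ ∷ m ∷ σ ∷ []))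

-- The difference is governed by 178 m (u + v) - u (178 m + v) = v (178 m - u) ≥ 0, so the extreme
-- case is v = 0. In hundredths of m, 78 = 56 + 22 and 178 = 200 - 22 are the values at the largest
-- τ, about 0.22 m.
pentagon-product : ∀ u v m σ → u + v ≤ 78 * m + 100 * σ → u ≤ 178 * m →
  u * (178 * m + v) ≤ 178 * m * (78 * m + 100 * σ)
pentagon-product u v m σ h1 h2 =
  linear (0) ((178 * m) ⊗ h1 ⊕ v ⊗ h2) (solve (u ∷ v ∷ m ∷ σ ∷ []))

pentagon-final : ∀ m σ → 14000 * m * m ≤ 178 * m * (78 * m + 100 * σ) → 2000 * σ ≤ m → 1 ≤ m → 1 ≤ 0
pentagon-final m σ h1 h2 h3 =
  *-cancelˡ-≤ 1071 (linear (0) (10 ⊗ h1 ⊕ (89 * m) ⊗ h2 ⊕ (1071 * m) ⊗ h3 ⊕ 1071 ⊗ h3)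
    (solve (m ∷ σ ∷ [])))

budget-step : ∀ y y2 d τ k → 81 * τ ≤ 20 * y + 9 * τ * (1 + k) → 9 * τ ≤ 20 * d → y + d ≤ y2 →
  81 * τ ≤ 20 * y2 + 9 * τ * k
budget-step y y2 d τ k h1 h2 h3 =
  linear (0) (h1 ⊕ h2 ⊕ 20 ⊗ h3) (solve (y ∷ y2 ∷ d ∷ τ ∷ k ∷ []))

budget-final : ∀ y z τ → 81 * τ ≤ 20 * y → y ≤ z → z ≤ 4 * τ → 1 ≤ τ → 1 ≤ 0
budget-final y z τ h1 h2 h3 h4 =
  linear (0) (h1 ⊕ 20 ⊗ h2 ⊕ 20 ⊗ h3 ⊕ h4) (solve (y ∷ z ∷ τ ∷ []))

pentagon-overlap : ∀ a b c d e → a + b ≤ 1 → b + c ≤ 1 → c + d ≤ 1 → d + e ≤ 1 → e + a ≤ 1 →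
  a + b + c + d + e ≤ 2
pentagon-overlap a b c d e h1 h2 h3 h4 h5 = s≤s⁻¹ (*-cancelˡ-< 2 (a + b + c + d + e) 3
  (s≤s (linear 0 (h1 ⊕ h2 ⊕ h3 ⊕ h4 ⊕ h5) (solve (a ∷ b ∷ c ∷ d ∷ e ∷ [])))))

pentagon-u : ∀ τ m σ → 50 * τ ≤ 11 * m + 50 * σ → 100 * τ + 56 * m ≤ 78 * m + 100 * σ
pentagon-u τ m σ h1 =
  linear (0) (2 ⊗ h1) (solve (τ ∷ m ∷ σ ∷ []))

pentagon-u′ : ∀ m σ → 2000 * σ ≤ m → 78 * m + 100 * σ ≤ 178 * m
pentagon-u′ m σ h1 =
  *-cancelˡ-≤ 20 (linear (1999 * m) (h1) (solve (m ∷ σ ∷ [])))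

pentagon-scale : ∀ s a e τ m → 28 * m * s ≤ 50 * e → e ≤ 2 * (τ * a) → 5 * m ≤ 2 * a + s →
  14000 * m * m ≤ (100 * τ + 56 * m) * (100 * a)
pentagon-scale s a e τ m h1 h2 h3 =
  linear (0) (100 ⊗ h1 ⊕ 5000 ⊗ h2 ⊕ (2800 * m) ⊗ h3) (solve (s ∷ a ∷ e ∷ τ ∷ m ∷ []))

-- Graphs close to a complete bipartite graph with parts of size n / 3 and 2 n / 3

adjacent-exclusive : ∀ {n} (F : Graph n) → TriangleFree F → let open Adjacency F in
  ∀ {u v} → u ~ v → ∀ x → A x u + A x v ≤ 1
adjacent-exclusive F triangle-free {u} {v} u~v x = exclusive λ p q → triangle-free x u v (p , u~v , q)
  where
  exclusive : ∀ {a b} → (T a → ¬ T b) → ⟦ a ⟧ + ⟦ b ⟧ ≤ 1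
  exclusive {false} {b}     _ = ⟦⟧≤1 b
  exclusive {true}  {false} _ = ≤-refl
  exclusive {true}  {true}  e = ⊥-elim (e tt tt)

-- The constants are 28 / 50 = 1 - 2 a and 61 / 50 = 1 + a for a = 11 / 50.
module NearlyBipartite {n} (F : Graph n) (triangle-free : TriangleFree F) (D : VertexSet n) (m σ : ℕ)
  (∁D-indep : Adjacency.Independent F (∁ D))
  (m≤deg    : ∀ x → m ≤ Adjacency.deg F x)
  (outer    : ∀ w → w ∈ D → 28 * m ≤ 50 * card (Graph.adjacent F w ∖ D))
  (D-size   : 50 * card D ≤ 61 * m + 50 * σ)
  (3m≤n     : 3 * m ≤ n)
  (n≤3m+σ   : n ≤ 3 * m + σ)
  (1≤σ      : 1 ≤ σ)
  (σ-small  : 2000 * σ ≤ m)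
  where
  open Adjacency F
  open ≤-Reasoning

  f d f̄ : Fin n → ℕ
  f w = card (adjacent w ∖ D)
  d w = card (adjacent w ∩ D)
  f̄ w = card (∁ D ∖ adjacent w)

  a τ : ℕ
  a = card (∁ D)
  τ = card D ∸ m

  1≤m : 1 ≤ m
  1≤m = m-positive m σ σ-small 1≤σ

  deg-split : ∀ w → m ≤ f w + d w
  deg-split w = ≤-trans (m≤deg w) (card-cover {X = adjacent w ∖ D} {Y = adjacent w ∩ D} {W = adjacent w} split)
    where
    split : ∀ x → x ∈ adjacent w → x ∈ adjacent w ∖ D ⊎ x ∈ adjacent w ∩ D
    split x w~x = case T? (D x) of λ where
      (yes x∈D) → inj₂ (∧-intro w~x x∈D)
      (no x∉D)  → inj₁ (∧-intro w~x (T-not x∉D))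

  ∁D-split : ∀ w → a ≤ f w + f̄ w
  ∁D-split w = card-cover {X = adjacent w ∖ D} {Y = ∁ D ∖ adjacent w} {W = ∁ D} λ x p →
    case T? (adjacent w x) of λ where
      (yes w~x) → inj₁ (∧-intro w~x p)
      (no w≁x)  → inj₂ (∧-intro p (T-not w≁x))

  edge : ∀ {w w′} → w ~ w′ → f w + f w′ ≤ a
  edge {w} {w′} w~w′ = card-disjoint {X = adjacent w ∖ D} {Y = adjacent w′ ∖ D} {W = ∁ D}
    (λ x → proj₂ ∘ ∧-elim {adjacent w x}) (λ x → proj₂ ∘ ∧-elim {adjacent w′ x})
    (λ x p q → triangle-free w w′ x (w~w′ , proj₁ (∧-elim q) , proj₁ (∧-elim p)))

  f≤f̄ : ∀ {w w′} → w ~ w′ → f w ≤ f̄ w′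
  f≤f̄ {w} {w′} w~w′ = +-cancelʳ-≤ (f w′) (f w) (f̄ w′)
    (≤-trans (edge w~w′) (≤-trans (∁D-split w′) (≤-reflexive (+-comm (f w′) (f̄ w′)))))

  1≤a : 1 ≤ a
  1≤a = ∁D-positive (card D) a n m σ D-size 3m≤n (≤-reflexive (sym (card-∁ D))) σ-small 1≤σ

  nbr∈D : ∀ {x y} → x ∈ ∁ D → x ~ y → y ∈ D
  nbr∈D {x} {y} x∈∁D x~y = case T? (D y) of λ where
    (yes y∈D) → y∈D
    (no y∉D)  → ⊥-elim (∁D-indep x y x∈∁D (T-not y∉D) x~y)

  m≤D : m ≤ card D
  m≤D = let x , x∈∁D = card-nonempty (∁ D) 1≤a in
    ≤-trans (m≤deg x) (card-mono {X = adjacent x} {Y = D} λ y → nbr∈D x∈∁D)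

  m+τ : m + τ ≡ card D
  m+τ = m+[n∸m]≡n m≤D

  τ-bound : 50 * τ ≤ 11 * m + 50 * σ
  τ-bound = excess-bound τ m σ (subst (λ c → 50 * c ≤ 61 * m + 50 * σ) (sym m+τ) D-size)

  a-bound : a + τ ≤ 2 * m + σ
  a-bound = ∁D-bound τ a n m σ (≤-reflexive (trans (cong (_+ a) m+τ) (card-∁ D))) n≤3m+σ

  -- The missing pairs are counted from the other side: a vertex of `∁ D` has its at least m
  -- neighbours among the m + τ vertices of `D`, and so misses at most τ of them.
  nonadjacent : sum (λ y → ⟦ D y ⟧ * f̄ y) ≤ τ * a
  nonadjacent = begin
    sum (λ y → ⟦ D y ⟧ * f̄ y)
      ≡⟨ (sum-cong-≗ λ y → ∑-*ˡ ⟦ D y ⟧ λ x → ⟦ (∁ D ∖ adjacent y) x ⟧) ⟩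
    sum (λ y → sum λ x → ⟦ D y ⟧ * ⟦ (∁ D ∖ adjacent y) x ⟧)
      ≡⟨ ∑-comm (λ y x → ⟦ D y ⟧ * ⟦ (∁ D ∖ adjacent y) x ⟧) ⟩
    sum (λ x → sum λ y → ⟦ D y ⟧ * ⟦ (∁ D ∖ adjacent y) x ⟧)
      ≡⟨ sum-cong-≗ column ⟩
    sum (λ x → ⟦ not (D x) ⟧ * card (D ∖ adjacent x))
      ≤⟨ ∑-mono (λ x → bound x) ⟩
    sum (λ x → τ * ⟦ not (D x) ⟧)
      ≡⟨ ∑-*ˡ τ (λ x → ⟦ not (D x) ⟧) ⟨
    τ * a ∎
    where
    rearrange : ∀ x y → ⟦ D y ⟧ * ⟦ (∁ D ∖ adjacent y) x ⟧ ≡ ⟦ not (D x) ⟧ * ⟦ (D ∖ adjacent x) y ⟧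
    rearrange x y rewrite symmetric x y =
      trans (cong (⟦ D y ⟧ *_) (⟦⟧-∧ (not (D x)) _))
        (trans (swap ⟦ D y ⟧ ⟦ not (D x) ⟧ _) (cong (⟦ not (D x) ⟧ *_) (sym (⟦⟧-∧ (D y) _))))
      where
      swap : ∀ x y z → x * (y * z) ≡ y * (x * z)
      swap = solve-∀
    column : ∀ x → sum (λ y → ⟦ D y ⟧ * ⟦ (∁ D ∖ adjacent y) x ⟧) ≡ ⟦ not (D x) ⟧ * card (D ∖ adjacent x)
    column x = trans (sum-cong-≗ (rearrange x)) (sym (∑-*ˡ ⟦ not (D x) ⟧ λ y → ⟦ (D ∖ adjacent x) y ⟧))
    deg-bound : ∀ {x} → x ∈ ∁ D → card (D ∖ adjacent x) ≤ τ
    deg-bound {x} x∈∁D = +-cancelˡ-≤ m (card (D ∖ adjacent x)) τ (begin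
      m + card (D ∖ adjacent x)                 ≤⟨ +-monoˡ-≤ _ (m≤deg x) ⟩
      card (adjacent x) + card (D ∖ adjacent x) ≤⟨ card-disjoint {X = adjacent x} {Y = D ∖ adjacent x} {W = D}
        (λ y → nbr∈D x∈∁D) (λ y → proj₁ ∘ ∧-elim) (λ y p q → not-T (proj₂ (∧-elim {D y} q)) p) ⟩
      card D                                    ≡⟨ m+τ ⟨
      m + τ                                     ∎)
    bound : ∀ x → ⟦ not (D x) ⟧ * card (D ∖ adjacent x) ≤ τ * ⟦ not (D x) ⟧
    bound x = ≤-trans (⟦⟧*-mono (not (D x)) deg-bound) (≤-reflexive (*-comm ⟦ not (D x) ⟧ τ))

  -- `∁ D` and the rest of `D` are independent, so only these vertices are hard to colour.
  Z : VertexSet n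
  Z = D ∩ λ z → exists (adjacent z ∩ D)

  Z-intro : ∀ {z y} → z ∈ D → y ∈ D → z ~ y → z ∈ Z
  Z-intro z∈D y∈D z~y = ∧-intro z∈D (exists-intro _ (∧-intro z~y y∈D))

  Z⊆D : ∀ z → z ∈ Z → z ∈ D
  Z⊆D z = proj₁ ∘ ∧-elim

  -- A vertex z of `Z` misses all outer neighbours of some y in `D`, at least 0.56 m vertices. There
  -- are at most τ a missing pairs, a is at most about 2 m, and 2 / 0.56 < 4.
  Z≤4τ : card Z ≤ 4 * τ
  Z≤4τ = *-cancelˡ-≤ m {{>-nonZero 1≤m}} (Z-bound (card Z) τ a m σ mass a-bound σ-small)
    where
    pointwise : ∀ z → 28 * m * ⟦ Z z ⟧ ≤ 50 * (⟦ D z ⟧ * f̄ z)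
    pointwise z = case T? (Z z) of λ where
      (no ¬p) → ≤-trans (≤-reflexive (trans (cong (28 * m *_) (⟦⟧-false ¬p)) (*-zeroʳ (28 * m)))) z≤n
      (yes p) → let z∈D , q = ∧-elim {D z} p
                    y , r = exists-elim q
                    z~y , y∈D = ∧-elim {adjacent z y} r
        in begin
        28 * m * ⟦ Z z ⟧        ≡⟨ trans (cong (28 * m *_) (⟦⟧-true p)) (*-identityʳ _) ⟩
        28 * m                  ≤⟨ outer y y∈D ⟩
        50 * f y                ≤⟨ *-monoʳ-≤ 50 (f≤f̄ (~-sym z~y)) ⟩
        50 * f̄ z                ≡⟨ cong (50 *_) (trans (cong (_* f̄ z) (⟦⟧-true z∈D)) (*-identityˡ _)) ⟨
        50 * (⟦ D z ⟧ * f̄ z)    ∎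
    mass : 28 * m * card Z ≤ 50 * τ * a
    mass = begin
      28 * m * card Z                     ≡⟨ ∑-*ˡ (28 * m) (λ z → ⟦ Z z ⟧) ⟩
      sum (λ z → 28 * m * ⟦ Z z ⟧)        ≤⟨ ∑-mono pointwise ⟩
      sum (λ z → 50 * (⟦ D z ⟧ * f̄ z))    ≡⟨ ∑-*ˡ 50 (λ z → ⟦ D z ⟧ * f̄ z) ⟨
      50 * sum (λ z → ⟦ D z ⟧ * f̄ z)      ≤⟨ *-monoʳ-≤ 50 nonadjacent ⟩
      50 * (τ * a)                        ≡⟨ *-assoc 50 τ a ⟨
      50 * τ * a                          ∎

  d≤Z : ∀ {w} → w ∈ D → d w ≤ card Z
  d≤Z {w} w∈D = card-mono {X = adjacent w ∩ D} {Y = Z} λ y p →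
    let w~y , y∈D = ∧-elim {adjacent w y} p in Z-intro y∈D w∈D (~-sym w~y)

  ∁D-colouring : ColourableOn (∁ D) 1
  ∁D-colouring = independent⇒colourableOn ∁D-indep

  -- If the excess τ is at most a multiple of σ, then so is the number of
  -- vertices of Z, and the neighbourhoods in ∁ D of adjacent vertices of D
  -- are complementary up to O(σ) vertices.
  module SmallExcess (τ≤10σ : τ ≤ 10 * σ) (q l j : ℕ) .{{_ : NonZero q}} (l-large : 2 * n <ⁿ 2 ^ l)
    (q-large : 40 * σ <ⁿ q ^ j) (ql-small : 50 * ((2 * (q * l) + 1) * (81 * σ)) ≤ 28 * m) where

    e : ℕ
    e = 81 * σ

    B : Fin n → VertexSet n
    B v = adjacent v ∖ D

    rest : Fin n → Fin n → VertexSet n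
    rest x y = ∁ D ∖ (adjacent x ∪ adjacent y)

    rest-small : ∀ {x y} → x ∈ D → y ∈ D → x ~ y → card (rest x y) ≤ e
    rest-small {x} {y} x∈D y∈D x~y = remainder-bound (card (rest x y)) (f x) (f y) (d x) (d y) (card Z) τ a m σ
      (begin
        card (rest x y) + (f x + f y)
          ≤⟨ +-monoʳ-≤ (card (rest x y)) (card-disjoint {X = B x} {Y = B y} {W = ∁ D ∩ (adjacent x ∪ adjacent y)}
               (λ z p → let q , r = ∧-elim {adjacent x z} p in ∧-intro r (∨-introˡ q))
               (λ z p → let q , r = ∧-elim {adjacent y z} p in ∧-intro r (∨-introʳ {adjacent x z} q))
               (λ z p q → triangle-free x y z (x~y , proj₁ (∧-elim q) , proj₁ (∧-elim p)))) ⟩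
        card (rest x y) + card (∁ D ∩ (adjacent x ∪ adjacent y))
          ≤⟨ card-disjoint {X = rest x y} {Y = ∁ D ∩ (adjacent x ∪ adjacent y)} {W = ∁ D}
               (λ z → proj₁ ∘ ∧-elim) (λ z → proj₁ ∘ ∧-elim)
               (λ z p q → not-T (proj₂ (∧-elim {not (D z)} p)) (proj₂ (∧-elim {not (D z)} q))) ⟩
        a ∎)
      (deg-split x) (deg-split y) (d≤Z x∈D) (d≤Z y∈D) Z≤4τ τ≤10σ a-bound

    -- Along an edge the outer neighbourhoods are exactly disjoint, so `near-step` is free; they
    -- cover `∁ D` only up to `rest`, so `far-step` costs `e`.
    Near Far : ℕ → Fin n → Fin n → Set
    Near i v x = card (B v ∖ adjacent x) ≤ i * e
    Far i v x  = card (B v ∩ adjacent x) ≤ i * e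

    1≤e : 1 ≤ e
    1≤e = ≤-trans 1≤σ (m≤m+n σ _)

    -- A short closed walk of odd length through `v` would make the outer neighbourhood of `v`
    -- almost disjoint from itself, although it has at least 0.56 m vertices.
    too-close : ∀ {i v} → i <ⁿ q * l → v ∈ D → ¬ f v ≤ i * e + i * e + e
    too-close {i} {v} i<r v∈D f≤ = <-irrefl refl (begin-strict
      28 * m                              ≤⟨ outer v v∈D ⟩
      50 * f v                            ≤⟨ *-monoʳ-≤ 50 f≤ ⟩
      50 * (i * e + i * e + e)            ≡⟨ cong (50 *_) (collect i e) ⟩
      50 * ((2 * i + 1) * e)              <⟨ *-monoʳ-< 50 (*-monoˡ-< e {{>-nonZero 1≤e}} (+-monoˡ-< 1 (*-monoʳ-< 2 i<r))) ⟩
      50 * ((2 * (q * l) + 1) * e)        ≤⟨ ql-small ⟩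
      28 * m                              ∎)
      where
      collect : ∀ i e → i * e + i * e + e ≡ (2 * i + 1) * e
      collect = solve-∀

    near-refl : ∀ {v} → Near 0 v v
    near-refl {v} = ≤-reflexive (trans (sum-cong-≗ λ x → ⟦⟧-false λ p →
      let p₁ , p₂ = ∧-elim {B v x} p in not-T p₂ (proj₁ (∧-elim p₁)))
      (trans (∑-const n 0) (*-zeroʳ n)))

    near-step : ∀ {i v x y} → x ∈ D → y ∈ D → Near i v x → x ~ y → Far i v y
    near-step {v = v} {x} {y} _ _ near x~y = ≤-trans
      (card-mono {X = B v ∩ adjacent y} {Y = B v ∖ adjacent x} λ z p → let q , r = ∧-elim {B v z} p in
        ∧-intro q (T-not λ x~z → triangle-free x y z (x~y , r , x~z)))
      near

    far-step : ∀ {i v x y} → x ∈ D → y ∈ D → Far i v x → x ~ y → Near (suc i) v y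
    far-step {i} {v} {x} {y} x∈D y∈D far x~y = begin
      card (B v ∖ adjacent y)
        ≤⟨ card-cover {X = rest x y} {Y = B v ∩ adjacent x} {W = B v ∖ adjacent y} split ⟩
      card (rest x y) + card (B v ∩ adjacent x)
        ≤⟨ +-mono-≤ (rest-small x∈D y∈D x~y) far ⟩
      e + i * e ∎
      where
      split : ∀ z → z ∈ B v ∖ adjacent y → z ∈ rest x y ⊎ z ∈ B v ∩ adjacent x
      split z p = let z∈B , z≁y = ∧-elim {B v z} p in case T? (adjacent x z) of λ where
        (yes x~z) → inj₂ (∧-intro z∈B x~z)
        (no x≁z)  → inj₁ (∧-intro (proj₂ (∧-elim {adjacent v z} z∈B))
          (T-not λ q → [ x≁z , not-T z≁y ]′ (∨-elim q)))

    near-far : ∀ {i v x} → i <ⁿ q * l → v ∈ D → x ∈ D → Near i v x → ¬ Far i v x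
    near-far {i} {v} {x} i<r v∈D _ near far = too-close i<r v∈D (begin
      f v
        ≤⟨ card-cover {X = B v ∖ adjacent x} {Y = B v ∩ adjacent x} {W = B v} split ⟩
      card (B v ∖ adjacent x) + card (B v ∩ adjacent x)
        ≤⟨ +-mono-≤ near far ⟩
      i * e + i * e
        ≤⟨ m≤m+n _ e ⟩
      i * e + i * e + e ∎)
      where
      split : ∀ z → z ∈ B v → z ∈ B v ∖ adjacent x ⊎ z ∈ B v ∩ adjacent x
      split z p = case T? (adjacent x z) of λ where
        (yes q) → inj₂ (∧-intro p q)
        (no ¬q) → inj₁ (∧-intro p (T-not ¬q))

    far-far : ∀ {i v x y} → i <ⁿ q * l → v ∈ D → x ∈ D → y ∈ D → Far i v x → Far i v y → ¬ x ~ y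
    far-far {i} {v} {x} {y} i<r v∈D x∈D y∈D far far′ x~y = too-close i<r v∈D (begin
      f v
        ≤⟨ card-cover {X = (B v ∩ adjacent x) ∪ (B v ∩ adjacent y)} {Y = rest x y} {W = B v} split ⟩
      card ((B v ∩ adjacent x) ∪ (B v ∩ adjacent y)) + card (rest x y)
        ≤⟨ +-monoˡ-≤ _ (card-cover {X = B v ∩ adjacent x} {Y = B v ∩ adjacent y}
             {W = (B v ∩ adjacent x) ∪ (B v ∩ adjacent y)} λ z → ∨-elim) ⟩
      card (B v ∩ adjacent x) + card (B v ∩ adjacent y) + card (rest x y)
        ≤⟨ +-mono-≤ (+-mono-≤ far far′) (rest-small x∈D y∈D x~y) ⟩
      i * e + i * e + e ∎)
      where
      split : ∀ z → z ∈ B v → z ∈ (B v ∩ adjacent x) ∪ (B v ∩ adjacent y) ⊎ z ∈ rest x y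
      split z p = case T? (adjacent x z) ,′ T? (adjacent y z) of λ where
        (yes r , _)     → inj₁ (∨-introˡ (∧-intro p r))
        (no _  , yes s) → inj₁ (∨-introʳ {(B v ∩ adjacent x) z} (∧-intro p s))
        (no ¬r , no ¬s) → inj₂ (∧-intro (proj₂ (∧-elim {adjacent v z} p)) (T-not λ t → [ ¬r , ¬s ]′ (∨-elim t)))

    open LocallyBipartite F D Near Far (λ {v} → near-refl {v}) (λ {i} p → ≤-trans p (m≤n+m (i * e) e))
      (λ {i} → near-step {i}) (λ {i} → far-step {i}) (q * l) (λ {i} → near-far {i}) (λ {i} → far-far {i})
      using (colour)

    colouring : Colourable F (3 + j)
    colouring = subst (Colourable F) (+-comm (suc j) 2) (colourableOn⇒colourable {X = λ _ → true} (λ _ → tt)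
      (colourableOn-∪ {X = Z} {Y = ∁ Z} (λ x _ → case T? (Z x) of λ where
          (yes p) → inj₁ p
          (no ¬p) → inj₂ (T-not ¬p))
        -- `Z` has at most 4 τ ≤ 40 σ < q ^ j vertices and takes j + 1 colours; the two independent
        -- sets take one each.
        (colour q l refl l-large j Z Z⊆D (≤-<-trans (≤-trans Z≤4τ (*-monoʳ-≤ 4 τ≤10σ))
          (subst (_<ⁿ q ^ j) (*-assoc 4 10 σ) q-large)))
        (colourableOn-∪ {X = ∁ D} {Y = D ∖ Z} (λ x p → case T? (D x) of λ where
            (yes q) → inj₂ (∧-intro q p)
            (no ¬q) → inj₁ (T-not ¬q))
          ∁D-colouring
          (independent⇒colourableOn {X = D ∖ Z} λ u v p q u~v →
            let u∈D , u∉Z = ∧-elim {D u} p in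
            not-T u∉Z (Z-intro u∈D (proj₁ (∧-elim q)) u~v)))))

  module LargeExcess (τ≥10σ : 10 * σ ≤ τ) (1≤τ : 1 ≤ τ) where

    Low High : VertexSet n
    Low w  = D w ∧ ⌊ suc (2 * d w + σ) ≤? τ ⌋
    High w = D w ∧ not ⌊ suc (2 * d w + σ) ≤? τ ⌋

    -- An edge needs d u + d v ≥ 2 m - a ≥ τ - σ, and the threshold in `Low` puts both degrees below
    -- half of this.
    low-independent : Independent Low
    low-independent u v p q u~v = contradiction
      (low-bound (f u) (f v) (d u) (d v) τ a m σ (edge u~v) (deg-split u) (deg-split v) a-bound
        (toWitness (proj₂ (∧-elim {D u} p))) (toWitness (proj₂ (∧-elim {D v} q)))) λ ()

    high-degree : ∀ {w} → w ∈ High → 9 * τ ≤ 20 * d w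
    high-degree {w} p = high-bound (d w) τ σ
      (s≤s⁻¹ (≰⇒> λ le → not-T (proj₂ (∧-elim {D w} p)) (fromWitness le))) τ≥10σ

    -- Every vertex has at most two neighbours on the cycle. Hence the outer degrees sum to at most
    -- 2 a, and the inner degrees to at least 5 m - 2 a. Each inner neighbour misses at least 0.56 m
    -- vertices of `∁ D`, and a missing pair is counted at most twice, so 140 m² ≤ (100 τ + 56 m) a.
    -- But the bounds on τ and a keep the right-hand side below 139 m².
    no-pentagon : ∀ {w₁ w₂ w₃ w₄ w₅} → w₁ ∈ D → w₂ ∈ D → w₃ ∈ D → w₄ ∈ D → w₅ ∈ D →
      w₁ ~ w₂ → w₂ ~ w₃ → w₃ ~ w₄ → w₄ ~ w₅ → w₅ ~ w₁ → ⊥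
    no-pentagon {w₁} {w₂} {w₃} {w₄} {w₅} D₁ D₂ D₃ D₄ D₅ e₁₂ e₂₃ e₃₄ e₄₅ e₅₁ =
      contradiction (pentagon-final m σ product σ-small 1≤m) λ ()
      where
      S : Fin n → ℕ
      S x = A x w₁ + A x w₂ + A x w₃ + A x w₄ + A x w₅
      exclusive : ∀ {u v} → u ~ v → ∀ x → A x u + A x v ≤ 1
      exclusive = adjacent-exclusive F triangle-free
      S≤2 : ∀ x → S x ≤ 2
      S≤2 x = pentagon-overlap (A x w₁) (A x w₂) (A x w₃) (A x w₄) (A x w₅)
        (exclusive e₁₂ x) (exclusive e₂₃ x) (exclusive e₃₄ x) (exclusive e₄₅ x) (exclusive e₅₁ x)
      five : (g : Fin n → Fin n → ℕ) → ℕ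
      five g = sum (g w₁) + sum (g w₂) + sum (g w₃) + sum (g w₄) + sum (g w₅)
      weighted : (h : Fin n → ℕ) → five (λ w x → A x w * h x) ≤ 2 * sum h
      weighted h = begin
        five (λ w x → A x w * h x)
          ≡⟨ cong (λ s → s + sum (λ x → A x w₃ * h x) + sum (λ x → A x w₄ * h x) + sum (λ x → A x w₅ * h x))
               (∑-distrib-+ (λ x → A x w₁ * h x) (λ x → A x w₂ * h x)) ⟨
        _ ≡⟨ cong (λ s → s + sum (λ x → A x w₄ * h x) + sum (λ x → A x w₅ * h x))
               (∑-distrib-+ (λ x → A x w₁ * h x + A x w₂ * h x) (λ x → A x w₃ * h x)) ⟨
        _ ≡⟨ cong (λ s → s + sum (λ x → A x w₅ * h x))
               (∑-distrib-+ (λ x → A x w₁ * h x + A x w₂ * h x + A x w₃ * h x) (λ x → A x w₄ * h x)) ⟨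
        _ ≡⟨ ∑-distrib-+ (λ x → A x w₁ * h x + A x w₂ * h x + A x w₃ * h x + A x w₄ * h x) (λ x → A x w₅ * h x) ⟨
        sum (λ x → A x w₁ * h x + A x w₂ * h x + A x w₃ * h x + A x w₄ * h x + A x w₅ * h x)
          ≤⟨ ∑-mono (λ x → ≤-trans (≤-reflexive (collect (A x w₁) (A x w₂) (A x w₃) (A x w₄) (A x w₅) (h x)))
               (*-monoˡ-≤ (h x) (S≤2 x))) ⟩
        sum (λ x → 2 * h x)
          ≡⟨ ∑-*ˡ 2 h ⟨
        2 * sum h ∎
        where
        collect : ∀ a b c d e h → a * h + b * h + c * h + d * h + e * h ≡ (a + b + c + d + e) * h
        collect = solve-∀
      f≡ : ∀ w → f w ≡ sum (λ x → A x w * ⟦ not (D x) ⟧)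
      f≡ w = sum-cong-≗ λ x → trans (⟦⟧-∧ (adjacent w x) (not (D x))) (cong (_* ⟦ not (D x) ⟧) (A-sym w x))
      f-sum : f w₁ + f w₂ + f w₃ + f w₄ + f w₅ ≤ 2 * a
      f-sum = ≤-trans (≤-reflexive (cong₂ _+_ (cong₂ _+_ (cong₂ _+_ (cong₂ _+_ (f≡ w₁) (f≡ w₂)) (f≡ w₃)) (f≡ w₄)) (f≡ w₅)))
        (weighted λ x → ⟦ not (D x) ⟧)
      df : ∀ {w} → w ∈ D → d w * (28 * m) ≤ 50 * sum (λ y → A y w * (⟦ D y ⟧ * f̄ y))
      df {w} w∈D = begin
        d w * (28 * m)                                ≤⟨ *-monoʳ-≤ (d w) (outer w w∈D) ⟩
        d w * (50 * f w)                              ≡⟨ swap (d w) 50 (f w) ⟩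
        50 * (d w * f w)                              ≡⟨ cong (50 *_) (∑-*ʳ (f w) (λ y → ⟦ (adjacent w ∩ D) y ⟧)) ⟩
        50 * sum (λ y → ⟦ (adjacent w ∩ D) y ⟧ * f w) ≤⟨ *-monoʳ-≤ 50 (∑-mono pointwise) ⟩
        50 * sum (λ y → A y w * (⟦ D y ⟧ * f̄ y))      ∎
        where
        swap : ∀ x y z → x * (y * z) ≡ y * (x * z)
        swap = solve-∀
        pointwise : ∀ y → ⟦ (adjacent w ∩ D) y ⟧ * f w ≤ A y w * (⟦ D y ⟧ * f̄ y)
        pointwise y = case T? ((adjacent w ∩ D) y) of λ where
          (no ¬p) → ≤-trans (≤-reflexive (cong (_* f w) (⟦⟧-false ¬p))) z≤n
          (yes p) → let w~y , y∈D = ∧-elim {adjacent w y} p in begin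
            ⟦ (adjacent w ∩ D) y ⟧ * f w  ≡⟨ trans (cong (_* f w) (⟦⟧-true p)) (*-identityˡ _) ⟩
            f w                           ≤⟨ f≤f̄ w~y ⟩
            f̄ y                           ≡⟨ trans (cong (_* f̄ y) (⟦⟧-true y∈D)) (*-identityˡ _) ⟨
            ⟦ D y ⟧ * f̄ y                 ≡⟨ trans (cong (_* (⟦ D y ⟧ * f̄ y)) (⟦⟧-true (~-sym w~y))) (*-identityˡ _) ⟨
            A y w * (⟦ D y ⟧ * f̄ y)       ∎
      g : Fin n → ℕ
      g w = sum λ y → A y w * (⟦ D y ⟧ * f̄ y)
      e : ℕ
      e = five (λ w y → A y w * (⟦ D y ⟧ * f̄ y))
      s : ℕ
      s = d w₁ + d w₂ + d w₃ + d w₄ + d w₅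
      mass : 28 * m * s ≤ 50 * e
      mass = linear 0 (df D₁ ⊕ df D₂ ⊕ df D₃ ⊕ df D₄ ⊕ df D₅)
        (identity m (d w₁) (d w₂) (d w₃) (d w₄) (d w₅) (g w₁) (g w₂) (g w₃) (g w₄) (g w₅))
        where
        identity : ∀ m a b c d e a′ b′ c′ d′ e′ →
          28 * m * (a + b + c + d + e) + (50 * a′ + 50 * b′ + 50 * c′ + 50 * d′ + 50 * e′) + 0 ≡
          50 * (a′ + b′ + c′ + d′ + e′) + (a * (28 * m) + b * (28 * m) + c * (28 * m) + d * (28 * m) + e * (28 * m))
        identity = solve-∀
      e≤ : e ≤ 2 * (τ * a)
      e≤ = ≤-trans (weighted λ y → ⟦ D y ⟧ * f̄ y) (*-monoʳ-≤ 2 nonadjacent)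
      u v : ℕ
      u = 100 * τ + 56 * m
      v = 78 * m + 100 * σ ∸ u
      u≤ : u ≤ 78 * m + 100 * σ
      u≤ = pentagon-u τ m σ τ-bound
      u+v : u + v ≡ 78 * m + 100 * σ
      u+v = m+[n∸m]≡n u≤
      product : 14000 * m * m ≤ 178 * m * (78 * m + 100 * σ)
      product = begin
        14000 * m * m                       ≤⟨ pentagon-scale s a e τ m mass e≤
          (pentagon-defect (f w₁) (f w₂) (f w₃) (f w₄) (f w₅) (d w₁) (d w₂) (d w₃) (d w₄) (d w₅) a m
            (deg-split w₁) (deg-split w₂) (deg-split w₃) (deg-split w₄) (deg-split w₅) f-sum) ⟩
        u * (100 * a)                       ≤⟨ *-monoʳ-≤ u (pentagon-complement u v a τ m σ
          (≤-reflexive (sym u+v)) (≤-reflexive u+v) ≤-refl ≤-refl a-bound) ⟩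
        u * (178 * m + v)                   ≤⟨ pentagon-product u v m σ (≤-reflexive u+v)
          (≤-trans u≤ (pentagon-u′ m σ σ-small)) ⟩
        178 * m * (78 * m + 100 * σ)        ∎

    -- A colour class consists of the vertices of `H` with a common neighbour in `D` with `c`; an
    -- edge inside it would close a 5-cycle through `c`. The inner neighbours of `c` are new to `Y`
    -- and are no longer seen by the rest of `H`. So each colour adds at least 9 τ / 20 vertices to
    -- `Y`, a subset of `Z`. As 9 · 9 / 20 > 4, nine colours are enough when `Y` starts empty.
    greedy : ∀ k (H Y : VertexSet n) → (∀ w → w ∈ H → w ∈ High) → (∀ y → y ∈ Y → y ∈ Z) →
      (∀ w y → w ∈ H → y ∈ Y → ¬ w ~ y) → 81 * τ ≤ 20 * card Y + 9 * τ * k → ColourableOn H k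
    greedy zero H Y _ Y⊆Z _ large = contradiction
      (budget-final (card Y) (card Z) τ (≤-trans large (≤-reflexive (trans (cong (_+_ (20 * card Y)) (*-zeroʳ (9 * τ))) (+-identityʳ _))))
        (card-mono {X = Y} {Y = Z} Y⊆Z) Z≤4τ 1≤τ) λ ()
    greedy (suc k) H Y H⊆ Y⊆Z H≁Y large = decide (1 ≤? card H)
      where
      decide : Dec (1 ≤ card H) → ColourableOn H (suc k)
      step : ∀ c → c ∈ H → ColourableOn H (suc k)
      decide (yes H-nonempty) = let c , c∈H = card-nonempty H H-nonempty in step c c∈H
      decide (no H-empty)     = (λ _ → 0) , (λ _ _ → s≤s z≤n) ,
        λ u v u∈H _ _ _ → H-empty (card-pos {X = H} u u∈H)
      step c c∈H = colourableOn-∪ {X = Near} {Y = H ∖ Near}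
        (λ x x∈H → case T? (Near x) of λ where
          (yes p) → inj₁ p
          (no ¬p) → inj₂ (∧-intro x∈H (T-not ¬p)))
        (independent⇒colourableOn near-independent)
        (greedy k (H ∖ Near) (Y ∪ N) (λ w → H⊆ w ∘ proj₁ ∘ ∧-elim)
          (λ y p → [ Y⊆Z y , N⊆Z y ]′ (∨-elim p))
          (λ w y p q w~y → let w∈H , w∉Near = ∧-elim {H w} p in
            [ (λ y∈Y → H≁Y w y w∈H y∈Y w~y)
            , (λ y∈N → not-T w∉Near (∧-intro w∈H (exists-intro y (∧-intro y∈N (~-sym w~y))))) ]′ (∨-elim q))
          (budget-step (card Y) (card (Y ∪ N)) (card N) τ k large (high-degree (H⊆ c c∈H))
            (card-disjoint {X = Y} {Y = N} {W = Y ∪ N} (λ y → ∨-introˡ) (λ y → ∨-introʳ {Y y})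
              (λ y y∈Y y∈N → H≁Y c y c∈H y∈Y (proj₁ (∧-elim y∈N))))))
        where
        N Near : VertexSet n
        N = adjacent c ∩ D
        Near w = H w ∧ exists λ y → N y ∧ adjacent y w
        c∈D : c ∈ D
        c∈D = proj₁ (∧-elim (H⊆ c c∈H))
        N⊆Z : ∀ y → y ∈ N → y ∈ Z
        N⊆Z y p = let c~y , y∈D = ∧-elim {adjacent c y} p in Z-intro y∈D c∈D (~-sym c~y)
        near-independent : Independent Near
        near-independent u v p q u~v =
          let u∈H , r = ∧-elim {H u} p
              v∈H , s = ∧-elim {H v} q
              y , t = exists-elim r
              z , o = exists-elim s
              y∈N , y~u = ∧-elim {N y} t
              z∈N , z~v = ∧-elim {N z} o
              c~y , y∈D = ∧-elim {adjacent c y} y∈N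
              c~z , z∈D = ∧-elim {adjacent c z} z∈N
          in no-pentagon c∈D y∈D (proj₁ (∧-elim (H⊆ u u∈H))) (proj₁ (∧-elim (H⊆ v v∈H))) z∈D
               c~y y~u u~v (~-sym z~v) (~-sym c~z)

    colouring : Colourable F 11
    colouring = colourableOn⇒colourable {X = λ _ → true} (λ _ → tt)
      (colourableOn-∪ {X = ∁ D} {Y = D} (λ x _ → case T? (D x) of λ where
          (yes p) → inj₂ p
          (no ¬p) → inj₁ (T-not ¬p))
        ∁D-colouring
        (colourableOn-∪ {X = Low} {Y = High} {W = D} (λ x p → case T? ⌊ suc (2 * d x + σ) ≤? τ ⌋ of λ where
            (yes q) → inj₁ (∧-intro p q)
            (no ¬q) → inj₂ (∧-intro p (T-not ¬q)))
          (independent⇒colourableOn low-independent)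
          (greedy 9 High (λ _ → false) (λ _ → id) (λ _ ()) (λ _ _ _ ())
            (≤-trans (≤-reflexive (nine τ)) (m≤n+m _ _)))))
      where
      nine : ∀ τ → 81 * τ ≡ 9 * τ * 9
      nine = solve-∀

  colouring : ∀ q l j → .{{NonZero q}} → 2 * n <ⁿ 2 ^ l → 40 * σ <ⁿ q ^ j →
    50 * ((2 * (q * l) + 1) * (81 * σ)) ≤ 28 * m → Colourable F 11 ⊎ Colourable F (3 + j)
  colouring q l j l-large q-large ql-small = case τ ≤? 10 * σ of λ where
    (yes τ≤10σ) → inj₂ (SmallExcess.colouring τ≤10σ q l j l-large q-large ql-small)
    (no τ≰10σ)  → inj₁ (let τ>10σ = ≰⇒> τ≰10σ in
      LargeExcess.colouring (<⇒≤ τ>10σ) (≤-trans (s≤s z≤n) τ>10σ))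

-- From a sparse fractional set to a bipartition

missing-mass : ∀ N Q G R m n σ L → N + Q ≤ 2 * m * L * R → 2 * m * L * (L * m) ≤ G + Q →
  R + 2 * m * L ≤ n * L → n ≤ 3 * m + σ → 2000 * σ ≤ m → 100 * G ≤ 17 * m * m * L * L →
  1000 * N ≤ 171 * m * m * L * L
missing-mass N Q G R m n σ L h1 h2 h3 h4 h5 h6 =
  linear (0) (1000 ⊗ h1 ⊕ 1000 ⊗ h2 ⊕ (2000 * m * L) ⊗ h3 ⊕ (2000 * m * L * L) ⊗ h4
    ⊕ (m * L * L) ⊗ h5 ⊕ 10 ⊗ h6)
    (solve (N ∷ Q ∷ G ∷ R ∷ m ∷ n ∷ σ ∷ L ∷ []))

complement-upper : ∀ R n m σ L → R + 2 * m * L ≤ n * L → n ≤ 3 * m + σ → R ≤ m * L + σ * L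
complement-upper R n m σ L h1 h2 =
  linear (0) (h1 ⊕ L ⊗ h2) (solve (R ∷ n ∷ m ∷ σ ∷ L ∷ []))

complement-lower : ∀ R n m L → n * L ≤ R + 2 * m * L → 3 * m ≤ n → m * L ≤ R
complement-lower R n m L h1 h2 =
  linear (0) (h1 ⊕ L ⊗ h2) (solve (R ∷ n ∷ m ∷ L ∷ []))

upper-range : ∀ r R m σ L → 2 * r ≤ R → R ≤ m * L + σ * L → 2000 * σ ≤ m → 50 * r ≤ 39 * (m * L)
upper-range r R m σ L h1 h2 h3 =
  *-cancelˡ-≤ 80 (linear (1119 * L * m) (2000 ⊗ h1 ⊕ 2000 ⊗ h2 ⊕ L ⊗ h3)
    (solve (r ∷ R ∷ m ∷ σ ∷ L ∷ [])))

shifted-complement : ∀ α r q X → 50 * r + q ≤ 39 * X → 39 * X ≤ 50 * r + q → X ≤ α + r →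
  11 * X + q ≤ 50 * α
shifted-complement α r q X h1 h2 h3 =
  linear (0) (h1 ⊕ 50 ⊗ h3) (solve (α ∷ r ∷ q ∷ X ∷ []))

-- Here p + q = 28 X, so (11 X + p) (11 X + q) = 11 · 39 X² + p q, and 11 · 39 = 429.
balanced-product : ∀ α r p q X N → (11 * X + q) * (11 * X + p) ≤ 50 * α * (50 * r) →
  11 * X + p ≤ 50 * r → 50 * r ≤ 11 * X + p → 39 * X ≤ 50 * r + q → α * r ≤ N →
  429 * (X * X) ≤ 2500 * N
balanced-product α r p q X N h1 h2 h3 h4 h5 =
  linear (p * q) (h1 ⊕ (11 * X) ⊗ h3 ⊕ (11 * X) ⊗ h4 ⊕ 2500 ⊗ h5)
    (solve (α ∷ r ∷ p ∷ q ∷ X ∷ N ∷ []))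

balanced-absurd : ∀ N m L → 429 * (m * L * (m * L)) ≤ 2500 * N → 1000 * N ≤ 171 * m * m * L * L →
  1 ≤ m * L * (m * L) → 1 ≤ 0
balanced-absurd N m L h1 h2 h3 =
  *-cancelˡ-≤ 3 (linear (0) (2 ⊗ h1 ⊕ 5 ⊗ h2 ⊕ 3 ⊗ h3) (solve (N ∷ m ∷ L ∷ [])))

nonneighbour-weight : ∀ r s R m L → R ≤ r + s → m * L ≤ R → 50 * r ≤ 11 * (m * L) →
  39 * (m * L) ≤ 50 * s
nonneighbour-weight r s R m L h1 h2 h3 =
  linear (0) (50 ⊗ h1 ⊕ 50 ⊗ h2 ⊕ h3) (solve (r ∷ s ∷ R ∷ m ∷ L ∷ []))

small-weight : ∀ w N m L → 39 * (m * L) * w ≤ 50 * N → 1000 * N ≤ 171 * m * m * L * L →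
  m * L * (50 * w) ≤ m * L * (11 * (m * L))
small-weight w N m L h1 h2 =
  *-cancelˡ-≤ 78 (linear (3 * L * L * m * m) (100 ⊗ h1 ⊕ 5 ⊗ h2) (solve (w ∷ N ∷ m ∷ L ∷ [])))

outer-degree : ∀ f w α r m L → α ≤ L * f + w → m * L ≤ α + r → 50 * r ≤ 11 * (m * L) →
  50 * w ≤ 11 * (m * L) → L * (28 * m) ≤ L * (50 * f)
outer-degree f w α r m L h1 h2 h3 h4 =
  linear (0) (50 ⊗ h1 ⊕ 50 ⊗ h2 ⊕ h3 ⊕ h4) (solve (f ∷ w ∷ α ∷ r ∷ m ∷ L ∷ []))

inner-size : ∀ D w R m σ L → L * D ≤ w + R → 50 * w ≤ 11 * (m * L) → R ≤ m * L + σ * L →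
  L * (50 * D) ≤ L * (61 * m + 50 * σ)
inner-size D w R m σ L h1 h2 h3 =
  linear (0) (50 ⊗ h1 ⊕ h2 ⊕ 50 ⊗ h3) (solve (D ∷ w ∷ R ∷ m ∷ σ ∷ L ∷ []))

halves-overlap : ∀ r s R → r + s ≤ R → 1 + R ≤ 2 * r → 1 + R ≤ 2 * s → 1 ≤ 0
halves-overlap r s R h1 h2 h3 =
  *-cancelˡ-≤ 2 (linear (0) (2 ⊗ h1 ⊕ h2 ⊕ h3) (solve (r ∷ s ∷ R ∷ [])))

-- Ψ = 2 Φ and its complement Ψ̄ are fractional versions, scaled by L, of the two
-- parts of sizes 2 n / 3 and n / 3.
module Weighted {n} (F : Graph n) (triangle-free : TriangleFree F) (m σ L : ℕ) (Φ : Fin n → ℕ)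
  (m≤deg    : ∀ x → m ≤ Adjacency.deg F x)
  (3m≤n     : 3 * m ≤ n)
  (n≤3m+σ   : n ≤ 3 * m + σ)
  (1≤σ      : 1 ≤ σ)
  (σ-small  : 2000 * σ ≤ m)
  (1≤L      : 1 ≤ L)
  (half     : ∀ x → 2 * Φ x ≤ L)
  (total    : sum Φ ≡ L * m)
  (sparse   : 400 * sum (λ x → sum λ y → Adjacency.A F x y * (Φ x * Φ y)) ≤ 17 * m * m * L * L)
  where
  open Adjacency F
  open ≤-Reasoning

  Ψ Ψ̄ : Fin n → ℕ
  Ψ x = 2 * Φ x
  Ψ̄ x = L ∸ Ψ x

  Ψ+Ψ̄ : ∀ x → Ψ x + Ψ̄ x ≡ L
  Ψ+Ψ̄ x = m+[n∸m]≡n (half x)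

  Ā : Fin n → Fin n → ℕ
  Ā x y = ⟦ not (adjacent x y) ⟧

  α ρ ρ̄ : Fin n → ℕ
  α w = sum λ x → A w x * Ψ x
  ρ w = sum λ x → A w x * Ψ̄ x
  ρ̄ w = sum λ x → Ā w x * Ψ̄ x

  R N Q G : ℕ
  R = sum Ψ̄
  N = sum λ x → Ψ x * ρ̄ x
  Q = sum λ x → Ψ x * ρ x
  G = sum λ x → Ψ x * α x

  1≤mL : 1 ≤ m * L
  1≤mL = *-mono-≤ (m-positive m σ σ-small 1≤σ) 1≤L

  ∑Ψ : sum Ψ ≡ 2 * m * L
  ∑Ψ = trans (sym (∑-*ˡ 2 Φ)) (trans (cong (2 *_) (trans total (*-comm L m))) (sym (*-assoc 2 m L)))

  R-total : R + 2 * m * L ≡ n * L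
  R-total = trans (+-comm R (2 * m * L)) (trans (cong (_+ R) (sym ∑Ψ)) (trans (sym (∑-distrib-+ Ψ Ψ̄))
    (trans (sum-cong-≗ Ψ+Ψ̄) (∑-const n L))))

  R≤ : R ≤ m * L + σ * L
  R≤ = complement-upper R n m σ L (≤-reflexive R-total) n≤3m+σ

  mL≤R : m * L ≤ R
  mL≤R = complement-lower R n m L (≤-reflexive (sym R-total)) 3m≤n

  α+ρ : ∀ w → α w + ρ w ≡ L * deg w
  α+ρ w = trans (sym (∑-distrib-+ (λ x → A w x * Ψ x) (λ x → A w x * Ψ̄ x)))
    (trans (sum-cong-≗ λ x → trans (sym (*-distribˡ-+ (A w x) (Ψ x) (Ψ̄ x)))
      (trans (cong (A w x *_) (Ψ+Ψ̄ x)) (*-comm (A w x) L)))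
    (sym (∑-*ˡ L (A w))))

  mL≤α+ρ : ∀ w → m * L ≤ α w + ρ w
  mL≤α+ρ w = begin
    m * L      ≡⟨ *-comm m L ⟩
    L * m      ≤⟨ *-monoʳ-≤ L (m≤deg w) ⟩
    L * deg w  ≡⟨ α+ρ w ⟨
    α w + ρ w  ∎

  ρ+ρ̄ : ∀ w → ρ w + ρ̄ w ≡ R
  ρ+ρ̄ w = trans (sym (∑-distrib-+ (λ x → A w x * Ψ̄ x) (λ x → Ā w x * Ψ̄ x)))
    (sum-cong-≗ λ x → trans (sym (*-distribʳ-+ (Ψ̄ x) (A w x) (Ā w x)))
      (trans (cong (_* Ψ̄ x) (⟦⟧-not (adjacent w x))) (*-identityˡ (Ψ̄ x))))

  N+Q : N + Q ≡ 2 * m * L * R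
  N+Q = trans (sym (∑-distrib-+ (λ x → Ψ x * ρ̄ x) (λ x → Ψ x * ρ x)))
    (trans (sum-cong-≗ λ x → trans (sym (*-distribˡ-+ (Ψ x) (ρ̄ x) (ρ x)))
      (cong (Ψ x *_) (trans (+-comm (ρ̄ x) (ρ x)) (ρ+ρ̄ x))))
    (trans (sym (∑-*ʳ R Ψ)) (cong (_* R) ∑Ψ)))

  G+Q : 2 * m * L * (L * m) ≤ G + Q
  G+Q = begin
    2 * m * L * (L * m)                ≡⟨ cong (_* (L * m)) ∑Ψ ⟨
    sum Ψ * (L * m)                    ≡⟨ ∑-*ʳ (L * m) Ψ ⟩
    sum (λ x → Ψ x * (L * m))          ≤⟨ ∑-mono (λ x → *-monoʳ-≤ (Ψ x) (subst (_≤ α x + ρ x) (*-comm m L) (mL≤α+ρ x))) ⟩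
    sum (λ x → Ψ x * (α x + ρ x))      ≡⟨ (sum-cong-≗ λ x → *-distribˡ-+ (Ψ x) (α x) (ρ x)) ⟩
    sum (λ x → Ψ x * α x + Ψ x * ρ x)  ≡⟨ ∑-distrib-+ (λ x → Ψ x * α x) (λ x → Ψ x * ρ x) ⟩
    G + Q                              ∎

  G-sparse : 100 * G ≤ 17 * m * m * L * L
  G-sparse = begin
    100 * G
      ≡⟨ cong (100 *_) (sum-cong-≗ row) ⟩
    100 * sum (λ x → 4 * sum λ y → A x y * (Φ x * Φ y))
      ≡⟨ cong (100 *_) (∑-*ˡ 4 (λ x → sum λ y → A x y * (Φ x * Φ y))) ⟨
    100 * (4 * sum (λ x → sum λ y → A x y * (Φ x * Φ y)))
      ≡⟨ *-assoc 100 4 (sum (λ x → sum λ y → A x y * (Φ x * Φ y))) ⟨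
    400 * sum (λ x → sum λ y → A x y * (Φ x * Φ y))
      ≤⟨ sparse ⟩
    17 * m * m * L * L ∎
    where
    entry : ∀ a x y → 2 * x * (a * (2 * y)) ≡ 4 * (a * (x * y))
    entry = solve-∀
    row : ∀ x → Ψ x * α x ≡ 4 * sum (λ y → A x y * (Φ x * Φ y))
    row x = trans (∑-*ˡ (Ψ x) (λ y → A x y * Ψ y))
      (trans (sum-cong-≗ λ y → entry (A x y) (Φ x) (Φ y)) (sym (∑-*ˡ 4 (λ y → A x y * (Φ x * Φ y)))))

  -- The degrees send weight 2 m² out of `Ψ`. At most 0.17 m² of it returns to `Ψ`, and the rest
  -- must go to `Ψ̄`, whose mass is at most m + σ. So the non-edges between them weigh at most 0.17
  -- m² + 2 m σ ≤ 0.171 m², all up to the factor L².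
  N-small : 1000 * N ≤ 171 * m * m * L * L
  N-small = missing-mass N Q G R m n σ L (≤-reflexive N+Q) G+Q (≤-reflexive R-total) n≤3m+σ σ-small G-sparse

  -- Neighbourhoods are independent, so every pair of neighbours of w counts
  -- as a missing edge.
  αρ≤N : ∀ w → α w * ρ w ≤ N
  αρ≤N w = begin
    α w * ρ w
      ≡⟨ ∑-product (λ x → A w x * Ψ x) (λ y → A w y * Ψ̄ y) ⟩
    sum (λ x → sum λ y → A w x * Ψ x * (A w y * Ψ̄ y))
      ≤⟨ ∑-mono (λ x → ∑-mono (entry x)) ⟩
    sum (λ x → sum λ y → Ψ x * (Ā x y * Ψ̄ y))
      ≡⟨ (sum-cong-≗ λ x → ∑-*ˡ (Ψ x) (λ y → Ā x y * Ψ̄ y)) ⟨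
    N ∎
    where
    nonadjacent : ∀ x y → A w x * A w y ≤ Ā x y
    nonadjacent x y = subst (_≤ Ā x y) (⟦⟧-∧ (adjacent w x) (adjacent w y)) (⟦⟧-mono λ p →
      let w~x , w~y = ∧-elim {adjacent w x} p in T-not λ x~y → triangle-free w x y (w~x , x~y , w~y))
    regroup : ∀ a b c d → a * b * (c * d) ≡ a * c * (b * d)
    regroup = solve-∀
    swap : ∀ a b c → a * (b * c) ≡ b * (a * c)
    swap = solve-∀
    entry : ∀ x y → A w x * Ψ x * (A w y * Ψ̄ y) ≤ Ψ x * (Ā x y * Ψ̄ y)
    entry x y = begin
      A w x * Ψ x * (A w y * Ψ̄ y) ≡⟨ regroup (A w x) (Ψ x) (A w y) (Ψ̄ y) ⟩
      A w x * A w y * (Ψ x * Ψ̄ y) ≤⟨ *-monoˡ-≤ (Ψ x * Ψ̄ y) (nonadjacent x y) ⟩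
      Ā x y * (Ψ x * Ψ̄ y)         ≡⟨ swap (Ā x y) (Ψ x) (Ψ̄ y) ⟩
      Ψ x * (Ā x y * Ψ̄ y)         ∎

  -- Cutting at exactly half of `Ψ̄` makes the complement independent: two adjacent vertices cannot
  -- both see more than half of it.
  D : VertexSet n
  D w = ⌊ 2 * ρ w ≤? R ⌋

  D-elim : ∀ {w} → w ∈ D → 2 * ρ w ≤ R
  D-elim = toWitness

  ∁D-elim : ∀ {w} → w ∈ ∁ D → R <ⁿ 2 * ρ w
  ∁D-elim p = ≰⇒> λ q → not-T p (fromWitness q)

  ∁D-indep : Independent (∁ D)
  ∁D-indep u v p q u~v = contradiction (halves-overlap (ρ u) (ρ v) R
    (begin
      ρ u + ρ v
        ≡⟨ ∑-distrib-+ (λ x → A u x * Ψ̄ x) (λ x → A v x * Ψ̄ x) ⟨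
      sum (λ x → A u x * Ψ̄ x + A v x * Ψ̄ x)
        ≤⟨ ∑-mono (λ x → ≤-trans (≤-reflexive (sym (*-distribʳ-+ (Ψ̄ x) (A u x) (A v x))))
             (≤-trans (*-monoˡ-≤ (Ψ̄ x) (common x)) (≤-reflexive (*-identityˡ (Ψ̄ x))))) ⟩
      R ∎)
    (∁D-elim p) (∁D-elim q)) λ ()
    where
    common : ∀ x → A u x + A v x ≤ 1
    common x = subst (λ s → A u x + s ≤ 1) (A-sym x v) (subst (λ s → s + A x v ≤ 1) (A-sym x u)
      (adjacent-exclusive F triangle-free u~v x))

  -- α + ρ ≥ m L and α ρ ≤ N < 0.1716 (m L)² keep ρ out of the interval from
  -- 0.22 m L to 0.78 m L.
  ρ-small : ∀ {w} → w ∈ D → 50 * ρ w ≤ 11 * (m * L)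
  ρ-small {w} w∈D = ≮⇒≥ λ big →
    let X = m * L
        p = 50 * ρ w ∸ 11 * X
        q = 39 * X ∸ 50 * ρ w
        11X+p = m+[n∸m]≡n (<⇒≤ big)
        50ρ+q = m+[n∸m]≡n (upper-range (ρ w) R m σ L (D-elim w∈D) R≤ σ-small)
    in contradiction (balanced-absurd N m L
      (balanced-product (α w) (ρ w) p q X N
        (*-mono-≤ (shifted-complement (α w) (ρ w) q X (≤-reflexive 50ρ+q) (≤-reflexive (sym 50ρ+q)) (mL≤α+ρ w))
                  (≤-reflexive 11X+p))
        (≤-reflexive 11X+p) (≤-reflexive (sym 11X+p)) (≤-reflexive (sym 50ρ+q)) (αρ≤N w))
      N-small (*-mono-≤ 1≤mL 1≤mL)) λ ()

  ω : ℕ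
  ω = sum λ x → ⟦ D x ⟧ * Ψ x

  -- Every vertex of `D` misses at least 0.78 m L of `Ψ̄`, so 0.78 m L ω ≤ N, and 0.171 / 0.78 <
  -- 0.22.
  ω-small : 50 * ω ≤ 11 * (m * L)
  ω-small = *-cancelˡ-≤ (m * L) {{>-nonZero 1≤mL}} (small-weight ω N m L (begin
    39 * (m * L) * ω
      ≡⟨ ∑-*ˡ (39 * (m * L)) (λ x → ⟦ D x ⟧ * Ψ x) ⟩
    sum (λ x → 39 * (m * L) * (⟦ D x ⟧ * Ψ x))
      ≤⟨ ∑-mono entry ⟩
    sum (λ x → 50 * (Ψ x * ρ̄ x))
      ≡⟨ ∑-*ˡ 50 (λ x → Ψ x * ρ̄ x) ⟨
    50 * N ∎) N-small)
    where
    swap : ∀ a b c → a * (b * c) ≡ b * (c * a)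
    swap = solve-∀
    entry : ∀ x → 39 * (m * L) * (⟦ D x ⟧ * Ψ x) ≤ 50 * (Ψ x * ρ̄ x)
    entry x = begin
      39 * (m * L) * (⟦ D x ⟧ * Ψ x)   ≡⟨ swap (39 * (m * L)) ⟦ D x ⟧ (Ψ x) ⟩
      ⟦ D x ⟧ * (Ψ x * (39 * (m * L))) ≤⟨ ⟦⟧*-mono (D x) (λ x∈D → *-monoʳ-≤ (Ψ x)
        (nonneighbour-weight (ρ x) (ρ̄ x) R m L (≤-reflexive (sym (ρ+ρ̄ x))) mL≤R (ρ-small x∈D))) ⟩
      ⟦ D x ⟧ * (Ψ x * (50 * ρ̄ x))     ≤⟨ *-monoˡ-≤ (Ψ x * (50 * ρ̄ x)) (⟦⟧≤1 (D x)) ⟩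
      1 * (Ψ x * (50 * ρ̄ x))           ≡⟨ *-identityˡ _ ⟩
      Ψ x * (50 * ρ̄ x)                 ≡⟨ swap (Ψ x) 50 (ρ̄ x) ⟩
      50 * (ρ̄ x * Ψ x)                 ≡⟨ cong (50 *_) (*-comm (ρ̄ x) (Ψ x)) ⟩
      50 * (Ψ x * ρ̄ x)                 ∎

  -- The vertex `w` sees at least 0.78 m L of `Ψ`, and at most 0.22 m L of that lies in `D`; this
  -- leaves 0.56 m L.
  outer : ∀ w → w ∈ D → 28 * m ≤ 50 * card (adjacent w ∖ D)
  outer w w∈D = *-cancelˡ-≤ L {{>-nonZero 1≤L}} (outer-degree (card (adjacent w ∖ D)) ω (α w) (ρ w) m L
    (begin
      α w
        ≤⟨ ∑-mono entry ⟩
      sum (λ x → L * ⟦ (adjacent w ∖ D) x ⟧ + ⟦ D x ⟧ * Ψ x)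
        ≡⟨ ∑-distrib-+ (λ x → L * ⟦ (adjacent w ∖ D) x ⟧) (λ x → ⟦ D x ⟧ * Ψ x) ⟩
      sum (λ x → L * ⟦ (adjacent w ∖ D) x ⟧) + ω
        ≡⟨ cong (_+ ω) (∑-*ˡ L (λ x → ⟦ (adjacent w ∖ D) x ⟧)) ⟨
      L * card (adjacent w ∖ D) + ω ∎)
    (mL≤α+ρ w) (ρ-small w∈D) ω-small)
    where
    bool : ∀ a d {L Ψ} → Ψ ≤ L → ⟦ a ⟧ * Ψ ≤ L * ⟦ a ∧ not d ⟧ + ⟦ d ⟧ * Ψ
    bool false d         _   = z≤n
    bool true  true  {L} _   = m≤n+m _ (L * 0)
    bool true  false {L} Ψ≤L = +-mono-≤ (≤-trans Ψ≤L (≤-reflexive (sym (*-identityʳ L)))) z≤n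
    entry : ∀ x → A w x * Ψ x ≤ L * ⟦ (adjacent w ∖ D) x ⟧ + ⟦ D x ⟧ * Ψ x
    entry x = bool (adjacent w x) (D x) (half x)

  D-size : 50 * card D ≤ 61 * m + 50 * σ
  D-size = *-cancelˡ-≤ L {{>-nonZero 1≤L}} (inner-size (card D) ω R m σ L (begin
    L * card D
      ≡⟨ ∑-*ˡ L (λ x → ⟦ D x ⟧) ⟩
    sum (λ x → L * ⟦ D x ⟧)
      ≤⟨ ∑-mono entry ⟩
    sum (λ x → ⟦ D x ⟧ * Ψ x + Ψ̄ x)
      ≡⟨ ∑-distrib-+ (λ x → ⟦ D x ⟧ * Ψ x) Ψ̄ ⟩
    ω + R ∎) ω-small R≤)
    where
    bool : ∀ d {L Ψ Ψ̄} → Ψ + Ψ̄ ≡ L → L * ⟦ d ⟧ ≤ ⟦ d ⟧ * Ψ + Ψ̄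
    bool false {L} _ = ≤-trans (≤-reflexive (*-zeroʳ L)) z≤n
    bool true {L} {Ψ} {Ψ̄} eq = ≤-reflexive (trans (*-identityʳ L) (trans (sym eq) (cong (_+ Ψ̄) (sym (+-identityʳ Ψ)))))
    entry : ∀ x → L * ⟦ D x ⟧ ≤ ⟦ D x ⟧ * Ψ x + Ψ̄ x
    entry x = bool (D x) (Ψ+Ψ̄ x)

  open NearlyBipartite F triangle-free D m σ ∁D-indep m≤deg outer D-size 3m≤n n≤3m+σ 1≤σ σ-small
    using (colouring) public

order-bound : ∀ m n σ → n ≤ 3 * m + σ → 2000 * σ ≤ m → 40 * n ≤ 121 * m
order-bound m n σ h1 h2 =
  *-cancelˡ-≤ 50 (linear (49 * m) (2000 ⊗ h1 ⊕ h2) (solve (m ∷ n ∷ σ ∷ [])))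

order-square-bound : ∀ m n → 40 * n ≤ 121 * m → 10 * (n * n) ≤ 92 * (m * m)
order-square-bound m n h1 =
  *-cancelˡ-≤ 160 (linear (79 * m * m) ((40 * n) ⊗ h1 ⊕ (121 * m) ⊗ h1) (solve (m ∷ n ∷ [])))

-- Energy decrement

subset-of-size : ∀ {n} (X : VertexSet n) m → m ≤ card X →
  Σ (VertexSet n) λ Y → (∀ x → x ∈ Y → x ∈ X) × card Y ≡ m
subset-of-size {n} X zero _ = (λ _ → false) , (λ _ ()) , trans (∑-const n 0) (*-zeroʳ n)
subset-of-size {suc n} X (suc m) m<X with X zero in eq
... | false = let Y , Y⊆X , |Y| = subset-of-size (X ∘ suc) (suc m) m<X in
  (λ { zero → false ; (suc x) → Y x }) , (λ { zero () ; (suc x) → Y⊆X x }) , |Y|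
... | true = let Y , Y⊆X , |Y| = subset-of-size (X ∘ suc) m (s≤s⁻¹ m<X) in
  (λ { zero → true ; (suc x) → Y x }) , (λ { zero _ → subst T (sym eq) tt ; (suc x) → Y⊆X x }) , cong suc |Y|

module ℤ∑ = Algebra.Properties.Semiring.Sum ℤ.+-*-semiring
open ℤ∑ using () renaming (sum to ∑; sum-cong-≗ to ∑-cong)

∑∑ : ∀ {n} → (Fin n → Fin n → ℤ) → ℤ
∑∑ M = ∑ λ x → ∑ λ y → M x y

pos-sum : ∀ {n} (f : Fin n → ℕ) → + sum f ≡ ∑ λ i → + f i
pos-sum {zero}  f = refl
pos-sum {suc n} f = trans (ℤ.pos-+ (f zero) (sum (f ∘ suc))) (cong (ℤ._+_ (+ f zero)) (pos-sum (f ∘ suc)))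

0≤∑ : ∀ {n} {f : Fin n → ℤ} → (∀ i → 0ℤ ℤ.≤ f i) → 0ℤ ℤ.≤ ∑ f
0≤∑ {zero}  f≥0 = ℤ.≤-refl
0≤∑ {suc n} f≥0 = ℤ.+-mono-≤ (f≥0 zero) (0≤∑ (f≥0 ∘ suc))

∑ᶻ-const : ∀ n c → ∑ {n} (λ _ → c) ≡ + n ℤ.* c
∑ᶻ-const zero    c = refl
∑ᶻ-const (suc n) c = trans (cong (ℤ._+_ c) (∑ᶻ-const n c)) (sym (ℤ.suc-* (+ n) c))

module _ {n : ℕ} where

  ∑-*ᶻ : ∀ c (f : Fin n → ℤ) → c ℤ.* ∑ f ≡ ∑ λ i → c ℤ.* f i
  ∑-*ᶻ = ℤ∑.*-distribˡ-sum

  ∑∑-cong : {M K : Fin n → Fin n → ℤ} → (∀ x y → M x y ≡ K x y) → ∑∑ M ≡ ∑∑ K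
  ∑∑-cong eq = ∑-cong λ x → ∑-cong (eq x)

  ∑-zero : ∑ {n} (λ _ → 0ℤ) ≡ 0ℤ
  ∑-zero = trans (∑ᶻ-const n 0ℤ) (ℤ.*-zeroʳ (+ n))

  ∑∑-zero : ∑∑ {n} (λ _ _ → 0ℤ) ≡ 0ℤ
  ∑∑-zero = trans (∑-cong {n} λ _ → ∑-zero) ∑-zero

  ∑∑-+ : (M K : Fin n → Fin n → ℤ) → ∑∑ (λ x y → M x y ℤ.+ K x y) ≡ ∑∑ M ℤ.+ ∑∑ K
  ∑∑-+ M K = trans (∑-cong λ x → ℤ∑.∑-distrib-+ (M x) (K x)) (ℤ∑.∑-distrib-+ (λ x → ∑ (M x)) (λ x → ∑ (K x)))

  ∑∑-* : ∀ c (M : Fin n → Fin n → ℤ) → ∑∑ (λ x y → c ℤ.* M x y) ≡ c ℤ.* ∑∑ M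
  ∑∑-* c M = trans (∑-cong λ x → sym (∑-*ᶻ c (M x))) (sym (∑-*ᶻ c λ x → ∑ (M x)))

  ∑∑-product : (f g : Fin n → ℤ) → ∑∑ (λ x y → f x ℤ.* g y) ≡ ∑ f ℤ.* ∑ g
  ∑∑-product f g = trans (∑-cong λ x → sym (∑-*ᶻ (f x) g)) (sym (ℤ∑.*-distribʳ-sum (∑ g) f))

0≤i*i : ∀ i → 0ℤ ℤ.≤ i ℤ.* i
0≤i*i (+ n)     = subst (0ℤ ℤ.≤_) (ℤ.pos-* n n) (ℤ.+≤+ z≤n)
0≤i*i (-[1+ n ]) = ℤ.+≤+ z≤n

linearᶻ : ∀ {a b l r} → l ℤ.≤ r → a ℤ.+ r ≡ b ℤ.+ l → a ℤ.≤ b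
linearᶻ {a} {b} {l} {r} l≤r eq = subst₂ ℤ._≤_ (cancel a r) (cancel b r)
  (ℤ.+-monoˡ-≤ (ℤ.- r) (ℤ.≤-trans (ℤ.≤-reflexive eq) (ℤ.+-monoʳ-≤ b l≤r)))
  where
  cancel : ∀ a r → a ℤ.+ r ℤ.- r ≡ a
  cancel = solve-∀ᶻ

-- Partitions and conditional expectations

module Atoms {n} (a : Fin n → ℕ) where

  e : Fin n → Fin n → ℕ
  e x y = ⟦ a x ≡ᵇ a y ⟧

  e-sym : ∀ x y → e x y ≡ e y x
  e-sym x y = ≤-antisym (⟦⟧-mono (flip x y)) (⟦⟧-mono (flip y x))
    where
    flip : ∀ x y → T (a x ≡ᵇ a y) → T (a y ≡ᵇ a x)
    flip x y p = ≡⇒≡ᵇ (a y) (a x) (sym (≡ᵇ⇒≡ (a x) (a y) p))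

  e-cong : ∀ {x x′} → a x ≡ a x′ → ∀ y → e x y ≡ e x′ y
  e-cong eq y = cong (λ k → ⟦ k ≡ᵇ a y ⟧) eq

  e-elim : ∀ {ℓ} (P : ℕ → Set ℓ) {x y} → (a x ≡ a y → P 1) → P 0 → P (e x y)
  e-elim P {x} {y} p₁ p₀ with a x ≡ᵇ a y in eq
  ... | true  = p₁ (≡ᵇ⇒≡ (a x) (a y) (subst T (sym eq) tt))
  ... | false = p₀

  size : Fin n → ℕ
  size x = sum (e x)

  size-cong : ∀ {x y} → a x ≡ a y → size x ≡ size y
  size-cong eq = sum-cong-≗ (e-cong eq)

  1≤size : ∀ x → 1 ≤ size x
  1≤size x = ≤-trans (≤-reflexive (sym (⟦⟧-true (≡⇒≡ᵇ (a x) (a x) refl)))) (term≤∑ (e x) x)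

  size≤n : ∀ x → size x ≤ n
  size≤n x = card≤n λ y → a x ≡ᵇ a y

  count : (Fin n → ℕ) → Fin n → ℕ
  count f x = sum λ y → e x y * f y

  count-cong : ∀ f {x y} → a x ≡ a y → count f x ≡ count f y
  count-cong f eq = sum-cong-≗ λ y → cong (_* f y) (e-cong eq y)

  Measurable : (Fin n → ℤ) → Set
  Measurable u = ∀ {x y} → a x ≡ a y → u x ≡ u y

  Measurable₂ : (Fin n → Fin n → ℤ) → Set
  Measurable₂ S = (∀ y → Measurable λ x → S x y) × (∀ x → Measurable (S x))

  L : ℕ
  L = n !

  size∣L : ∀ x → size x ∣ L
  size∣L x = ∣-trans (m∣m! (1≤size x)) (m≤n⇒m!∣n! (size≤n x))
    where
    m∣m! : ∀ {m} → 1 ≤ m → m ∣ m !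
    m∣m! {suc m} _ = m∣m*n (m !)

  weight : Fin n → ℕ
  weight x = quotient (size∣L x)

  weight-size : ∀ x → weight x * size x ≡ L
  weight-size x = sym (_∣_.equality (size∣L x))

  weight-cong : ∀ {x y} → a x ≡ a y → weight x ≡ weight y
  weight-cong {x} {y} eq = *-cancelʳ-≡ (weight x) (weight y) (size x) {{>-nonZero (1≤size x)}}
    (trans (weight-size x) (trans (sym (weight-size y)) (cong (weight y *_) (sym (size-cong eq)))))

  -- The conditional expectation of f, scaled by n ! to stay in ℕ.
  E : (Fin n → ℕ) → Fin n → ℕ
  E f x = weight x * count f x

  E-cong : ∀ f {x y} → a x ≡ a y → E f x ≡ E f y
  E-cong f eq = cong₂ _*_ (weight-cong eq) (count-cong f eq)

  E-half : ∀ f → (∀ x → 2 * count f x ≤ size x) → ∀ x → 2 * E f x ≤ L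
  E-half f minor x = begin
    2 * (weight x * count f x)  ≡⟨ swap 2 (weight x) (count f x) ⟩
    weight x * (2 * count f x)  ≤⟨ *-monoʳ-≤ (weight x) (minor x) ⟩
    weight x * size x           ≡⟨ weight-size x ⟩
    L                           ∎
    where
    open ≤-Reasoning
    swap : ∀ a b c → a * (b * c) ≡ b * (a * c)
    swap = solve-∀

  -- Conditional expectation is self-adjoint and fixes `u`: inside an atom `u` and `weight` can be
  -- moved from x to y, after which the sum over x is the size of the atom.
  expectation : ∀ f u → Measurable u → ∑ (λ x → u x ℤ.* + E f x) ≡ + L ℤ.* ∑ λ x → u x ℤ.* + f x
  expectation f u measurable = begin
    ∑ (λ x → u x ℤ.* + E f x)
      ≡⟨ ∑-cong expand ⟩
    ∑ (λ x → ∑ λ y → u x ℤ.* + weight x ℤ.* (+ e x y ℤ.* + f y))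
      ≡⟨ ℤ∑.∑-comm (λ x y → u x ℤ.* + weight x ℤ.* (+ e x y ℤ.* + f y)) ⟩
    ∑ (λ y → ∑ λ x → u x ℤ.* + weight x ℤ.* (+ e x y ℤ.* + f y))
      ≡⟨ (∑-cong λ y → ∑-cong λ x → transport x y) ⟩
    ∑ (λ y → ∑ λ x → u y ℤ.* + weight y ℤ.* + f y ℤ.* + e y x)
      ≡⟨ ∑-cong collect ⟩
    ∑ (λ y → + L ℤ.* (u y ℤ.* + f y))
      ≡⟨ ∑-*ᶻ (+ L) (λ y → u y ℤ.* + f y) ⟨
    + L ℤ.* ∑ (λ y → u y ℤ.* + f y) ∎
    where
    open ≡-Reasoning
    expand : ∀ x → u x ℤ.* + E f x ≡ ∑ λ y → u x ℤ.* + weight x ℤ.* (+ e x y ℤ.* + f y)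
    expand x = begin
      u x ℤ.* + (weight x * count f x)
        ≡⟨ cong (u x ℤ.*_) (ℤ.pos-* (weight x) (count f x)) ⟩
      u x ℤ.* (+ weight x ℤ.* + count f x)
        ≡⟨ ℤ.*-assoc (u x) (+ weight x) (+ count f x) ⟨
      u x ℤ.* + weight x ℤ.* + count f x
        ≡⟨ cong (u x ℤ.* + weight x ℤ.*_) (trans (pos-sum (λ y → e x y * f y)) (∑-cong λ y → ℤ.pos-* (e x y) (f y))) ⟩
      u x ℤ.* + weight x ℤ.* ∑ (λ y → + e x y ℤ.* + f y)
        ≡⟨ ∑-*ᶻ (u x ℤ.* + weight x) (λ y → + e x y ℤ.* + f y) ⟩
      ∑ (λ y → u x ℤ.* + weight x ℤ.* (+ e x y ℤ.* + f y)) ∎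
    swap : ∀ a b c → a ℤ.* (b ℤ.* c) ≡ a ℤ.* c ℤ.* b
    swap = solve-∀ᶻ
    zeroes : ∀ a b c → a ℤ.* (0ℤ ℤ.* b) ≡ c ℤ.* 0ℤ
    zeroes = solve-∀ᶻ
    transport : ∀ x y → u x ℤ.* + weight x ℤ.* (+ e x y ℤ.* + f y) ≡ u y ℤ.* + weight y ℤ.* + f y ℤ.* + e y x
    transport x y = trans (e-elim (λ k → u x ℤ.* + weight x ℤ.* (+ k ℤ.* + f y) ≡ u y ℤ.* + weight y ℤ.* + f y ℤ.* + k) {x} {y}
      (λ eq → trans (cong₂ (λ p q → p ℤ.* + q ℤ.* (+ 1 ℤ.* + f y)) (measurable eq) (weight-cong eq))
        (swap (u y ℤ.* + weight y) (+ 1) (+ f y)))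
      (zeroes (u x ℤ.* + weight x) (+ f y) (u y ℤ.* + weight y ℤ.* + f y)))
      (cong (λ k → u y ℤ.* + weight y ℤ.* + f y ℤ.* + k) (e-sym x y))
    regroup : ∀ u w f s → u ℤ.* w ℤ.* f ℤ.* s ≡ w ℤ.* s ℤ.* (u ℤ.* f)
    regroup = solve-∀ᶻ
    collect : ∀ y → ∑ (λ x → u y ℤ.* + weight y ℤ.* + f y ℤ.* + e y x) ≡ + L ℤ.* (u y ℤ.* + f y)
    collect y = begin
      ∑ (λ x → u y ℤ.* + weight y ℤ.* + f y ℤ.* + e y x)
        ≡⟨ ∑-*ᶻ (u y ℤ.* + weight y ℤ.* + f y) (λ x → + e y x) ⟨
      u y ℤ.* + weight y ℤ.* + f y ℤ.* ∑ (λ x → + e y x)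
        ≡⟨ cong (u y ℤ.* + weight y ℤ.* + f y ℤ.*_) (pos-sum (e y)) ⟨
      u y ℤ.* + weight y ℤ.* + f y ℤ.* + size y
        ≡⟨ regroup (u y) (+ weight y) (+ f y) (+ size y) ⟩
      + weight y ℤ.* + size y ℤ.* (u y ℤ.* + f y)
        ≡⟨ cong (ℤ._* (u y ℤ.* + f y)) (trans (sym (ℤ.pos-* (weight y) (size y))) (cong +_ (weight-size y))) ⟩
      + L ℤ.* (u y ℤ.* + f y) ∎

refine-injective : ∀ {p q N} b c → p <ⁿ N → q <ⁿ N → p + N * ⟦ b ⟧ ≡ q + N * ⟦ c ⟧ → p ≡ q × b ≡ c
refine-injective {p} {q} {N} false false p<N q<N eq = +-cancelʳ-≡ (N * 0) p q eq , refl
refine-injective {p} {q} {N} true  true  p<N q<N eq = +-cancelʳ-≡ (N * 1) p q eq , refl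
refine-injective {p} {q} {N} false true  p<N q<N eq = contradiction
  (subst (_<ⁿ N) (trans (sym (+-identityʳ p)) (trans (cong (λ k → p + k) (sym (*-zeroʳ N))) (trans eq (cong (λ k → q + k) (*-identityʳ N))))) p<N)
  (≤⇒≯ (m≤n+m N q))
refine-injective {p} {q} {N} true  false p<N q<N eq = contradiction
  (subst (_<ⁿ N) (trans (sym (+-identityʳ q)) (trans (cong (λ k → q + k) (sym (*-zeroʳ N))) (trans (sym eq) (cong (λ k → p + k) (*-identityʳ N))))) q<N)
  (≤⇒≯ (m≤n+m N p))

refine-bound : ∀ {p N} b → p <ⁿ N → p + N * ⟦ b ⟧ <ⁿ N + N
refine-bound {p} {N} b p<N = +-mono-<-≤ p<N (≤-trans (*-monoʳ-≤ N (⟦⟧≤1 b)) (≤-reflexive (*-identityʳ N)))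

-- A vertex w whose neighbourhood has density more than 1/2 in some atom can be
-- coloured by that atom.  Otherwise let f be the indicator of a set I of m
-- neighbours of w and Φ its conditional expectation.  As I is independent,
-- ⟨ A , f ⊗ f ⟩ = 0, so if ⟨ A , Φ ⊗ Φ ⟩ is large then adding
-- X = f ⊗ f - Φ ⊗ Φ to the matrix 24 A + S decreases its norm; here X is
-- orthogonal to all matrices that are constant on the old atoms.
module EnergyDecrement {n} (F : Graph n) (triangle-free : TriangleFree F) (m σ : ℕ)
  (m≤deg    : ∀ x → m ≤ Adjacency.deg F x)
  (n≤3m+σ   : n ≤ 3 * m + σ)
  (1≤σ      : 1 ≤ σ)
  (σ-small  : 2000 * σ ≤ m)
  where
  open Adjacency F

  L : ℕ
  L = n !

  -- For a scale k in place of 24 the initial energy is k² n² / 4 and a step gains at least (17 k /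
  -- 200 - 1) m². The integer 24 minimises the ratio k² / (17 k / 200 - 1).
  ℓ Aᶻ-scale W : ℤ
  ℓ = + L
  Aᶻ-scale = + 24 ℤ.* (ℓ ℤ.* ℓ)
  W = + m ℤ.* + m ℤ.* (ℓ ℤ.* ℓ ℤ.* (ℓ ℤ.* ℓ))

  Aᶻ : Fin n → Fin n → ℤ
  Aᶻ x y = + A x y

  energy : (Fin n → Fin n → ℤ) → ℤ
  energy S = ∑∑ λ x y → (Aᶻ-scale ℤ.* Aᶻ x y ℤ.+ S x y) ℤ.* (Aᶻ-scale ℤ.* Aᶻ x y ℤ.+ S x y)

  quadratic : (Fin n → ℕ) → ℕ
  quadratic Φ = sum λ x → sum λ y → A x y * (Φ x * Φ y)

  SparseWeight : Set
  SparseWeight = Σ (Fin n → ℕ) λ Φ → (∀ x → 2 * Φ x ≤ L) × sum Φ ≡ L * m ×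
    400 * quadratic Φ ≤ 17 * m * m * L * L

  module Increment (a : Fin n → ℕ) (w : Fin n)
    (minority : ∀ x → 2 * Atoms.count a (A w) x ≤ Atoms.size a x) where
    open Atoms a hiding (L)

    -- Taking exactly m neighbours gives Φ the exact mass L m, whatever the degree of `w`; passing
    -- to a subset preserves the minority condition.
    I : VertexSet n
    I = proj₁ (subset-of-size (adjacent w) m (m≤deg w))

    I⊆N : ∀ x → x ∈ I → w ~ x
    I⊆N = proj₁ (proj₂ (subset-of-size (adjacent w) m (m≤deg w)))

    |I| : card I ≡ m
    |I| = proj₂ (proj₂ (subset-of-size (adjacent w) m (m≤deg w)))

    f Φ : Fin n → ℕ
    f x = ⟦ I x ⟧
    Φ = E f

    half : ∀ x → 2 * Φ x ≤ L
    half = E-half f λ x → ≤-trans (*-monoʳ-≤ 2 (∑-mono λ y → *-monoʳ-≤ (e x y) (⟦⟧-mono (I⊆N y)))) (minority x)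

    fᶻ Φᶻ : Fin n → ℤ
    fᶻ x = + f x
    Φᶻ x = + Φ x

    total : sum Φ ≡ L * m
    total = ℤ.+-injective (begin
      + sum Φ                          ≡⟨ pos-sum Φ ⟩
      ∑ Φᶻ                             ≡⟨ (∑-cong λ x → ℤ.*-identityˡ (Φᶻ x)) ⟨
      ∑ (λ x → + 1 ℤ.* Φᶻ x)           ≡⟨ expectation f (λ _ → + 1) (λ _ → refl) ⟩
      ℓ ℤ.* ∑ (λ x → + 1 ℤ.* fᶻ x)     ≡⟨ cong (ℓ ℤ.*_) (∑-cong λ x → ℤ.*-identityˡ (fᶻ x)) ⟩
      ℓ ℤ.* ∑ fᶻ                       ≡⟨ cong (ℓ ℤ.*_) (trans (sym (pos-sum f)) (cong +_ |I|)) ⟩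
      ℓ ℤ.* + m                        ≡⟨ ℤ.pos-* L m ⟨
      + (L * m)                        ∎)
      where open ≡-Reasoning

    bilinear : (Fin n → Fin n → ℤ) → (Fin n → ℤ) → (Fin n → ℤ) → ℤ
    bilinear S p q = ∑∑ λ x y → S x y ℤ.* (p x ℤ.* q y)

    bilinear-Φʳ : ∀ S p → (∀ x → Measurable (S x)) → bilinear S p Φᶻ ≡ ℓ ℤ.* bilinear S p fᶻ
    bilinear-Φʳ S p measurable = begin
      ∑ (λ x → ∑ λ y → S x y ℤ.* (p x ℤ.* Φᶻ y))
        ≡⟨ (∑-cong λ x → ∑-cong λ y → sym (ℤ.*-assoc (S x y) (p x) (Φᶻ y))) ⟩
      ∑ (λ x → ∑ λ y → S x y ℤ.* p x ℤ.* Φᶻ y)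
        ≡⟨ (∑-cong λ x → expectation f (λ y → S x y ℤ.* p x) λ eq → cong (ℤ._* p x) (measurable x eq)) ⟩
      ∑ (λ x → ℓ ℤ.* ∑ λ y → S x y ℤ.* p x ℤ.* fᶻ y)
        ≡⟨ ∑-*ᶻ ℓ (λ x → ∑ λ y → S x y ℤ.* p x ℤ.* fᶻ y) ⟨
      ℓ ℤ.* ∑ (λ x → ∑ λ y → S x y ℤ.* p x ℤ.* fᶻ y)
        ≡⟨ cong (ℓ ℤ.*_) (∑-cong λ x → ∑-cong λ y → ℤ.*-assoc (S x y) (p x) (fᶻ y)) ⟩
      ℓ ℤ.* bilinear S p fᶻ ∎
      where open ≡-Reasoning

    bilinear-transpose : ∀ S p q → bilinear S p q ≡ bilinear (λ x y → S y x) q p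
    bilinear-transpose S p q = trans (ℤ∑.∑-comm λ x y → S x y ℤ.* (p x ℤ.* q y))
      (∑∑-cong λ y x → cong (S x y ℤ.*_) (ℤ.*-comm (p x) (q y)))

    bilinear-Φˡ : ∀ S q → (∀ y → Measurable λ x → S x y) → bilinear S Φᶻ q ≡ ℓ ℤ.* bilinear S fᶻ q
    bilinear-Φˡ S q measurable = trans (bilinear-transpose S Φᶻ q)
      (trans (bilinear-Φʳ (λ y x → S x y) q measurable) (cong (ℓ ℤ.*_) (sym (bilinear-transpose S fᶻ q))))

    X : Fin n → Fin n → ℤ
    X x y = ℓ ℤ.* ℓ ℤ.* (fᶻ x ℤ.* fᶻ y) ℤ.+ ℤ.- (+ 1) ℤ.* (Φᶻ x ℤ.* Φᶻ y)

    ∑∑*X : ∀ S → ∑∑ (λ x y → S x y ℤ.* X x y) ≡ ℓ ℤ.* ℓ ℤ.* bilinear S fᶻ fᶻ ℤ.+ ℤ.- (+ 1) ℤ.* bilinear S Φᶻ Φᶻ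
    ∑∑*X S = begin
      ∑∑ (λ x y → S x y ℤ.* X x y)
        ≡⟨ (∑∑-cong λ x y → expand (S x y) (ℓ ℤ.* ℓ) (fᶻ x ℤ.* fᶻ y) (Φᶻ x ℤ.* Φᶻ y)) ⟩
      ∑∑ (λ x y → ℓ ℤ.* ℓ ℤ.* (S x y ℤ.* (fᶻ x ℤ.* fᶻ y)) ℤ.+ ℤ.- (+ 1) ℤ.* (S x y ℤ.* (Φᶻ x ℤ.* Φᶻ y)))
        ≡⟨ ∑∑-+ (λ x y → ℓ ℤ.* ℓ ℤ.* (S x y ℤ.* (fᶻ x ℤ.* fᶻ y))) (λ x y → ℤ.- (+ 1) ℤ.* (S x y ℤ.* (Φᶻ x ℤ.* Φᶻ y))) ⟩
      ∑∑ (λ x y → ℓ ℤ.* ℓ ℤ.* (S x y ℤ.* (fᶻ x ℤ.* fᶻ y))) ℤ.+ ∑∑ (λ x y → ℤ.- (+ 1) ℤ.* (S x y ℤ.* (Φᶻ x ℤ.* Φᶻ y)))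
        ≡⟨ cong₂ ℤ._+_ (∑∑-* (ℓ ℤ.* ℓ) (λ x y → S x y ℤ.* (fᶻ x ℤ.* fᶻ y))) (∑∑-* (ℤ.- (+ 1)) (λ x y → S x y ℤ.* (Φᶻ x ℤ.* Φᶻ y))) ⟩
      ℓ ℤ.* ℓ ℤ.* bilinear S fᶻ fᶻ ℤ.+ ℤ.- (+ 1) ℤ.* bilinear S Φᶻ Φᶻ ∎
      where
      open ≡-Reasoning
      expand : ∀ s k p q → s ℤ.* (k ℤ.* p ℤ.+ ℤ.- (+ 1) ℤ.* q) ≡ k ℤ.* (s ℤ.* p) ℤ.+ ℤ.- (+ 1) ℤ.* (s ℤ.* q)
      expand = solve-∀ᶻ

    -- Against a measurable matrix each replacement of `f` by `Φ` costs one factor ℓ, so both terms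
    -- of `X` contribute ℓ² ⟨ S , f ⊗ f ⟩.
    orthogonal : ∀ S → Measurable₂ S → ∑∑ (λ x y → S x y ℤ.* X x y) ≡ 0ℤ
    orthogonal S (measurableˡ , measurableʳ) = begin
      ∑∑ (λ x y → S x y ℤ.* X x y)
        ≡⟨ ∑∑*X S ⟩
      ℓ ℤ.* ℓ ℤ.* bilinear S fᶻ fᶻ ℤ.+ ℤ.- (+ 1) ℤ.* bilinear S Φᶻ Φᶻ
        ≡⟨ cong (λ b → ℓ ℤ.* ℓ ℤ.* bilinear S fᶻ fᶻ ℤ.+ ℤ.- (+ 1) ℤ.* b)
             (trans (bilinear-Φʳ S Φᶻ measurableʳ) (cong (ℓ ℤ.*_) (bilinear-Φˡ S fᶻ measurableˡ))) ⟩
      ℓ ℤ.* ℓ ℤ.* bilinear S fᶻ fᶻ ℤ.+ ℤ.- (+ 1) ℤ.* (ℓ ℤ.* (ℓ ℤ.* bilinear S fᶻ fᶻ))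
        ≡⟨ cancel ℓ (bilinear S fᶻ fᶻ) ⟩
      0ℤ ∎
      where
      open ≡-Reasoning
      cancel : ∀ l b → l ℤ.* l ℤ.* b ℤ.+ ℤ.- (+ 1) ℤ.* (l ℤ.* (l ℤ.* b)) ≡ 0ℤ
      cancel = solve-∀ᶻ

    A*X : ∑∑ (λ x y → Aᶻ x y ℤ.* X x y) ≡ ℤ.- (+ quadratic Φ)
    A*X = begin
      ∑∑ (λ x y → Aᶻ x y ℤ.* X x y)
        ≡⟨ ∑∑*X Aᶻ ⟩
      ℓ ℤ.* ℓ ℤ.* bilinear Aᶻ fᶻ fᶻ ℤ.+ ℤ.- (+ 1) ℤ.* bilinear Aᶻ Φᶻ Φᶻ
        ≡⟨ cong₂ (λ b c → ℓ ℤ.* ℓ ℤ.* b ℤ.+ ℤ.- (+ 1) ℤ.* c) Aff AΦΦ ⟩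
      ℓ ℤ.* ℓ ℤ.* 0ℤ ℤ.+ ℤ.- (+ 1) ℤ.* + quadratic Φ
        ≡⟨ simplify (ℓ ℤ.* ℓ) (+ quadratic Φ) ⟩
      ℤ.- (+ quadratic Φ) ∎
      where
      open ≡-Reasoning
      simplify : ∀ k b → k ℤ.* 0ℤ ℤ.+ ℤ.- (+ 1) ℤ.* b ≡ ℤ.- b
      simplify = solve-∀ᶻ
      cast : ∀ p q r → + (p * (q * r)) ≡ + p ℤ.* (+ q ℤ.* + r)
      cast p q r = trans (ℤ.pos-* p (q * r)) (cong (+ p ℤ.*_) (ℤ.pos-* q r))
      entry : ∀ x y → A x y * (f x * f y) ≡ 0
      entry x y = trans (cong (A x y *_) (sym (⟦⟧-∧ (I x) (I y)))) (trans (sym (⟦⟧-∧ (adjacent x y) (I x ∧ I y)))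
        (⟦⟧-false λ p → let x~y , q = ∧-elim {adjacent x y} p
                            x∈I , y∈I = ∧-elim {I x} q
          in triangle-free w x y (I⊆N x x∈I , x~y , I⊆N y y∈I)))
      Aff : bilinear Aᶻ fᶻ fᶻ ≡ 0ℤ
      Aff = trans (∑∑-cong {M = λ x y → Aᶻ x y ℤ.* (fᶻ x ℤ.* fᶻ y)} {K = λ _ _ → 0ℤ} λ x y → trans (sym (cast (A x y) (f x) (f y))) (cong +_ (entry x y)))
        (∑∑-zero {n})
      AΦΦ : bilinear Aᶻ Φᶻ Φᶻ ≡ + quadratic Φ
      AΦΦ = sym (trans (pos-sum λ x → sum λ y → A x y * (Φ x * Φ y)) (∑-cong λ x →
        trans (pos-sum λ y → A x y * (Φ x * Φ y)) (∑-cong λ y → cast (A x y) (Φ x) (Φ y))))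

    -- Subtracting a projection does not increase the norm. As `X` is orthogonal to Φ ⊗ Φ, its
    -- square is ℓ² ⟨ f ⊗ f , X ⟩ = ℓ² (ℓ² m² - c²).
    X*X≤W : ∑∑ (λ x y → X x y ℤ.* X x y) ℤ.≤ W
    X*X≤W = linearᶻ (0≤i*i (ℓ ℤ.* c)) (trans (cong (ℤ._+ ℓ ℤ.* c ℤ.* (ℓ ℤ.* c)) X*X) (collect ℓ (+ m) c))
      where
      open ≡-Reasoning
      c : ℤ
      c = ∑ λ x → fᶻ x ℤ.* Φᶻ x
      ff : ∑ (λ x → fᶻ x ℤ.* fᶻ x) ≡ + m
      ff = trans (∑-cong λ x → trans (sym (ℤ.pos-* (f x) (f x))) (cong +_ (⟦⟧-idem (I x))))
        (trans (sym (pos-sum f)) (cong +_ |I|))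
      collect : ∀ l m c → l ℤ.* l ℤ.* (l ℤ.* l ℤ.* (m ℤ.* m) ℤ.+ ℤ.- (+ 1) ℤ.* (c ℤ.* c)) ℤ.+ l ℤ.* c ℤ.* (l ℤ.* c)
        ≡ m ℤ.* m ℤ.* (l ℤ.* l ℤ.* (l ℤ.* l)) ℤ.+ 0ℤ
      collect = solve-∀ᶻ
      expand : ∀ k p q x → (k ℤ.* p ℤ.+ ℤ.- (+ 1) ℤ.* q) ℤ.* x ≡ k ℤ.* (p ℤ.* x) ℤ.+ ℤ.- (+ 1) ℤ.* (q ℤ.* x)
      expand = solve-∀ᶻ
      regroup : ∀ a b c d → a ℤ.* b ℤ.* (c ℤ.* d) ≡ a ℤ.* c ℤ.* (b ℤ.* d)
      regroup = solve-∀ᶻ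
      zeroʳ : ∀ k b → k ℤ.* b ℤ.+ ℤ.- (+ 1) ℤ.* 0ℤ ≡ k ℤ.* b
      zeroʳ = solve-∀ᶻ
      tensor : (p q : Fin n → ℤ) → ∑∑ (λ x y → fᶻ x ℤ.* fᶻ y ℤ.* (p x ℤ.* q y)) ≡ ∑ (λ x → fᶻ x ℤ.* p x) ℤ.* ∑ (λ y → fᶻ y ℤ.* q y)
      tensor p q = trans (∑∑-cong λ x y → regroup (fᶻ x) (fᶻ y) (p x) (q y))
        (∑∑-product (λ x → fᶻ x ℤ.* p x) (λ y → fᶻ y ℤ.* q y))
      X*X : ∑∑ (λ x y → X x y ℤ.* X x y) ≡ ℓ ℤ.* ℓ ℤ.* (ℓ ℤ.* ℓ ℤ.* (+ m ℤ.* + m) ℤ.+ ℤ.- (+ 1) ℤ.* (c ℤ.* c))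
      X*X = begin
        ∑∑ (λ x y → X x y ℤ.* X x y)
          ≡⟨ (∑∑-cong λ x y → expand (ℓ ℤ.* ℓ) (fᶻ x ℤ.* fᶻ y) (Φᶻ x ℤ.* Φᶻ y) (X x y)) ⟩
        ∑∑ (λ x y → ℓ ℤ.* ℓ ℤ.* (fᶻ x ℤ.* fᶻ y ℤ.* X x y) ℤ.+ ℤ.- (+ 1) ℤ.* (Φᶻ x ℤ.* Φᶻ y ℤ.* X x y))
          ≡⟨ ∑∑-+ (λ x y → ℓ ℤ.* ℓ ℤ.* (fᶻ x ℤ.* fᶻ y ℤ.* X x y)) (λ x y → ℤ.- (+ 1) ℤ.* (Φᶻ x ℤ.* Φᶻ y ℤ.* X x y)) ⟩
        ∑∑ (λ x y → ℓ ℤ.* ℓ ℤ.* (fᶻ x ℤ.* fᶻ y ℤ.* X x y)) ℤ.+ ∑∑ (λ x y → ℤ.- (+ 1) ℤ.* (Φᶻ x ℤ.* Φᶻ y ℤ.* X x y))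
          ≡⟨ cong₂ ℤ._+_ (∑∑-* (ℓ ℤ.* ℓ) (λ x y → fᶻ x ℤ.* fᶻ y ℤ.* X x y)) (∑∑-* (ℤ.- (+ 1)) (λ x y → Φᶻ x ℤ.* Φᶻ y ℤ.* X x y)) ⟩
        ℓ ℤ.* ℓ ℤ.* ∑∑ (λ x y → fᶻ x ℤ.* fᶻ y ℤ.* X x y) ℤ.+ ℤ.- (+ 1) ℤ.* ∑∑ (λ x y → Φᶻ x ℤ.* Φᶻ y ℤ.* X x y)
          ≡⟨ cong (λ b → ℓ ℤ.* ℓ ℤ.* ∑∑ (λ x y → fᶻ x ℤ.* fᶻ y ℤ.* X x y) ℤ.+ ℤ.- (+ 1) ℤ.* b)
               (orthogonal (λ x y → Φᶻ x ℤ.* Φᶻ y)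
                 ((λ y eq → cong (λ k → + k ℤ.* Φᶻ y) (E-cong f eq)) , (λ x eq → cong (λ k → Φᶻ x ℤ.* + k) (E-cong f eq)))) ⟩
        ℓ ℤ.* ℓ ℤ.* ∑∑ (λ x y → fᶻ x ℤ.* fᶻ y ℤ.* X x y) ℤ.+ ℤ.- (+ 1) ℤ.* 0ℤ
          ≡⟨ zeroʳ (ℓ ℤ.* ℓ) (∑∑ (λ x y → fᶻ x ℤ.* fᶻ y ℤ.* X x y)) ⟩
        ℓ ℤ.* ℓ ℤ.* ∑∑ (λ x y → fᶻ x ℤ.* fᶻ y ℤ.* X x y)
          ≡⟨ cong (ℓ ℤ.* ℓ ℤ.*_) (∑∑*X λ x y → fᶻ x ℤ.* fᶻ y) ⟩
        ℓ ℤ.* ℓ ℤ.* (ℓ ℤ.* ℓ ℤ.* bilinear (λ x y → fᶻ x ℤ.* fᶻ y) fᶻ fᶻ ℤ.+ ℤ.- (+ 1) ℤ.* bilinear (λ x y → fᶻ x ℤ.* fᶻ y) Φᶻ Φᶻ)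
          ≡⟨ cong₂ (λ b d → ℓ ℤ.* ℓ ℤ.* (ℓ ℤ.* ℓ ℤ.* b ℤ.+ ℤ.- (+ 1) ℤ.* d))
               (trans (tensor fᶻ fᶻ) (cong₂ ℤ._*_ ff ff)) (tensor Φᶻ Φᶻ) ⟩
        ℓ ℤ.* ℓ ℤ.* (ℓ ℤ.* ℓ ℤ.* (+ m ℤ.* + m) ℤ.+ ℤ.- (+ 1) ℤ.* (c ℤ.* c)) ∎

    energy-increment : ∀ S → Measurable₂ S → energy (λ x y → S x y ℤ.+ X x y) ≡
      energy S ℤ.+ (+ 48 ℤ.* (ℓ ℤ.* ℓ) ℤ.* (ℤ.- (+ quadratic Φ)) ℤ.+ (+ 2 ℤ.* 0ℤ ℤ.+ ∑∑ λ x y → X x y ℤ.* X x y))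
    energy-increment S measurable = begin
      energy (λ x y → S x y ℤ.+ X x y)
        ≡⟨ (∑∑-cong λ x y → expand (ℓ ℤ.* ℓ) (Aᶻ x y) (S x y) (X x y)) ⟩
      ∑∑ (λ x y → M x y ℤ.+ (k ℤ.* AX x y ℤ.+ (+ 2 ℤ.* SX x y ℤ.+ XX x y)))
        ≡⟨ trans (∑∑-+ M (λ x y → k ℤ.* AX x y ℤ.+ (+ 2 ℤ.* SX x y ℤ.+ XX x y)))
             (cong (ℤ._+_ (energy S)) (trans (∑∑-+ (λ x y → k ℤ.* AX x y) (λ x y → + 2 ℤ.* SX x y ℤ.+ XX x y))
               (cong (ℤ._+_ (∑∑ λ x y → k ℤ.* AX x y)) (∑∑-+ (λ x y → + 2 ℤ.* SX x y) XX)))) ⟩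
      energy S ℤ.+ (∑∑ (λ x y → k ℤ.* AX x y) ℤ.+ (∑∑ (λ x y → + 2 ℤ.* SX x y) ℤ.+ ∑∑ XX))
        ≡⟨ cong₂ (λ b c → energy S ℤ.+ (b ℤ.+ (c ℤ.+ ∑∑ XX)))
             (trans (∑∑-* k AX) (cong (k ℤ.*_) A*X)) (trans (∑∑-* (+ 2) SX) (cong (+ 2 ℤ.*_) (orthogonal S measurable))) ⟩
      energy S ℤ.+ (k ℤ.* (ℤ.- (+ quadratic Φ)) ℤ.+ (+ 2 ℤ.* 0ℤ ℤ.+ ∑∑ XX)) ∎
      where
      open ≡-Reasoning
      k : ℤ
      k = + 48 ℤ.* (ℓ ℤ.* ℓ)
      M AX SX XX : Fin n → Fin n → ℤ
      M x y = (Aᶻ-scale ℤ.* Aᶻ x y ℤ.+ S x y) ℤ.* (Aᶻ-scale ℤ.* Aᶻ x y ℤ.+ S x y)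
      AX x y = Aᶻ x y ℤ.* X x y
      SX x y = S x y ℤ.* X x y
      XX x y = X x y ℤ.* X x y
      expand : ∀ k a s x → (+ 24 ℤ.* k ℤ.* a ℤ.+ (s ℤ.+ x)) ℤ.* (+ 24 ℤ.* k ℤ.* a ℤ.+ (s ℤ.+ x)) ≡
        (+ 24 ℤ.* k ℤ.* a ℤ.+ s) ℤ.* (+ 24 ℤ.* k ℤ.* a ℤ.+ s) ℤ.+
          (+ 48 ℤ.* k ℤ.* (a ℤ.* x) ℤ.+ (+ 2 ℤ.* (s ℤ.* x) ℤ.+ x ℤ.* x))
      expand = solve-∀ᶻ

  module _ (a : Fin n → ℕ) where
    open Atoms a hiding (L)

    minority? : Dec (∀ w → ∃ λ x → size x <ⁿ 2 * count (A w) x)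
    minority? = Fin.all? λ w → Fin.any? λ x → size x <? 2 * count (A w) x

    -- The neighbourhoods of adjacent vertices are disjoint and cannot both fill more than half of
    -- the same atom.
    majority-colouring : ∀ {N} → (∀ x → a x <ⁿ N) → (∀ w → ∃ λ x → size x <ⁿ 2 * count (A w) x) → Colourable F N
    majority-colouring {N} a<N majority = colourableOn⇒colourable {X = λ _ → true} (λ _ → tt)
      (colour , (λ w _ → a<N (x w)) , proper)
      where
      x : Fin n → Fin n
      x w = proj₁ (majority w)
      colour : Fin n → ℕ
      colour w = a (x w)
      disjoint : ∀ {u v} → u ~ v → ∀ y → count (A u) y + count (A v) y ≤ size y
      disjoint {u} {v} u~v y = ≤-trans
        (≤-reflexive (sym (∑-distrib-+ (λ z → e y z * A u z) (λ z → e y z * A v z))))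
        (∑-mono λ z → ≤-trans (≤-reflexive (sym (*-distribˡ-+ (e y z) (A u z) (A v z))))
          (≤-trans (*-monoʳ-≤ (e y z) (subst₂ (λ p q → p + q ≤ 1) (A-sym z u) (A-sym z v) (adjacent-exclusive F triangle-free u~v z)))
            (≤-reflexive (*-identityʳ (e y z)))))
      proper : ∀ u v → T true → T true → u ~ v → colour u ≢ colour v
      proper u v _ _ u~v eq = contradiction
        (halves-overlap (count (A u) (x u)) (count (A v) (x u)) (size (x u)) (disjoint u~v (x u))
          (proj₂ (majority u))
          (subst₂ (λ s c → s <ⁿ 2 * c) (sym (size-cong eq)) (sym (count-cong (A v) eq)) (proj₂ (majority v))))
        λ ()

  -- A step lowers 25 energy by at least 3 · 17 W - 25 W = 26 W.  At the start
  -- the energy is 144 n² L⁴, and 25 · 144 n² < 1290 · 26 m² as n is close to 3 m.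
  decrement : ∀ j E q x →
    + 17 ℤ.* W ℤ.≤ + 400 ℤ.* (ℓ ℤ.* ℓ ℤ.* + q) → x ℤ.≤ W →
    + 25 ℤ.* E ℤ.+ + 1 ℤ.≤ + suc j ℤ.* (+ 26 ℤ.* W) →
    + 25 ℤ.* (E ℤ.+ (+ 48 ℤ.* (ℓ ℤ.* ℓ) ℤ.* (ℤ.- (+ q)) ℤ.+ (+ 2 ℤ.* 0ℤ ℤ.+ x))) ℤ.+ + 1 ℤ.≤ + j ℤ.* (+ 26 ℤ.* W)
  decrement j E q x dense x≤W bound = linearᶻ
    (ℤ.+-mono-≤ (ℤ.+-mono-≤ (ℤ.*-monoˡ-≤-nonNeg (+ 3) dense) (ℤ.*-monoˡ-≤-nonNeg (+ 25) x≤W)) bound)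
    (trans (cong (λ i → + 25 ℤ.* (E ℤ.+ (+ 48 ℤ.* (ℓ ℤ.* ℓ) ℤ.* (ℤ.- (+ q)) ℤ.+ (+ 2 ℤ.* 0ℤ ℤ.+ x))) ℤ.+ + 1 ℤ.+
        (+ 3 ℤ.* (+ 400 ℤ.* (ℓ ℤ.* ℓ ℤ.* + q)) ℤ.+ + 25 ℤ.* W ℤ.+ i ℤ.* (+ 26 ℤ.* W))) (ℤ.pos-+ 1 j))
      (identity E (ℓ ℤ.* ℓ) (+ q) x W (+ j)))
    where
    identity : ∀ E k q x w j →
      + 25 ℤ.* (E ℤ.+ (+ 48 ℤ.* k ℤ.* (ℤ.- q) ℤ.+ (+ 2 ℤ.* 0ℤ ℤ.+ x))) ℤ.+ + 1 ℤ.+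
        (+ 3 ℤ.* (+ 400 ℤ.* (k ℤ.* q)) ℤ.+ + 25 ℤ.* w ℤ.+ (+ 1 ℤ.+ j) ℤ.* (+ 26 ℤ.* w))
      ≡ j ℤ.* (+ 26 ℤ.* w) ℤ.+ (+ 3 ℤ.* (+ 17 ℤ.* w) ℤ.+ + 25 ℤ.* x ℤ.+ (+ 25 ℤ.* E ℤ.+ + 1))
    identity = solve-∀ᶻ

  cast-W : + (m * m * (L * L * (L * L))) ≡ W
  cast-W = trans (ℤ.pos-* (m * m) (L * L * (L * L))) (cong₂ ℤ._*_ (ℤ.pos-* m m)
    (trans (ℤ.pos-* (L * L) (L * L)) (cong₂ ℤ._*_ (ℤ.pos-* L L) (ℤ.pos-* L L))))

  scale-up : ∀ q → 17 * m * m * L * L ≤ 400 * q → + 17 ℤ.* W ℤ.≤ + 400 ℤ.* (ℓ ℤ.* ℓ ℤ.* + q)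
  scale-up q dense = subst₂ ℤ._≤_ (trans (cong +_ (left m L)) castˡ) (trans (cong +_ (right L q)) castʳ)
    (ℤ.+≤+ (*-monoʳ-≤ (L * L) dense))
    where
    left : ∀ m L → L * L * (17 * m * m * L * L) ≡ 17 * (m * m * (L * L * (L * L)))
    left = solve-∀
    right : ∀ L q → L * L * (400 * q) ≡ 400 * (L * L * q)
    right = solve-∀
    castˡ : + (17 * (m * m * (L * L * (L * L)))) ≡ + 17 ℤ.* W
    castˡ = trans (ℤ.pos-* 17 (m * m * (L * L * (L * L)))) (cong (ℤ._*_ (+ 17)) cast-W)
    castʳ : + (400 * (L * L * q)) ≡ + 400 ℤ.* (ℓ ℤ.* ℓ ℤ.* + q)
    castʳ = trans (ℤ.pos-* 400 (L * L * q)) (cong (ℤ._*_ (+ 400))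
      (trans (ℤ.pos-* (L * L) q) (cong (ℤ._* + q) (ℤ.pos-* L L))))

  0≤energy : ∀ S → 0ℤ ℤ.≤ energy S
  0≤energy S = 0≤∑ λ x → 0≤∑ λ y → 0≤i*i (Aᶻ-scale ℤ.* Aᶻ x y ℤ.+ S x y)

  -- Here `j` counts the refinements still affordable, each of which doubles the range `N` of
  -- labels. The `+ 1` makes the energy bound strict, so that it fails for j = 0.
  Dichotomy : ℕ → Set
  Dichotomy j = ∀ N a S → (∀ x → a x <ⁿ N) → Atoms.Measurable₂ a S →
    + 25 ℤ.* energy S ℤ.+ + 1 ℤ.≤ + j ℤ.* (+ 26 ℤ.* W) → Colourable F (2 ^ j * N) ⊎ SparseWeight

  module Refinement (j N : ℕ) (a : Fin n → ℕ) (S : Fin n → Fin n → ℤ) (a<N : ∀ x → a x <ⁿ N)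
    (measurable : Atoms.Measurable₂ a S) (bound : + 25 ℤ.* energy S ℤ.+ + 1 ℤ.≤ + suc j ℤ.* (+ 26 ℤ.* W))
    (w : Fin n) (minority : ∀ x → 2 * Atoms.count a (A w) x ≤ Atoms.size a x) where
    open Increment a w minority

    a′ : Fin n → ℕ
    a′ x = a x + N * ⟦ I x ⟧

    a≡ : ∀ {x y} → a′ x ≡ a′ y → a x ≡ a y
    a≡ {x} {y} eq = proj₁ (refine-injective (I x) (I y) (a<N x) (a<N y) eq)

    f≡ : ∀ {x y} → a′ x ≡ a′ y → f x ≡ f y
    f≡ {x} {y} eq = cong ⟦_⟧ (proj₂ (refine-injective (I x) (I y) (a<N x) (a<N y) eq))

    X-cong : ∀ {x x′ y y′} → f x ≡ f x′ → a x ≡ a x′ → f y ≡ f y′ → a y ≡ a y′ → X x y ≡ X x′ y′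
    X-cong p q r s = cong₂ (λ i j → ℓ ℤ.* ℓ ℤ.* i ℤ.+ ℤ.- (+ 1) ℤ.* j)
      (cong₂ (λ i j → + i ℤ.* + j) p r)
      (cong₂ (λ i j → + i ℤ.* + j) (Atoms.E-cong a f q) (Atoms.E-cong a f s))

    refine : Dichotomy j → 17 * m * m * L * L ≤ 400 * quadratic Φ → Colourable F (2 ^ suc j * N) ⊎ SparseWeight
    refine ih dense = [ (λ c → inj₁ (subst (Colourable F) (double (2 ^ j) N) c)) , inj₂ ]′
      (ih (N + N) a′ (λ x y → S x y ℤ.+ X x y) (λ x → refine-bound (I x) (a<N x))
        ( (λ y {x} {x′} eq → cong₂ ℤ._+_ (proj₁ measurable y (a≡ eq)) (X-cong {x} {x′} {y} {y} (f≡ eq) (a≡ eq) refl refl))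
        , (λ x {y} {y′} eq → cong₂ ℤ._+_ (proj₂ measurable x (a≡ eq)) (X-cong {x} {x} {y} {y′} refl refl (f≡ eq) (a≡ eq))))
        (subst (λ E → + 25 ℤ.* E ℤ.+ + 1 ℤ.≤ + j ℤ.* (+ 26 ℤ.* W)) (sym (energy-increment S measurable))
          (decrement j (energy S) (quadratic Φ) (∑∑ λ x y → X x y ℤ.* X x y) (scale-up (quadratic Φ) dense) X*X≤W bound)))
      where
      double : ∀ k N → k * (N + N) ≡ 2 * k * N
      double = solve-∀

    weight : 400 * quadratic Φ ≤ 17 * m * m * L * L → SparseWeight
    weight sparse = Φ , half , total , sparse

    step : Dichotomy j → Colourable F (2 ^ suc j * N) ⊎ SparseWeight
    step ih = [ inj₂ ∘ weight , refine ih ]′ (≤-total (400 * quadratic Φ) (17 * m * m * L * L))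

  dichotomy : ∀ j → Dichotomy j
  dichotomy zero N a S a<N measurable bound = contradiction
    (ℤ.≤-trans (ℤ.+-monoˡ-≤ (+ 1) (ℤ.*-monoˡ-≤-nonNeg (+ 25) (0≤energy S))) bound) λ { (ℤ.+≤+ ()) }
  dichotomy (suc j) N a S a<N measurable bound = case minority? a of λ where
    (yes majority) → inj₁ (colourable-mono F
      (≤-trans (≤-reflexive (sym (*-identityˡ N))) (*-monoˡ-≤ N (m^n>0 2 (suc j)))) (majority-colouring a a<N majority))
    (no ¬majority) →
      let w , ¬x = Fin.¬∀⟶∃¬ n _ (λ w → Fin.any? λ x → Atoms.size a x <? 2 * Atoms.count a (A w) x) ¬majority
      in Refinement.step j N a S a<N measurable bound w (λ x → ≮⇒≥ λ lt → ¬x (x , lt)) (dichotomy j)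

  -- This makes all entries of 24 A + S equal to 12 or -12 up to ℓ², so the initial energy does not
  -- depend on the number of edges.
  initial : Fin n → Fin n → ℤ
  initial _ _ = ℤ.- (+ 12) ℤ.* (ℓ ℤ.* ℓ)

  initial-energy : energy initial ≡ + (144 * (n * n * (L * L * (L * L))))
  initial-energy = begin
    energy initial
      ≡⟨ (∑∑-cong λ x y → entry (adjacent x y)) ⟩
    ∑∑ {n} (λ _ _ → c)
      ≡⟨ trans (∑-cong {n} λ _ → ∑ᶻ-const n c) (∑ᶻ-const n (+ n ℤ.* c)) ⟩
    + n ℤ.* (+ n ℤ.* c)
      ≡⟨ trans (cong (ℤ._*_ (+ n)) (sym (ℤ.pos-* n (144 * (L * L * (L * L)))))) (sym (ℤ.pos-* n (n * (144 * (L * L * (L * L)))))) ⟩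
    + (n * (n * (144 * (L * L * (L * L)))))
      ≡⟨ cong +_ (regroup n (L * L * (L * L))) ⟩
    + (144 * (n * n * (L * L * (L * L)))) ∎
    where
    open ≡-Reasoning
    c : ℤ
    c = + (144 * (L * L * (L * L)))
    regroup : ∀ n k → n * (n * (144 * k)) ≡ 144 * (n * n * k)
    regroup = solve-∀
    cast : + 144 ℤ.* (ℓ ℤ.* ℓ ℤ.* (ℓ ℤ.* ℓ)) ≡ c
    cast = sym (trans (ℤ.pos-* 144 (L * L * (L * L))) (cong (ℤ._*_ (+ 144)) (trans (ℤ.pos-* (L * L) (L * L)) (cong₂ ℤ._*_ (ℤ.pos-* L L) (ℤ.pos-* L L)))))
    on² : ∀ k → (+ 24 ℤ.* k ℤ.* + 1 ℤ.+ ℤ.- (+ 12) ℤ.* k) ℤ.* (+ 24 ℤ.* k ℤ.* + 1 ℤ.+ ℤ.- (+ 12) ℤ.* k) ≡ + 144 ℤ.* (k ℤ.* k)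
    on² = solve-∀ᶻ
    off² : ∀ k → (+ 24 ℤ.* k ℤ.* + 0 ℤ.+ ℤ.- (+ 12) ℤ.* k) ℤ.* (+ 24 ℤ.* k ℤ.* + 0 ℤ.+ ℤ.- (+ 12) ℤ.* k) ≡ + 144 ℤ.* (k ℤ.* k)
    off² = solve-∀ᶻ
    entry : ∀ b → (Aᶻ-scale ℤ.* + ⟦ b ⟧ ℤ.+ ℤ.- (+ 12) ℤ.* (ℓ ℤ.* ℓ)) ℤ.* (Aᶻ-scale ℤ.* + ⟦ b ⟧ ℤ.+ ℤ.- (+ 12) ℤ.* (ℓ ℤ.* ℓ)) ≡ c
    entry true  = trans (on² (ℓ ℤ.* ℓ)) cast
    entry false = trans (off² (ℓ ℤ.* ℓ)) cast

  initial-small : + 25 ℤ.* energy initial ℤ.+ + 1 ℤ.≤ + 1290 ℤ.* (+ 26 ℤ.* W)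
  initial-small = subst₂ ℤ._≤_ left right (ℤ.+≤+ (begin
    25 * (144 * (n * n * K)) + 1   ≡⟨ cong (_+ 1) (regroup 360 10 25 144 (n * n) K refl) ⟩
    360 * (10 * (n * n) * K) + 1   ≤⟨ +-mono-≤ (*-monoʳ-≤ 360 (*-monoˡ-≤ K (order-square-bound m n (order-bound m n σ n≤3m+σ σ-small)))) 1≤ ⟩
    360 * (92 * (m * m) * K) + 420 * (m * m * K)  ≡⟨ collect 360 92 420 (m * m) K ⟩
    (360 * 92 + 420) * (m * m * K) ≡⟨ *-assoc 1290 26 (m * m * K) ⟩
    1290 * (26 * (m * m * K))      ∎))
    where
    open ≤-Reasoning
    K : ℕ
    K = L * L * (L * L)
    1≤m : 1 ≤ m
    1≤m = m-positive m σ σ-small 1≤σ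
    1≤L : 1 ≤ L
    1≤L = 1≤n! n
    1≤ : 1 ≤ 420 * (m * m * K)
    1≤ = *-mono-≤ {1} {420} (s≤s z≤n) (*-mono-≤ (*-mono-≤ 1≤m 1≤m) (*-mono-≤ (*-mono-≤ 1≤L 1≤L) (*-mono-≤ 1≤L 1≤L)))
    regroup : ∀ a b c d x k → c * d ≡ a * b → c * (d * (x * k)) ≡ a * (b * x * k)
    regroup a b c d x k eq = trans (sym (*-assoc c d (x * k))) (trans (cong (_* (x * k)) eq) (lemma a b x k))
      where
      lemma : ∀ a b x k → a * b * (x * k) ≡ a * (b * x * k)
      lemma = solve-∀
    collect : ∀ a b c x k → a * (b * x * k) + c * (x * k) ≡ (a * b + c) * (x * k)
    collect = solve-∀
    left : + (25 * (144 * (n * n * K)) + 1) ≡ + 25 ℤ.* energy initial ℤ.+ + 1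
    left = trans (ℤ.pos-+ (25 * (144 * (n * n * K))) 1) (cong (ℤ._+ + 1)
      (trans (ℤ.pos-* 25 (144 * (n * n * K))) (cong (ℤ._*_ (+ 25)) (sym initial-energy))))
    right : + (1290 * (26 * (m * m * K))) ≡ + 1290 ℤ.* (+ 26 ℤ.* W)
    right = trans (ℤ.pos-* 1290 (26 * (m * m * K))) (cong (ℤ._*_ (+ 1290)) (trans (ℤ.pos-* 26 (m * m * K))
      (cong (ℤ._*_ (+ 26)) cast-W)))

  colourable-or-sparse : Colourable F (2 ^ 1290) ⊎ SparseWeight
  colourable-or-sparse = [ (λ c → inj₁ (subst (Colourable F) (*-identityʳ (2 ^ 1290)) c)) , inj₂ ]′
    (dichotomy 1290 1 (λ _ → 0) initial (λ _ → ≤-refl) ((λ _ _ → refl) , (λ _ _ → refl)) initial-small)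

order-vs-defect : ∀ P m n σ → 7 * P ≤ n → n ≤ 3 * m + σ → σ ≤ P → 2 * P ≤ m
order-vs-defect P m n σ h1 h2 h3 =
  *-cancelˡ-≤ 3 (linear (0) (h1 ⊕ h2 ⊕ h3) (solve (P ∷ m ∷ n ∷ σ ∷ [])))

radius-bound : ∀ P σ m → 500 * P ≤ m → σ ≤ P → 50 * (81 * (2 * P + σ)) ≤ 28 * m
radius-bound P σ m h1 h2 =
  linear (1850 * P) (28 ⊗ h1 ⊕ 4050 ⊗ h2) (solve (P ∷ σ ∷ m ∷ []))

third-bound : ∀ n m r σ → n ≤ r + 3 * m → r ≤ 2 → 2 ≤ σ → n ≤ 3 * m + σ
third-bound n m r σ h1 h2 h3 =
  linear (0) (h1 ⊕ h2 ⊕ h3) (solve (n ∷ m ∷ r ∷ σ ∷ []))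

-- Numerical estimates

square≤pow : ∀ u → (u + 3) * (u + 3) ≤ 9 * 2 ^ u
square≤pow zero    = ≤-refl
square≤pow (suc u) = linear (u * u + 4 * u + 2) (2 ⊗ square≤pow u) (identity u (2 ^ u))
  where
  identity : ∀ u p → (suc u + 3) * (suc u + 3) + 2 * (9 * p) + (u * u + 4 * u + 2) ≡ 9 * (2 * p) + 2 * ((u + 3) * (u + 3))
  identity = solve-∀

linear≤pow : ∀ c u → 9 * c ≤ u → c * (u + 3) ≤ 2 ^ u
linear≤pow c u 9c≤u = *-cancelˡ-≤ 9 (begin
  9 * (c * (u + 3))    ≡⟨ *-assoc 9 c (u + 3) ⟨
  9 * c * (u + 3)      ≤⟨ *-monoˡ-≤ (u + 3) (≤-trans 9c≤u (m≤m+n u 3)) ⟩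
  (u + 3) * (u + 3)    ≤⟨ square≤pow u ⟩
  9 * 2 ^ u            ∎)
  where open ≤-Reasoning

m≤m^suc : ∀ m a → m ≤ m ^ suc a
m≤m^suc zero    a = z≤n
m≤m^suc (suc m) a = ≤-trans (≤-reflexive (sym (*-identityʳ (suc m)))) (*-monoʳ-≤ (suc m) (m^n>0 (suc m) a))

-- With k = a u + v the claim follows from K a (u + 3) ≤ 2 ^ u.
polynomial≤pow : ∀ a K → .{{NonZero a}} → ∀ k → 9 * (K * a) * a ≤ k → K * (k + 2) ^ a ≤ 2 ^ k
polynomial≤pow a@(suc b) K k large = begin
  K * (k + 2) ^ a              ≤⟨ *-mono-≤ (m≤m^suc K b) (^-monoˡ-≤ a k+2≤) ⟩
  K ^ a * (a * (u + 3)) ^ a    ≡⟨ ^-distrib-* K (a * (u + 3)) a ⟨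
  (K * (a * (u + 3))) ^ a      ≡⟨ cong (_^ a) (*-assoc K a (u + 3)) ⟨
  (K * a * (u + 3)) ^ a        ≤⟨ ^-monoˡ-≤ a (linear≤pow (K * a) u u-large) ⟩
  (2 ^ u) ^ a                  ≡⟨ ^-*-assoc 2 u a ⟩
  2 ^ (u * a)                  ≤⟨ ^-monoʳ-≤ 2 (m/n*n≤m k a) ⟩
  2 ^ k                        ∎
  where
  open ≤-Reasoning
  u : ℕ
  u = k / a
  u-large : 9 * (K * a) ≤ u
  u-large = ≤-trans (≤-reflexive (sym (m*n/n≡m (9 * (K * a)) a))) (/-monoˡ-≤ a large)
  k+2≤ : k + 2 ≤ a * (u + 3)
  k+2≤ = begin
    k + 2                  ≡⟨ cong (_+ 2) (m≡m%n+[m/n]*n k a) ⟩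
    k % a + u * a + 2      ≤⟨ +-monoˡ-≤ 2 (+-monoˡ-≤ (u * a) (s≤s⁻¹ (m%n<n k a))) ⟩
    b + u * a + 2          ≤⟨ m≤m+n _ (2 * b + 1) ⟩
    b + u * a + 2 + (2 * b + 1) ≡⟨ identity b u ⟩
    a * (u + 3)            ∎
    where
    identity : ∀ b u → b + u * suc b + 2 + (2 * b + 1) ≡ suc b * (u + 3)
    identity = solve-∀

binary-log : ∀ n → 1 ≤ n → ∃ λ k → 2 ^ k ≤ n × n <ⁿ 2 ^ suc k
binary-log (suc zero)    _ = 0 , ≤-refl , ≤-refl
binary-log (suc (suc n)) _ with binary-log (suc n) (s≤s z≤n)
... | k , lower , upper with suc (suc n) <? 2 ^ suc k
...   | yes lt = k , ≤-trans lower (n≤1+n _) , lt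
...   | no ¬lt = suc k , ≮⇒≥ ¬lt , ≤-<-trans upper (^-monoʳ-< 2 (s≤s (s≤s z≤n)) (n<1+n (suc k)))

^-cancelʳ-≤ : ∀ {a b} j → .{{NonZero j}} → a ^ j ≤ b ^ j → a ≤ b
^-cancelʳ-≤ (suc j) le = ≮⇒≥ λ lt → <⇒≱ (^-monoˡ-< (suc j) lt) le

-- The least q with q ^ j > 40 σ is at least 2, so q ≤ 2 (q - 1), and the power of q - 1 is still at
-- most 40 σ.
small-base : ∀ j σ → .{{NonZero j}} → 1 ≤ σ → ∃ λ q → 1 ≤ q × 40 * σ <ⁿ q ^ j × q ^ j ≤ 2 ^ j * (40 * σ)
small-base j@(suc i) σ 1≤σ = bound (least (λ q → 40 * σ <? q ^ j) (suc (40 * σ)) (m≤m^suc (suc (40 * σ)) i))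
  where
  40σ≥1 : 1 ≤ 40 * σ
  40σ≥1 = *-mono-≤ {1} {40} (s≤s z≤n) 1≤σ
  bound : ∃ (IsLeast λ q → 40 * σ <ⁿ q ^ j) → ∃ λ q → 1 ≤ q × 40 * σ <ⁿ q ^ j × q ^ j ≤ 2 ^ j * (40 * σ)
  bound (zero        , ()   , _)
  bound (suc zero    , 40σ< , _) = contradiction (<-≤-trans 40σ< (≤-reflexive (^-zeroˡ j))) (≤⇒≯ 40σ≥1)
  bound (suc (suc q) , 40σ< , min) = suc (suc q) , s≤s z≤n , 40σ< , (begin
    suc (suc q) ^ j      ≤⟨ ^-monoˡ-≤ j (≤-trans (m≤m+n (suc (suc q)) q) (≤-reflexive (identity q))) ⟩
    (2 * suc q) ^ j      ≡⟨ ^-distrib-* 2 (suc q) j ⟩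
    2 ^ j * suc q ^ j    ≤⟨ *-monoʳ-≤ (2 ^ j) (≮⇒≥ λ lt → <⇒≱ (n<1+n (suc q)) (min (suc q) lt)) ⟩
    2 ^ j * (40 * σ)     ∎)
    where
    open ≤-Reasoning
    identity : ∀ q → suc (suc q) + q ≡ 2 * suc q
    identity = solve-∀

-- Colouring graphs of small defect

module StructureTheorem {n} (F : Graph n) (triangle-free : TriangleFree F) (m σ j : ℕ) .{{_ : NonZero j}}
  (m≤deg   : ∀ x → m ≤ Adjacency.deg F x)
  (3m≤n    : 3 * m ≤ n)
  (n≤3m+σ  : n ≤ 3 * m + σ)
  (1≤σ     : 1 ≤ σ)
  (l : ℕ) (1≤l : 1 ≤ l) (l-large : 2 * n <ⁿ 2 ^ l)
  (σ-small : 40 * (14000 * l) ^ j * σ ^ suc j ≤ n ^ j)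
  where
  open ≤-Reasoning

  private
    base = small-base j σ 1≤σ

    q : ℕ
    q = proj₁ base

    1≤q : 1 ≤ q
    1≤q = proj₁ (proj₂ base)

    instance
      q≢0 : NonZero q
      q≢0 = >-nonZero 1≤q

    P : ℕ
    P = 1000 * (q * l * σ)

    -- In 14000 = 2 · 7 · 1000 the factor 2 pays for rounding q up. The outcome 2 P ≤ m provides
    -- both 2000 σ ≤ m and the condition on the radius q l.
    7P≤n : 7 * P ≤ n
    7P≤n = ^-cancelʳ-≤ j (begin
      (7 * P) ^ j                            ≡⟨ cong (_^ j) (regroup 7 1000 q l σ) ⟩
      (q * (7000 * l * σ)) ^ j               ≡⟨ ^-distrib-* q (7000 * l * σ) j ⟩
      q ^ j * (7000 * l * σ) ^ j             ≤⟨ *-monoˡ-≤ ((7000 * l * σ) ^ j) (proj₂ (proj₂ (proj₂ base))) ⟩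
      2 ^ j * (40 * σ) * (7000 * l * σ) ^ j  ≡⟨ swap (2 ^ j) (40 * σ) ((7000 * l * σ) ^ j) ⟩
      40 * σ * (2 ^ j * (7000 * l * σ) ^ j)  ≡⟨ cong (40 * σ *_) (^-distrib-* 2 (7000 * l * σ) j) ⟨
      40 * σ * (2 * (7000 * l * σ)) ^ j      ≡⟨ cong (λ c → 40 * σ * c ^ j) (assoc 2 7000 l σ) ⟩
      40 * σ * (14000 * l * σ) ^ j           ≡⟨ cong (40 * σ *_) (^-distrib-* (14000 * l) σ j) ⟩
      40 * σ * ((14000 * l) ^ j * σ ^ j)     ≡⟨ last 40 σ ((14000 * l) ^ j) (σ ^ j) ⟩
      40 * (14000 * l) ^ j * σ ^ suc j       ≤⟨ σ-small ⟩
      n ^ j                                  ∎)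
      where
      regroup : ∀ a b q l s → a * (b * (q * l * s)) ≡ q * (a * b * l * s)
      regroup = solve-∀
      swap : ∀ a b c → a * b * c ≡ b * (a * c)
      swap = solve-∀
      assoc : ∀ a b l s → a * (b * l * s) ≡ a * b * l * s
      assoc = solve-∀
      last : ∀ a s c d → a * s * (c * d) ≡ a * c * (s * d)
      last = solve-∀

    σ≤qlσ : σ ≤ q * l * σ
    σ≤qlσ = ≤-trans (≤-reflexive (sym (*-identityˡ σ))) (*-monoˡ-≤ σ (*-mono-≤ 1≤q 1≤l))

    2P≤m : 2 * P ≤ m
    2P≤m = order-vs-defect P m n σ 7P≤n n≤3m+σ (≤-trans σ≤qlσ (m≤m+n _ _))

    scaled : ∀ c → c ≤ 2000 → c * (q * l * σ) ≤ m
    scaled c c≤ = ≤-trans (*-monoˡ-≤ (q * l * σ) c≤) (≤-trans (≤-reflexive (*-assoc 2 1000 (q * l * σ))) 2P≤m)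

    2000σ≤m : 2000 * σ ≤ m
    2000σ≤m = ≤-trans (*-monoʳ-≤ 2000 σ≤qlσ) (scaled 2000 ≤-refl)

    radius : 50 * ((2 * (q * l) + 1) * (81 * σ)) ≤ 28 * m
    radius = ≤-trans (≤-reflexive (regroup 50 81 (q * l) σ))
      (radius-bound (q * l * σ) σ m (scaled 500 (≤ᵇ⇒≤ 500 2000 tt)) σ≤qlσ)
      where
      regroup : ∀ a b r s → a * ((2 * r + 1) * (b * s)) ≡ a * (b * (2 * (r * s) + s))
      regroup = solve-∀

  colouring : Colourable F (2 ^ 1290) ⊎ Colourable F 11 ⊎ Colourable F (3 + j)
  colouring = [ inj₁ , inj₂ ∘ structured ]′
    (EnergyDecrement.colourable-or-sparse F triangle-free m σ m≤deg n≤3m+σ 1≤σ 2000σ≤m)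
    where
    structured : EnergyDecrement.SparseWeight F triangle-free m σ m≤deg n≤3m+σ 1≤σ 2000σ≤m →
      Colourable F 11 ⊎ Colourable F (3 + j)
    structured (Φ , half , total , sparse) =
      Weighted.colouring F triangle-free m σ (n !) Φ m≤deg 3m≤n n≤3m+σ 1≤σ 2000σ≤m (1≤n! n) half total sparse
        q l j l-large (proj₁ (proj₂ (proj₂ base))) radius

-- Absorbing logarithms into the exponent

module _ (j e : ℕ) .{{_ : NonZero j}} .{{_ : NonZero e}} where

  private
    Q : ℕ
    Q = suc (suc j * e)

    K₀ K : ℕ
    K₀ = 40 * 14000 ^ j
    K = (K₀ * 3 ^ suc j) ^ Q

    instance
      jQ≢0 : NonZero (j * Q)
      jQ≢0 = m*n≢0 j Q

  module _ (l : ℕ) where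

    -- For l of order log n both are polylogarithmic. If σ ≤ X, then so is B σ ^ (j + 1), which is
    -- below n. If σ ≥ X, the one factor by which σ ^ Q exceeds σ ^ ((j + 1) e) absorbs B ^ e 3 ^ Q.
    B X : ℕ
    B = 40 * (14000 * l) ^ j
    X = B ^ e * 3 ^ Q

    small-case : ∀ {n σ} → σ ≤ X → K * l ^ (j * Q) ≤ n → B * σ ^ suc j ≤ n ^ j
    small-case {n} {σ} σ≤X small = begin
      B * σ ^ suc j                      ≤⟨ *-monoʳ-≤ B (^-monoˡ-≤ (suc j) σ≤X) ⟩
      B * X ^ suc j                      ≡⟨ cong (B *_) (^-distrib-* (B ^ e) (3 ^ Q) (suc j)) ⟩
      B * ((B ^ e) ^ suc j * (3 ^ Q) ^ suc j) ≡⟨ *-assoc B _ _ ⟨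
      B * (B ^ e) ^ suc j * (3 ^ Q) ^ suc j ≡⟨ cong₂ _*_ powB pow3 ⟩
      B ^ Q * (3 ^ suc j) ^ Q            ≡⟨ ^-distrib-* B (3 ^ suc j) Q ⟨
      (B * 3 ^ suc j) ^ Q                ≡⟨ cong (_^ Q) factor ⟩
      (K₀ * 3 ^ suc j * l ^ j) ^ Q       ≡⟨ ^-distrib-* (K₀ * 3 ^ suc j) (l ^ j) Q ⟩
      K * (l ^ j) ^ Q                    ≡⟨ cong (K *_) (^-*-assoc l j Q) ⟩
      K * l ^ (j * Q)                    ≤⟨ small ⟩
      n                                  ≤⟨ m≤m^ j ⟩
      n ^ j                              ∎
      where
      open ≤-Reasoning
      m≤m^ : ∀ j → .{{NonZero j}} → n ≤ n ^ j
      m≤m^ (suc j) = m≤m^suc n j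
      powB : B * (B ^ e) ^ suc j ≡ B ^ Q
      powB = cong (B *_) (trans (^-*-assoc B e (suc j)) (cong (B ^_) (*-comm e (suc j))))
      pow3 : (3 ^ Q) ^ suc j ≡ (3 ^ suc j) ^ Q
      pow3 = trans (^-*-assoc 3 Q (suc j)) (trans (cong (3 ^_) (*-comm Q (suc j))) (sym (^-*-assoc 3 (suc j) Q)))
      regroup : ∀ a b c d → a * (b * c) * d ≡ a * b * d * c
      regroup = solve-∀
      factor : B * 3 ^ suc j ≡ K₀ * 3 ^ suc j * l ^ j
      factor = trans (cong (λ c → 40 * c * 3 ^ suc j) (^-distrib-* 14000 l j)) (regroup 40 (14000 ^ j) (l ^ j) (3 ^ suc j))

    large-case : ∀ {n σ} → 1 ≤ σ → X ≤ σ → σ ^ Q ≤ 3 ^ Q * n ^ (j * e) → B * σ ^ suc j ≤ n ^ j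
    large-case {n} {σ} 1≤σ X≤σ bound = ^-cancelʳ-≤ e (*-cancelˡ-≤ σ {{>-nonZero 1≤σ}} (begin
      σ * (B * σ ^ suc j) ^ e            ≡⟨ cong (σ *_) (^-distrib-* B (σ ^ suc j) e) ⟩
      σ * (B ^ e * (σ ^ suc j) ^ e)      ≡⟨ swap σ (B ^ e) _ ⟩
      B ^ e * (σ * (σ ^ suc j) ^ e)      ≡⟨ cong (λ c → B ^ e * (σ * c)) (^-*-assoc σ (suc j) e) ⟩
      B ^ e * σ ^ Q                      ≤⟨ *-monoʳ-≤ (B ^ e) bound ⟩
      B ^ e * (3 ^ Q * n ^ (j * e))      ≡⟨ *-assoc (B ^ e) (3 ^ Q) _ ⟨
      X * n ^ (j * e)                    ≤⟨ *-monoˡ-≤ (n ^ (j * e)) X≤σ ⟩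
      σ * n ^ (j * e)                    ≡⟨ cong (σ *_) (^-*-assoc n j e) ⟨
      σ * (n ^ j) ^ e                    ∎))
      where
      open ≤-Reasoning
      swap : ∀ a b c → a * (b * c) ≡ b * (a * c)
      swap = solve-∀

  deficiency-threshold : ∃ λ N → ∀ n → N ≤ n → 1 ≤ n × (∀ σ → 1 ≤ σ → σ ^ Q ≤ 3 ^ Q * n ^ (j * e) →
    ∃ λ l → 1 ≤ l × 2 * n <ⁿ 2 ^ l × 40 * (14000 * l) ^ j * σ ^ suc j ≤ n ^ j)
  deficiency-threshold = 2 ^ k₀ , λ n N≤n → ≤-trans (m^n>0 2 k₀) N≤n , λ σ 1≤σ bound →
    let k , lower , upper = binary-log n (≤-trans (m^n>0 2 k₀) N≤n)
        k₀≤k : k₀ ≤ k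
        k₀≤k = s≤s⁻¹ (≰⇒> λ k+1≤k₀ → <⇒≱ upper (≤-trans (^-monoʳ-≤ 2 k+1≤k₀) N≤n))
        polylog = ≤-trans (polynomial≤pow (j * Q) K k k₀≤k) lower
    in k + 2 , ≤-trans (s≤s z≤n) (m≤n+m 2 k) ,
       subst (λ l → 2 * n <ⁿ 2 ^ l) (+-comm 2 k) (*-monoʳ-< 2 upper) ,
       [ (λ σ≤X → small-case (k + 2) {n} {σ} σ≤X polylog) , (λ X≤σ → large-case (k + 2) {n} {σ} 1≤σ X≤σ bound) ]′ (≤-total σ (X (k + 2)))
    where
    k₀ : ℕ
    k₀ = 9 * (K * (j * Q)) * (j * Q)

-- Degrees and chromatic numbers

degree≡deg : ∀ {n} (F : Graph n) v → Graph.degree F v ≡ Adjacency.deg F v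
degree≡deg F v = count-tabulate (Graph.adjacent F v)
  where
  count-tabulate : ∀ {n} (X : VertexSet n) → Subset.∣ Vec.tabulate X ∣ ≡ card X
  count-tabulate {zero}  X = refl
  count-tabulate {suc n} X with X zero
  ... | true  = cong suc (count-tabulate (X ∘ suc))
  ... | false = count-tabulate (X ∘ suc)

foldr-⊓-≤ : ∀ {n} c (f : Fin n → ℕ) i → Vector.foldr _⊓_ c f ≤ f i
foldr-⊓-≤ c f zero    = m⊓n≤m _ _
foldr-⊓-≤ c f (suc i) = ≤-trans (m⊓n≤n (f zero) _) (foldr-⊓-≤ c (f ∘ suc) i)

foldr-⊓-≤-start : ∀ {n} c (f : Fin n → ℕ) → Vector.foldr _⊓_ c f ≤ c
foldr-⊓-≤-start {zero}  c f = ≤-refl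
foldr-⊓-≤-start {suc n} c f = ≤-trans (m⊓n≤n (f zero) _) (foldr-⊓-≤-start c (f ∘ suc))

foldr-⊓-cong : ∀ {n} c {f g : Fin n → ℕ} → (∀ i → f i ≡ g i) → Vector.foldr _⊓_ c f ≡ Vector.foldr _⊓_ c g
foldr-⊓-cong {zero}  c eq = refl
foldr-⊓-cong {suc n} c eq = cong₂ _⊓_ (eq zero) (foldr-⊓-cong c (eq ∘ suc))

δ≤deg : ∀ {n} (F : Graph n) v → δ F ≤ Adjacency.deg F v
δ≤deg {n} F v = ≤-trans (foldr-⊓-≤ n (Graph.degree F) v) (≤-reflexive (degree≡deg F v))

χ-minimal : ∀ {n} (F : Graph n) {k} → Colourable F k → χ F ≤ k
χ-minimal F {k} = proj₂ (proj₂ (chromaticNumber F)) k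

χ-colourable : ∀ {n} (F : Graph n) → Colourable F (χ F)
χ-colourable F = proj₁ (proj₂ (chromaticNumber F))

uncolourable⇒<χ : ∀ {n} (F : Graph n) {k} → ¬ Colourable F k → k <ⁿ χ F
uncolourable⇒<χ F ¬c = ≰⇒> λ χ≤k → ¬c (colourable-mono F χ≤k (χ-colourable F))

-- Triangle-free graphs of large chromatic number: the pairs i < j with (i , j)
-- adjacent to (j , k).  A vertex u encodes the pair (u / M , u % M).

module ShiftGraph (M : ℕ) .{{_ : NonZero M}} (n : ℕ) where

  fst snd : Fin n → ℕ
  fst u = toℕ u / M
  snd u = toℕ u % M

  -- A vertex beyond M * M has `fst` at least M, hence above `snd`, and is isolated; so one
  -- construction serves all n ≥ M * M.
  valid : Fin n → Bool
  valid u = fst u <ᵇ snd u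

  arrow : Fin n → Fin n → Bool
  arrow u v = valid u ∧ valid v ∧ (snd u ≡ᵇ fst v)

  arrow-elim : ∀ u v → T (arrow u v) → fst u <ⁿ snd u × fst v <ⁿ snd v × snd u ≡ fst v
  arrow-elim u v p =
    let u< , q = ∧-elim {valid u} p
        v< , r = ∧-elim {valid v} q
    in <ᵇ⇒< (fst u) (snd u) u< , <ᵇ⇒< (fst v) (snd v) v< , ≡ᵇ⇒≡ (snd u) (fst v) r

  arrow-< : ∀ u v → T (arrow u v) → fst u <ⁿ fst v
  arrow-< u v p = let u< , _ , eq = arrow-elim u v p in <-≤-trans u< (≤-reflexive eq)

  graph : Graph n
  graph = record
    { adjacent    = λ u v → arrow u v ∨ arrow v u
    ; symmetric   = λ u v → ∨-comm (arrow u v) (arrow v u)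
    ; irreflexive = λ v → ¬-not λ eq → [ loop v , loop v ]′ (∨-elim {arrow v v} (subst T (sym eq) tt))
    }
    where
    loop : ∀ v → ¬ T (arrow v v)
    loop v p = <-irrefl refl (arrow-< v v p)

  fork : ∀ u v w → T (arrow u v) → T (arrow u w) → ¬ T (arrow v w)
  fork u v w p q r = <-irrefl (trans (sym (proj₂ (proj₂ (arrow-elim u v p)))) (proj₂ (proj₂ (arrow-elim u w q)))) (arrow-< v w r)

  triangle-free : TriangleFree graph
  triangle-free u v w (p , q , r) with ∨-elim {arrow u v} p | ∨-elim {arrow v w} q | ∨-elim {arrow u w} r
  ... | inj₁ uv | inj₁ vw | inj₁ uw = fork u v w uv uw vw
  ... | inj₁ uv | inj₁ vw | inj₂ wu = <-asym (<-trans (arrow-< u v uv) (arrow-< v w vw)) (arrow-< w u wu)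
  ... | inj₁ uv | inj₂ wv | inj₁ uw = fork u w v uw uv wv
  ... | inj₁ uv | inj₂ wv | inj₂ wu = fork w u v wu wv uv
  ... | inj₂ vu | inj₁ vw | inj₁ uw = fork v u w vu vw uw
  ... | inj₂ vu | inj₁ vw | inj₂ wu = fork v w u vw vu wu
  ... | inj₂ vu | inj₂ wv | inj₁ uw = <-asym (<-trans (arrow-< w v wv) (arrow-< v u vu)) (arrow-< u w uw)
  ... | inj₂ vu | inj₂ wv | inj₂ wu = fork w v u wv wu vu

  module _ (M²≤n : M * M ≤ n) where

    index< : ∀ {i j} → i <ⁿ M → j <ⁿ M → j + i * M <ⁿ n
    index< {i} {j} i<M j<M = <-≤-trans (+-monoˡ-< (i * M) j<M) (≤-trans (*-monoˡ-≤ M i<M) M²≤n)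

    pair : ∀ {i j} → i <ⁿ M → j <ⁿ M → Fin n
    pair i<M j<M = fromℕ< (index< i<M j<M)

    snd-pair : ∀ {i j} (i<M : i <ⁿ M) (j<M : j <ⁿ M) → snd (pair i<M j<M) ≡ j
    snd-pair {i} {j} i<M j<M = trans (cong (_% M) (Fin.toℕ-fromℕ< (index< i<M j<M)))
      (trans ([m+kn]%n≡m%n j i M) (m<n⇒m%n≡m j<M))

    fst-pair : ∀ {i j} (i<M : i <ⁿ M) (j<M : j <ⁿ M) → fst (pair i<M j<M) ≡ i
    fst-pair {i} {j} i<M j<M = *-cancelʳ-≡ _ i M (+-cancelˡ-≡ j _ _ (trans (cong (_+ fst u * M) (sym (snd-pair i<M j<M)))
      (trans (sym (m≡m%n+[m/n]*n (toℕ u) M)) (Fin.toℕ-fromℕ< (index< i<M j<M)))))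
      where u = pair i<M j<M

    pair-arrow : ∀ {i j k} (i<M : i <ⁿ M) (j<M : j <ⁿ M) (k<M : k <ⁿ M) → i <ⁿ j → j <ⁿ k →
      T (arrow (pair i<M j<M) (pair j<M k<M))
    pair-arrow i<M j<M k<M i<j j<k = ∧-intro
      (<⇒<ᵇ (subst₂ _<ⁿ_ (sym (fst-pair i<M j<M)) (sym (snd-pair i<M j<M)) i<j)) (∧-intro
      (<⇒<ᵇ (subst₂ _<ⁿ_ (sym (fst-pair j<M k<M)) (sym (snd-pair j<M k<M)) j<k))
      (≡⇒≡ᵇ _ _ (trans (snd-pair i<M j<M) (sym (fst-pair j<M k<M)))))

    -- If i < j, then the colour of (i , j) occurs among the pairs starting in
    -- i but not among those starting in j.
    uncolourable : ∀ {k} → 2 ^ k <ⁿ M → ¬ Colourable graph k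
    uncolourable {k} large (c , proper) =
      let i , j , i<j , eq = Fin.pigeonhole large palette-code
          i<M = Fin.toℕ<n i
          j<M = Fin.toℕ<n j
          used-i : Used i (c (pair i<M j<M))
          used-i = j , i<j , refl
          l , j<l , same = transfer eq used-i
      in proper (pair i<M j<M) (pair j<M (Fin.toℕ<n l)) (∨-introˡ (pair-arrow i<M j<M (Fin.toℕ<n l) i<j j<l)) (sym same)
      where
      Used : Fin M → Fin k → Set
      Used i x = ∃ λ j → toℕ i <ⁿ toℕ j × c (pair (Fin.toℕ<n i) (Fin.toℕ<n j)) ≡ x
      used? : ∀ i x → Dec (Used i x)
      used? i x = Fin.any? λ j → (toℕ i <? toℕ j) ×-dec (c (pair (Fin.toℕ<n i) (Fin.toℕ<n j)) Fin.≟ x)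
      palette : Fin M → Fin k → Fin 2
      palette i x = Inverse.from Fin.2↔Bool ⌊ used? i x ⌋
      palette-code : Fin M → Fin (2 ^ k)
      palette-code i = funToFin (palette i)
      transfer : ∀ {i j x} → palette-code i ≡ palette-code j → Used i x → Used j x
      transfer {i} {j} {x} eq u = toWitness {a? = used? j x} (subst T
        (Injection.injective (↔⇒↣ (↔-sym Fin.2↔Bool)) (trans (sym (Fin.finToFun-funToFin (palette i) x))
          (trans (cong (λ f → finToFun f x) eq) (Fin.finToFun-funToFin (palette j) x))))
        (fromWitness {a? = used? i x} u))

-- The maximum in the definition of the deficiency

module Transfer {n} {F G : Graph n} (eq : ∀ u v → Graph.adjacent F u v ≡ Graph.adjacent G u v) where

  δ-cong : δ F ≡ δ G
  δ-cong = foldr-⊓-cong n λ v → trans (degree≡deg F v)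
    (trans (sum-cong-≗ λ u → cong ⟦_⟧ (eq v u)) (sym (degree≡deg G v)))

  colourable : ∀ {k} → Colourable F k → Colourable G k
  colourable (c , proper) = c , λ u v u~v → proper u v (subst T (sym (eq u v)) u~v)

transfer-admissible : ∀ {n t} {F G : Graph n} → (∀ u v → Graph.adjacent F u v ≡ Graph.adjacent G u v) →
  Admissible t F → Admissible t G
transfer-admissible {F = F} {G} eq (triangle-free , t≤χ) =
  (λ u v w (p , q , r) → triangle-free u v w
    (subst T (sym (eq u v)) p , subst T (sym (eq v w)) q , subst T (sym (eq u w)) r)) ,
  ≤-trans t≤χ (χ-minimal F (Transfer.colourable {F = G} {G = F} (λ u v → sym (eq u v)) (χ-colourable G)))

admissible? : ∀ {n} t (F : Graph n) → Dec (Admissible t F)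
admissible? t F = (Fin.all? λ u → Fin.all? λ v → Fin.all? λ w →
  ¬? (T? (adjacent u v) ×-dec (T? (adjacent v w) ×-dec T? (adjacent u w)))) ×-dec (t ≤? χ F)
  where open Graph F

module Codes (n : ℕ) where

  bit : Fin ((2 ^ n) ^ n) → Fin n → Fin n → Bool
  bit c u v = Inverse.to Fin.2↔Bool (finToFun {2} {n} (finToFun {2 ^ n} {n} c u) v)

  -- Any bit matrix becomes a graph by symmetrising it and clearing the diagonal. Up to pointwise
  -- equality of adjacency every graph arises, which makes the search over graphs finite.
  decode : Fin ((2 ^ n) ^ n) → Graph n
  decode c = record
    { adjacent    = λ u v → (bit c u v ∧ bit c v u) ∧ not ⌊ u Fin.≟ v ⌋
    ; symmetric   = λ u v → cong₂ _∧_ (∧-comm (bit c u v) (bit c v u)) (cong not (≟-sym u v))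
    ; irreflexive = λ v → ¬-not λ eq → not-T (proj₂ (∧-elim {bit c v v ∧ bit c v v} (subst T (sym eq) tt))) (fromWitness refl)
    }
    where
    ≟-sym : ∀ (u v : Fin n) → ⌊ u Fin.≟ v ⌋ ≡ ⌊ v Fin.≟ u ⌋
    ≟-sym u v with u Fin.≟ v | v Fin.≟ u
    ... | yes _ | yes _ = refl
    ... | no  _ | no  _ = refl
    ... | yes p | no ¬p = contradiction (sym p) ¬p
    ... | no ¬p | yes p = contradiction (sym p) ¬p

  encode : Graph n → Fin ((2 ^ n) ^ n)
  encode F = funToFin λ u → funToFin λ v → Inverse.from Fin.2↔Bool (Graph.adjacent F u v)

  bit-encode : ∀ F u v → bit (encode F) u v ≡ Graph.adjacent F u v
  bit-encode F u v = begin
    Inverse.to Fin.2↔Bool (finToFun (finToFun {2 ^ n} (encode F) u) v)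
      ≡⟨ cong (λ c → Inverse.to Fin.2↔Bool (finToFun c v)) (Fin.finToFun-funToFin (λ u → funToFin (row u)) u) ⟩
    Inverse.to Fin.2↔Bool (finToFun (funToFin (row u)) v)
      ≡⟨ cong (Inverse.to Fin.2↔Bool) (Fin.finToFun-funToFin (row u) v) ⟩
    Inverse.to Fin.2↔Bool (row u v)
      ≡⟨ Inverse.strictlyInverseˡ Fin.2↔Bool (Graph.adjacent F u v) ⟩
    Graph.adjacent F u v ∎
    where
    open ≡-Reasoning
    row : Fin n → Fin n → Fin 2
    row u v = Inverse.from Fin.2↔Bool (Graph.adjacent F u v)

  decode-encode : ∀ F u v → Graph.adjacent F u v ≡ Graph.adjacent (decode (encode F)) u v
  decode-encode F u v rewrite bit-encode F u v | bit-encode F v u | sym (Graph.symmetric F u v) = simplify (Graph.adjacent F u v) (u Fin.≟ v) λ { refl → Graph.irreflexive F u }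
    where
    simplify : ∀ b (d : Dec (u ≡ v)) → (u ≡ v → b ≡ false) → b ≡ (b ∧ b) ∧ not ⌊ d ⌋
    simplify b     (yes eq) loop = trans (loop eq) (sym (∧-zeroʳ (b ∧ b)))
    simplify false (no _)   _    = refl
    simplify true  (no _)   _    = refl

  module _ (t : ℕ) where

    HasMinDegree : ℕ → Set
    HasMinDegree d = Σ (Graph n) λ F → Admissible t F × d ≤ δ F

    hasMinDegree? : ∀ d → Dec (HasMinDegree d)
    hasMinDegree? d = map′ (λ (c , p) → decode c , p) encode-solution
      (Fin.any? λ c → admissible? t (decode c) ×-dec (d ≤? δ (decode c)))
      where
      encode-solution : HasMinDegree d → ∃ λ c → Admissible t (decode c) × d ≤ δ (decode c)
      encode-solution (F , admissible , d≤δ) = encode F ,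
        transfer-admissible {F = F} {G = decode (encode F)} (decode-encode F) admissible ,
        subst (d ≤_) (Transfer.δ-cong {F = F} {G = decode (encode F)} (decode-encode F)) d≤δ

    -- The maximum precedes the least degree that is not reached. The latter exists because the fold
    -- in `δ` starts at n, whence δ ≤ n.
    maximum : Σ (Graph n) (Admissible t) → ∃ λ d → IsMaxMinDegree t n d
    maximum (F₀ , admissible₀) = extract
      (least (λ d → ¬? (hasMinDegree? d)) (suc n) λ (F , _ , n<δ) → <⇒≱ n<δ (foldr-⊓-≤-start n (Graph.degree F)))
      where
      extract : ∃ (IsLeast λ d → ¬ HasMinDegree d) → ∃ λ d → IsMaxMinDegree t n d
      extract (zero  , none , _)   = contradiction (F₀ , admissible₀ , z≤n) none
      extract (suc d , none , min) with hasMinDegree? d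
      ... | no  ¬p = contradiction (min d ¬p) (<⇒≱ ≤-refl)
      ... | yes (F , admissible , d≤δ) = d ,
        (F , admissible , ≤-antisym (s≤s⁻¹ (≰⇒> λ lt → none (F , admissible , lt))) d≤δ) ,
        λ G admissible′ → s≤s⁻¹ (≰⇒> λ lt → none (G , admissible′ , lt))

maxMinDegree-exists : ∀ t → ∃ λ N → ∀ n → N ≤ n → ∃ λ d → IsMaxMinDegree t n d
maxMinDegree-exists t = M * M , λ n M²≤n → Codes.maximum n t
  (ShiftGraph.graph M n , ShiftGraph.triangle-free M n ,
    <⇒≤ (uncolourable⇒<χ (ShiftGraph.graph M n) (ShiftGraph.uncolourable M n M²≤n ≤-refl)))
  where
  M : ℕ
  M = suc (2 ^ t)

-- Rational and real powers

private module ℚ^ = Exp ℚ.+-*-rawSemiring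

linearℚ : ∀ {a b l r} → l ℚ.≤ r → a ℚ.+ r ≡ b ℚ.+ l → a ℚ.≤ b
linearℚ {a} {b} {l} {r} l≤r eq = subst₂ ℚ._≤_ (cancel a r) (cancel b r)
  (ℚ.+-monoˡ-≤ (ℚ.- r) (ℚ.≤-trans (ℚ.≤-reflexive eq) (ℚ.+-monoʳ-≤ b l≤r)))
  where
  open +-*-Solver renaming (solve to solveℚ)
  cancel : ∀ a r → (a ℚ.+ r) ℚ.+ ℚ.- r ≡ a
  cancel = solveℚ 2 (λ a r → (a :+ r) :+ :- r := a) refl

ι : ℕ → ℚ
ι n = ℚ.fromℤ (+ n)

ι-* : ∀ m n → ι (m * n) ≡ ι m ℚ.* ι n
ι-* m n = ℚ.toℚᵘ-injective (ℚᵘ.≃-trans (ℚᵘ.*≡* (cong (ℤ._* + 1) (ℤ.pos-* m n))) (ℚᵘ.≃-sym (ℚ.toℚᵘ-homo-* (ι m) (ι n))))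

ι-+ : ∀ m n → ι (m + n) ≡ ι m ℚ.+ ι n
ι-+ m n = ℚ.toℚᵘ-injective (ℚᵘ.≃-trans (ℚᵘ.*≡* (cong (ℤ._* + 1) eq)) (ℚᵘ.≃-sym (ℚ.toℚᵘ-homo-+ (ι m) (ι n))))
  where
  eq : + (m + n) ≡ + m ℤ.* + 1 ℤ.+ + n ℤ.* + 1
  eq = trans (ℤ.pos-+ m n) (cong₂ ℤ._+_ (sym (ℤ.*-identityʳ (+ m))) (sym (ℤ.*-identityʳ (+ n))))

ι-mono : ∀ {m n} → m ≤ n → ι m ℚ.≤ ι n
ι-mono m≤n = ℚ.*≤* (subst₂ ℤ._≤_ (sym (ℤ.*-identityʳ _)) (sym (ℤ.*-identityʳ _)) (ℤ.+≤+ m≤n))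

ι-cancel : ∀ {m n} → ι m ℚ.≤ ι n → m ≤ n
ι-cancel le = ℤ.drop‿+≤+ (subst₂ ℤ._≤_ (ℤ.*-identityʳ _) (ℤ.*-identityʳ _) (ℚ.drop-*≤* le))

ι-^ : ∀ x k → ι (x ^ k) ≡ ι x ℚ^.^ k
ι-^ x zero    = refl
ι-^ x (suc k) = trans (ι-* x (x ^ k)) (cong (ι x ℚ.*_) (ι-^ x k))

instance
  ι-nonNeg : ∀ {n} → ℚ.NonNegative (ι n)
  ι-nonNeg = _

q*↧q : ∀ q → q ℚ.* ι (ℚ.↧ₙ q) ≡ ℚ.fromℤ (ℚ.↥ q)
q*↧q q@(ℚ.mkℚ i d-1 _) = ℚ.toℚᵘ-injective (ℚᵘ.≃-trans (ℚ.toℚᵘ-homo-* q (ι (ℚ.↧ₙ q))) (ℚᵘ.*≡* (regroup i (suc d-1))))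
  where
  regroup : ∀ i d → (i ℤ.* + d) ℤ.* + 1 ≡ i ℤ.* + (d * 1)
  regroup i d = trans (ℤ.*-identityʳ _) (cong (λ d → i ℤ.* + d) (sym (*-identityʳ d)))

^ℚ-distrib-* : ∀ x y k → (x ℚ.* y) ℚ^.^ k ≡ x ℚ^.^ k ℚ.* y ℚ^.^ k
^ℚ-distrib-* x y zero    = refl
^ℚ-distrib-* x y (suc k) = trans (cong (x ℚ.* y ℚ.*_) (^ℚ-distrib-* x y k)) (regroup x y (x ℚ^.^ k) (y ℚ^.^ k))
  where
  open +-*-Solver renaming (solve to solveℚ)
  regroup : ∀ a b c d → a ℚ.* b ℚ.* (c ℚ.* d) ≡ a ℚ.* c ℚ.* (b ℚ.* d)
  regroup = solveℚ 4 (λ a b c d → a :* b :* (c :* d) := a :* c :* (b :* d)) refl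

p≤∣p∣ : ∀ p → p ℚ.≤ ℚ.∣ p ∣
p≤∣p∣ p = case ℚ.≤-total 0ℚ p of λ where
  (inj₁ 0≤p) → ℚ.≤-reflexive (sym (ℚ.0≤p⇒∣p∣≡p 0≤p))
  (inj₂ p≤0) → ℚ.≤-trans p≤0 (ℚ.0≤∣p∣ p)

*-mono-1≤ : ∀ {p q} → 1ℚ ℚ.≤ p → 1ℚ ℚ.≤ q → 1ℚ ℚ.≤ p ℚ.* q
*-mono-1≤ {p} {q} 1≤p 1≤q = ℚ.≤-trans 1≤p (ℚ.≤-trans (ℚ.≤-reflexive (sym (ℚ.*-identityʳ p)))
  (ℚ.*-monoˡ-≤-nonNeg p {{ℚ.nonNegative (ℚ.≤-trans (ι-mono {0} {1} z≤n) 1≤p)}} 1≤q))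

^ℚ-1≤ : ∀ {p} → 1ℚ ℚ.≤ p → ∀ k → 1ℚ ℚ.≤ p ℚ^.^ k
^ℚ-1≤ 1≤p zero    = ℚ.≤-refl
^ℚ-1≤ 1≤p (suc k) = *-mono-1≤ 1≤p (^ℚ-1≤ 1≤p k)

3≤root : ∀ n σ p Q → .{{NonZero Q}} → 1 ≤ n → 3 ^ Q * n ^ p ≤ σ ^ Q → 3 ≤ σ
3≤root n σ p Q 1≤n bound = ^-cancelʳ-≤ Q (≤-trans (≤-trans (≤-reflexive (sym (*-identityʳ (3 ^ Q))))
  (*-monoʳ-≤ (3 ^ Q) (m^n>0 n {{>-nonZero 1≤n}} p))) bound)

-- The bound s ≥ n ^ (p / Q) for s = σ / 3 implies s ≥ n ^ r for all r ≤ p / Q.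
module PowerBound (n σ p Q : ℕ) .{{_ : NonZero Q}} (1≤n : 1 ≤ n) (bound : 3 ^ Q * n ^ p ≤ σ ^ Q)
  (s : ℚ) (3s≡σ : ι 3 ℚ.* s ≡ ι σ) where

  1≤s : 1ℚ ℚ.≤ s
  1≤s = ℚ.*-cancelˡ-≤-pos (ι 3) (ℚ.≤-trans (ι-mono (3≤root n σ p Q 1≤n bound)) (ℚ.≤-reflexive (sym 3s≡σ)))

  power : ∀ a b → a * Q ≤ p * b → ι n ℚ^.^ a ℚ.≤ s ℚ^.^ b
  power a b aQ≤pb = ℚ.*-cancelˡ-≤-pos (ι (3 ^ b)) {{ℚ.positive (ℚ.<-≤-trans (ℚ.positive⁻¹ 1ℚ) (ι-mono (m^n>0 3 b)))}} (begin
    ι (3 ^ b) ℚ.* ι n ℚ^.^ a      ≡⟨ cong (ι (3 ^ b) ℚ.*_) (ι-^ n a) ⟨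
    ι (3 ^ b) ℚ.* ι (n ^ a)       ≡⟨ ι-* (3 ^ b) (n ^ a) ⟨
    ι (3 ^ b * n ^ a)             ≤⟨ ι-mono integral ⟩
    ι (σ ^ b)                     ≡⟨ ι-^ σ b ⟩
    ι σ ℚ^.^ b                    ≡⟨ cong (ℚ^._^ b) 3s≡σ ⟨
    (ι 3 ℚ.* s) ℚ^.^ b            ≡⟨ ^ℚ-distrib-* (ι 3) s b ⟩
    ι 3 ℚ^.^ b ℚ.* s ℚ^.^ b       ≡⟨ cong (ℚ._* s ℚ^.^ b) (ι-^ 3 b) ⟨
    ι (3 ^ b) ℚ.* s ℚ^.^ b        ∎)
    where
    open ℚ.≤-Reasoning
    integral : 3 ^ b * n ^ a ≤ σ ^ b
    integral = ^-cancelʳ-≤ Q (≤-trans (≤-reflexive (trans (^-distrib-* (3 ^ b) (n ^ a) Q)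
        (cong₂ _*_ (trans (^-*-assoc 3 b Q) (trans (cong (3 ^_) (*-comm b Q)) (sym (^-*-assoc 3 Q b)))) (^-*-assoc n a Q))))
      (≤-trans (*-monoʳ-≤ ((3 ^ Q) ^ b) (≤-trans (^-monoʳ-≤ n {{>-nonZero 1≤n}} aQ≤pb) (≤-reflexive (sym (^-*-assoc n p b)))))
      (≤-trans (≤-reflexive (sym (^-distrib-* (3 ^ Q) (n ^ p) b)))
      (≤-trans (^-monoˡ-≤ b bound)
        (≤-reflexive (trans (^-*-assoc σ Q b) (trans (cong (σ ^_) (*-comm Q b)) (sym (^-*-assoc σ b Q)))))))))

  rationalPower≤ : ∀ r → (0ℚ ℚ.≤ r → r ℚ.* ι Q ℚ.≤ ι p) → RationalPower≤ n r s
  rationalPower≤ r@(ℚ.mkℚ (+ a) b-1 _) r≤p/Q = ℚ.≤-trans (ι-mono z≤n) 1≤s ,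
    power a (suc b-1) (ι-cancel (begin
      ι (a * Q)                          ≡⟨ ι-* a Q ⟩
      ι a ℚ.* ι Q                        ≡⟨ cong (ℚ._* ι Q) (q*↧q r) ⟨
      r ℚ.* ι (suc b-1) ℚ.* ι Q          ≡⟨ swap r (ι (suc b-1)) (ι Q) ⟩
      r ℚ.* ι Q ℚ.* ι (suc b-1)          ≤⟨ ℚ.*-monoʳ-≤-nonNeg (ι (suc b-1)) (r≤p/Q (ℚ.nonNegative⁻¹ r)) ⟩
      ι p ℚ.* ι (suc b-1)                ≡⟨ ι-* p (suc b-1) ⟨
      ι (p * suc b-1)                    ∎))
    where
    open ℚ.≤-Reasoning
    swap : ∀ a b c → a ℚ.* b ℚ.* c ≡ a ℚ.* c ℚ.* b
    swap = solveℚ 3 (λ a b c → a :* b :* c := a :* c :* b) refl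
      where open +-*-Solver renaming (solve to solveℚ)
  -- For negative r the claim is that a product of powers of s and n, both at least 1, is at least
  -- 1.
  rationalPower≤ (ℚ.mkℚ -[1+ a ] b-1 _) _ = ℚ.≤-trans (ι-mono z≤n) 1≤s ,
    *-mono-1≤ (^ℚ-1≤ 1≤s (suc b-1)) (^ℚ-1≤ (ι-mono 1≤n) (suc a))

inverse-seq : ∀ y (0<y : 0ℝ < y) k → seq y (proj₁ (proj₂ (proj₂ 0<y)) + k) ℚ.* seq (inverse y 0<y) k ≡ 1ℚ
inverse-seq y (d , 0<d , N , d≤y) k = ℚ.*-inverseʳ (seq y (N + k))
  {{ℚ.>-nonZero (ℚ.<-≤-trans 0<d (subst (ℚ._≤ seq y (N + k)) (ℚ.+-identityˡ d) (d≤y (N + k) (m≤m+n N k))))}}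

-- The exponent is j / (j + 1 + ε).  With e such that ε ≥ 1 / e, a rational
-- r below it satisfies r ≤ j / (j + 1 + 1 / e) = j e / ((j + 1) e + 1).
module Exponent (c j : ℕ) (t≥ : c + 3 ≤ suc j + suc c) (ε : ℝ) (0<ε : 0ℝ < ε) where
  open ℚ.≤-Reasoning

  t : ℕ
  t = suc j + suc c

  d : ℚ
  d = proj₁ 0<ε

  0<d : 0ℚ ℚ.< d
  0<d = proj₁ (proj₂ 0<ε)

  N : ℕ
  N = proj₁ (proj₂ (proj₂ 0<ε))

  d≤ε : ∀ n → N ≤ n → d ℚ.≤ seq ε n
  d≤ε n N≤n = subst (ℚ._≤ seq ε n) (ℚ.+-identityˡ d) (proj₂ (proj₂ (proj₂ 0<ε)) n N≤n)

  e : ℕ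
  e = ℚ.↧ₙ d

  1≤e : 1 ≤ e
  1≤e = s≤s z≤n

  1≤ed : 1ℚ ℚ.≤ ι e ℚ.* d
  1≤ed = ℚ.≤-trans (positive-numerator d 0<d) (ℚ.≤-reflexive (trans (sym (q*↧q d)) (ℚ.*-comm d (ι e))))
    where
    positive-numerator : ∀ d → 0ℚ ℚ.< d → 1ℚ ℚ.≤ ℚ.fromℤ (ℚ.↥ d)
    positive-numerator d 0<d with ℚ.positive 0<d
    positive-numerator (ℚ.mkℚ (+ suc a) _ _) 0<d | _ = ι-mono (s≤s z≤n)

  H : ℚ
  H = (ι t ℚ.- ι c) ℚ.- 1ℚ

  H≡ : H ≡ ι (suc j)
  H≡ = begin-equality
    (ι t ℚ.- ι c) ℚ.- 1ℚ                              ≡⟨ cong (λ x → (x ℚ.- ι c) ℚ.- 1ℚ) (ι-+ (suc j) (suc c)) ⟩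
    (ι (suc j) ℚ.+ ι (suc c) ℚ.- ι c) ℚ.- 1ℚ          ≡⟨ cong (λ x → (ι (suc j) ℚ.+ x ℚ.- ι c) ℚ.- 1ℚ) (ι-+ 1 c) ⟩
    (ι (suc j) ℚ.+ (1ℚ ℚ.+ ι c) ℚ.- ι c) ℚ.- 1ℚ       ≡⟨ cancel (ι (suc j)) 1ℚ (ι c) ⟩
    ι (suc j)                                         ∎
    where
    open +-*-Solver renaming (solve to solveℚ)
    cancel : ∀ a o c → (a ℚ.+ (o ℚ.+ c) ℚ.- c) ℚ.- o ≡ a
    cancel = solveℚ 3 (λ a o c → (a :+ (o :+ c) :- c) :- o := a) refl

  module _ (r : ℚ) (0≤r : 0ℚ ℚ.≤ r) (r<x : fromℚ r < exponent c t t≥ ε 0<ε) where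

    private
      δ′ : ℚ
      δ′ = proj₁ r<x
      0<δ′ : 0ℚ ℚ.< δ′
      0<δ′ = proj₁ (proj₂ r<x)
      N′ : ℕ
      N′ = proj₁ (proj₂ (proj₂ r<x))
      M : ℕ
      M = proj₁ (cauchy ε 0<δ′)
      k : ℕ
      k = N ⊔ (N′ ⊔ M)
      N′≤k : N′ ≤ k
      N′≤k = ≤-trans (m≤m⊔n N′ M) (m≤n⊔m N (N′ ⊔ M))
      M≤k : M ≤ k
      M≤k = ≤-trans (m≤n⊔m N′ M) (m≤n⊔m N (N′ ⊔ M))
      -- Inversion shifts indices by `N`, so numerator and denominator contain different terms of ε.
      -- For k beyond `M` they differ by less than the margin `δ′` between r and the exponent.
      y y′ E i : ℚ
      y  = seq ε k
      y′ = seq ε (N + k)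
      E  = H ℚ.+ y′
      i  = seq (inverse (denominator c t ε) (0<denominator c t ε t≥ 0<ε)) k

    below : r ℚ.+ δ′ ℚ.≤ 1ℚ ℚ.- (1ℚ ℚ.+ y) ℚ.* i
    below = proj₂ (proj₂ (proj₂ r<x)) k N′≤k

    E*i : E ℚ.* i ≡ 1ℚ
    E*i = inverse-seq (denominator c t ε) (0<denominator c t ε t≥ 0<ε) k

    d≤y′ : d ℚ.≤ y′
    d≤y′ = d≤ε (N + k) (m≤m+n N k)

    1≤E : 1ℚ ℚ.≤ E
    1≤E = begin
      1ℚ                 ≤⟨ ι-mono (s≤s z≤n) ⟩
      ι (suc j)          ≡⟨ H≡ ⟨
      H                  ≡⟨ ℚ.+-identityʳ H ⟨
      H ℚ.+ 0ℚ           ≤⟨ ℚ.+-monoʳ-≤ H (ℚ.≤-trans (ℚ.<⇒≤ 0<d) d≤y′) ⟩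
      H ℚ.+ y′           ∎

    y′≤ : y′ ℚ.≤ y ℚ.+ δ′
    y′≤ = linearℚ (ℚ.≤-trans (p≤∣p∣ (y′ ℚ.- y)) (ℚ.<⇒≤ (proj₂ (cauchy ε 0<δ′) (N + k) k (≤-trans M≤k (m≤n+m k N)) M≤k)))
      (identity y y′ δ′)
      where
      open +-*-Solver renaming (solve to solveℚ)
      identity : ∀ y y′ d → y′ ℚ.+ d ≡ (y ℚ.+ d) ℚ.+ (y′ ℚ.- y)
      identity = solveℚ 3 (λ y y′ d → y′ :+ d := (y :+ d) :+ (y′ :- y)) refl

    -- Multiplying `below` by E gives r E + δ′ E ≤ j + y′ - y ≤ j + δ′, and δ′ ≤ δ′ E cancels the
    -- error.
    rE≤j : r ℚ.* E ℚ.≤ ι j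
    rE≤j = linearℚ
      (ℚ.+-mono-≤ (ℚ.+-mono-≤ scaled (ℚ.*-monoˡ-≤-nonNeg δ′ {{ℚ.nonNegative (ℚ.<⇒≤ 0<δ′)}} 1≤E)) y′≤)
      (trans (cong (λ t → r ℚ.* (t ℚ.+ y′) ℚ.+ ((t ℚ.+ y′ ℚ.- (1ℚ ℚ.+ y)) ℚ.+ δ′ ℚ.* (t ℚ.+ y′) ℚ.+ (y ℚ.+ δ′))) (trans H≡ (ι-+ 1 j)))
        (trans (identity r (ι j) y y′ δ′ 1ℚ)
          (cong (λ t → ι j ℚ.+ ((t ℚ.+ y′) ℚ.* (r ℚ.+ δ′) ℚ.+ δ′ ℚ.* 1ℚ ℚ.+ y′)) (sym (trans H≡ (ι-+ 1 j))))))
      where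
      open +-*-Solver renaming (solve to solveℚ)
      expand : ∀ E y i → E ℚ.* (1ℚ ℚ.- (1ℚ ℚ.+ y) ℚ.* i) ≡ E ℚ.- (1ℚ ℚ.+ y) ℚ.* (E ℚ.* i)
      expand = solveℚ 3 (λ E y i → E :* (con 1ℚ :- (con 1ℚ :+ y) :* i) := E :- (con 1ℚ :+ y) :* (E :* i)) refl
      identity : ∀ r j y y′ d o → r ℚ.* (1ℚ ℚ.+ j ℚ.+ y′) ℚ.+ ((1ℚ ℚ.+ j ℚ.+ y′ ℚ.- (1ℚ ℚ.+ y)) ℚ.+ d ℚ.* (1ℚ ℚ.+ j ℚ.+ y′) ℚ.+ (y ℚ.+ d))
        ≡ j ℚ.+ ((1ℚ ℚ.+ j ℚ.+ y′) ℚ.* (r ℚ.+ d) ℚ.+ d ℚ.* 1ℚ ℚ.+ y′)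
      identity = solveℚ 6 (λ r j y y′ d o → r :* (con 1ℚ :+ j :+ y′) :+ ((con 1ℚ :+ j :+ y′ :- (con 1ℚ :+ y)) :+ d :* (con 1ℚ :+ j :+ y′) :+ (y :+ d))
        := j :+ ((con 1ℚ :+ j :+ y′) :* (r :+ d) :+ d :* con 1ℚ :+ y′)) refl
      scaled : E ℚ.* (r ℚ.+ δ′) ℚ.≤ E ℚ.- (1ℚ ℚ.+ y)
      scaled = begin
        E ℚ.* (r ℚ.+ δ′)                     ≤⟨ ℚ.*-monoˡ-≤-nonNeg E {{ℚ.nonNegative (ℚ.≤-trans (ι-mono {0} {1} z≤n) 1≤E)}} below ⟩
        E ℚ.* (1ℚ ℚ.- (1ℚ ℚ.+ y) ℚ.* i)      ≡⟨ expand E y i ⟩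
        E ℚ.- (1ℚ ℚ.+ y) ℚ.* (E ℚ.* i)       ≡⟨ cong (λ x → E ℚ.- (1ℚ ℚ.+ y) ℚ.* x) E*i ⟩
        E ℚ.- (1ℚ ℚ.+ y) ℚ.* 1ℚ              ≡⟨ cong (λ x → E ℚ.- x) (ℚ.*-identityʳ (1ℚ ℚ.+ y)) ⟩
        E ℚ.- (1ℚ ℚ.+ y)                     ∎

    rational-bound : r ℚ.* ι (suc (suc j * e)) ℚ.≤ ι (j * e)
    rational-bound = begin
      r ℚ.* ι (suc (suc j * e))                       ≡⟨ cong (r ℚ.*_) (trans (ι-+ 1 (suc j * e)) (cong (1ℚ ℚ.+_) (ι-* (suc j) e))) ⟩
      r ℚ.* (1ℚ ℚ.+ ι (suc j) ℚ.* ι e)                ≤⟨ ℚ.*-monoˡ-≤-nonNeg r {{ℚ.nonNegative 0≤r}} (ℚ.+-monoˡ-≤ (ι (suc j) ℚ.* ι e)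
                                                           (ℚ.≤-trans 1≤ed (ℚ.*-monoˡ-≤-nonNeg (ι e) d≤y′))) ⟩
      r ℚ.* (ι e ℚ.* y′ ℚ.+ ι (suc j) ℚ.* ι e)        ≡⟨ cong (λ t → r ℚ.* (ι e ℚ.* y′ ℚ.+ t ℚ.* ι e)) H≡ ⟨
      r ℚ.* (ι e ℚ.* y′ ℚ.+ H ℚ.* ι e)                ≡⟨ regroup r (ι e) y′ H ⟩
      r ℚ.* E ℚ.* ι e                                 ≤⟨ ℚ.*-monoʳ-≤-nonNeg (ι e) rE≤j ⟩
      ι j ℚ.* ι e                                     ≡⟨ ι-* j e ⟨
      ι (j * e)                                       ∎
      where
      open +-*-Solver renaming (solve to solveℚ)
      regroup : ∀ r e y t → r ℚ.* (e ℚ.* y ℚ.+ t ℚ.* e) ≡ r ℚ.* (t ℚ.+ y) ℚ.* e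
      regroup = solveℚ 4 (λ r e y t → r :* (e :* y :+ t :* e) := r :* (t :+ y) :* e) refl

-- The deficiency

3*n/3 : ∀ n → ι 3 ℚ.* (+ n ℚ./ 3) ≡ ι n
3*n/3 n = ℚ.toℚᵘ-injective (ℚᵘ.≃-trans (ℚ.toℚᵘ-homo-* (ι 3) (+ n ℚ./ 3))
  (ℚᵘ.≃-trans (ℚᵘ.*-congˡ {ℚ.toℚᵘ (ι 3)} (ℚ.toℚᵘ-fromℚᵘ (ℚᵘ.mkℚᵘ (+ n) 2)))
    (ℚᵘ.*≡* (trans (ℤ.*-identityʳ (+ 3 ℤ.* + n)) (ℤ.*-comm (+ 3) (+ n))))))

n/1 : ∀ n → + n ℚ./ 1 ≡ ι n
n/1 n = ℚ.toℚᵘ-injective (ℚ.toℚᵘ-fromℚᵘ (ℚᵘ.mkℚᵘ (+ n) 0))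

3*deficiency : ∀ n d → 3 * d ≤ n → ι 3 ℚ.* ((+ n ℚ./ 3) ℚ.- (+ d ℚ./ 1)) ≡ ι (n ∸ 3 * d)
3*deficiency n d 3d≤n = begin
  ι 3 ℚ.* ((+ n ℚ./ 3) ℚ.- (+ d ℚ./ 1))             ≡⟨ distrib (ι 3) (+ n ℚ./ 3) (+ d ℚ./ 1) ⟩
  ι 3 ℚ.* (+ n ℚ./ 3) ℚ.- ι 3 ℚ.* (+ d ℚ./ 1)       ≡⟨ cong₂ (λ x y → x ℚ.- ι 3 ℚ.* y) (3*n/3 n) (n/1 d) ⟩
  ι n ℚ.- ι 3 ℚ.* ι d                               ≡⟨ cong₂ (λ x y → ι x ℚ.- y) (sym (m∸n+n≡m 3d≤n)) (sym (ι-* 3 d)) ⟩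
  ι (n ∸ 3 * d + 3 * d) ℚ.- ι (3 * d)               ≡⟨ cong (ℚ._- ι (3 * d)) (ι-+ (n ∸ 3 * d) (3 * d)) ⟩
  ι (n ∸ 3 * d) ℚ.+ ι (3 * d) ℚ.- ι (3 * d)         ≡⟨ cancel (ι (n ∸ 3 * d)) (ι (3 * d)) ⟩
  ι (n ∸ 3 * d)                                     ∎
  where
  open ≡-Reasoning
  open +-*-Solver renaming (solve to solveℚ)
  distrib : ∀ a b c → a ℚ.* (b ℚ.- c) ≡ a ℚ.* b ℚ.- a ℚ.* c
  distrib = solveℚ 3 (λ a b c → a :* (b :- c) := a :* b :- a :* c) refl
  cancel : ∀ a b → a ℚ.+ b ℚ.- b ≡ a
  cancel = solveℚ 2 (λ a b → a :+ b :- b := a) refl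

module _ (c j : ℕ) .{{_ : NonZero j}} (2^1290≤c : 2 ^ 1290 ≤ c) (11≤c : 11 ≤ c) (e : ℕ) .{{_ : NonZero e}} where

  private
    Q : ℕ
    Q = suc (suc j * e)

  colourable-of-small-defect : ∀ {n} (F : Graph n) → TriangleFree F →
    (∀ σ → 1 ≤ σ → σ ^ Q ≤ 3 ^ Q * n ^ (j * e) →
      ∃ λ l → 1 ≤ l × 2 * n <ⁿ 2 ^ l × 40 * (14000 * l) ^ j * σ ^ suc j ≤ n ^ j) →
    1 ≤ n → (n ∸ 3 * δ F) ^ Q ≤ 3 ^ Q * n ^ (j * e) → Colourable F (suc j + c)
  colourable-of-small-defect {n} F triangle-free threshold 1≤n small =
    [ weaken (≤-trans 2^1290≤c (m≤n+m c (suc j)))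
    , [ weaken (≤-trans 11≤c (m≤n+m c (suc j)))
      , weaken (≤-trans (≤-reflexive (+-comm 2 (suc j))) (+-monoʳ-≤ (suc j) (≤-trans (s≤s (s≤s z≤n)) 11≤c))) ]′ ]′
    (StructureTheorem.colouring F triangle-free m σ j m≤deg 3m≤n n≤3m+σ 1≤σ l 1≤l l-large σ-small)
    where
    weaken : ∀ {k} → k ≤ suc j + c → Colourable F k → Colourable F (suc j + c)
    weaken = colourable-mono F
    -- The minimum degree may exceed n / 3, so it is cut off there. The 2 keeps σ positive and
    -- covers the remainder of n modulo 3.
    m σ : ℕ
    m = δ F ⊓ (n / 3)
    σ = 2 ⊔ (n ∸ 3 * δ F)
    2≤σ : 2 ≤ σ
    2≤σ = m≤m⊔n 2 (n ∸ 3 * δ F)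
    1≤σ : 1 ≤ σ
    1≤σ = ≤-trans (s≤s z≤n) 2≤σ
    σ-bound : σ ^ Q ≤ 3 ^ Q * n ^ (j * e)
    σ-bound = case ⊔-sel 2 (n ∸ 3 * δ F) of λ where
      (inj₂ eq) → subst (λ s → s ^ Q ≤ 3 ^ Q * n ^ (j * e)) (sym eq) small
      (inj₁ eq) → subst (λ s → s ^ Q ≤ 3 ^ Q * n ^ (j * e)) (sym eq)
        (≤-trans (^-monoˡ-≤ Q (n≤1+n 2)) (≤-trans (≤-reflexive (sym (*-identityʳ (3 ^ Q))))
          (*-monoʳ-≤ (3 ^ Q) (m^n>0 n {{>-nonZero 1≤n}} (j * e)))))
    l : ℕ
    l = proj₁ (threshold σ 1≤σ σ-bound)
    1≤l : 1 ≤ l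
    1≤l = proj₁ (proj₂ (threshold σ 1≤σ σ-bound))
    l-large : 2 * n <ⁿ 2 ^ l
    l-large = proj₁ (proj₂ (proj₂ (threshold σ 1≤σ σ-bound)))
    σ-small : 40 * (14000 * l) ^ j * σ ^ suc j ≤ n ^ j
    σ-small = proj₂ (proj₂ (proj₂ (threshold σ 1≤σ σ-bound)))
    m≤deg : ∀ x → m ≤ Adjacency.deg F x
    m≤deg x = ≤-trans (m⊓n≤m (δ F) (n / 3)) (δ≤deg F x)
    3m≤n : 3 * m ≤ n
    3m≤n = ≤-trans (*-monoʳ-≤ 3 (m⊓n≤n (δ F) (n / 3))) (≤-trans (≤-reflexive (*-comm 3 (n / 3))) (m/n*n≤m n 3))
    n≤3m+σ : n ≤ 3 * m + σ
    n≤3m+σ = case ⊓-sel (δ F) (n / 3) of λ where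
      (inj₁ eq) → subst (λ m → n ≤ 3 * m + σ) (sym eq)
        (≤-trans (m≤n+m∸n n (3 * δ F)) (+-monoʳ-≤ (3 * δ F) (m≤n⊔m 2 (n ∸ 3 * δ F))))
      (inj₂ eq) → subst (λ m → n ≤ 3 * m + σ) (sym eq)
        (third-bound n (n / 3) (n % 3) σ
          (≤-reflexive (trans (m≡m%n+[m/n]*n n 3) (cong (λ k → n % 3 + k) (*-comm (n / 3) 3))))
          (s≤s⁻¹ (m%n<n n 3)) 2≤σ)

deficiency-bound : ∀ c j → .{{NonZero j}} → 2 ^ 1290 ≤ c → 11 ≤ c →
  (t≥ : c + 3 ≤ suc j + suc c) (ε : ℝ) (0<ε : 0ℝ < ε) →
  ∃ λ N → ∀ n → N ≤ n →
  ∃ λ s → IsDeficiency (suc j + suc c) n s × Power≤ n (exponent c (suc j + suc c) t≥ ε 0<ε) s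
deficiency-bound c j 2^1290≤c 11≤c t≥ ε 0<ε = N₁ ⊔ N₂ , λ n N≤n →
  let 1≤n , threshold = proj₂ (deficiency-threshold j e) n (≤-trans (m≤m⊔n N₁ N₂) N≤n)
      d , maximum     = proj₂ (maxMinDegree-exists t) n (≤-trans (m≤n⊔m N₁ N₂) N≤n)
      (F , (triangle-free , t≤χ) , δ≡d) , _ = maximum
      bound : 3 ^ Q * n ^ (j * e) ≤ (n ∸ 3 * d) ^ Q
      -- Otherwise the extremal graph would have a colouring with suc j + c = t - 1 colours.
      bound = ≮⇒≥ λ lt → <⇒≱ (≤-trans (≤-reflexive (sym (+-suc (suc j) c))) t≤χ) (χ-minimal F
        (colourable-of-small-defect c j 2^1290≤c 11≤c e F triangle-free threshold 1≤n
          (<⇒≤ (subst (λ d → (n ∸ 3 * d) ^ Q <ⁿ 3 ^ Q * n ^ (j * e)) (sym δ≡d) lt))))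
      3d≤n : 3 * d ≤ n
      3d≤n = <⇒≤ (m∸n≢0⇒n<m λ eq → case ≤-trans (3≤root n (n ∸ 3 * d) (j * e) Q 1≤n bound) (≤-reflexive eq) of λ ())
  in (+ n ℚ./ 3) ℚ.- (+ d ℚ./ 1) , (d , maximum , refl) ,
     λ r r<x → PowerBound.rationalPower≤ n (n ∸ 3 * d) (j * e) Q 1≤n bound _ (3*deficiency n d 3d≤n) r
       λ 0≤r → Exponent.rational-bound c j t≥ ε 0<ε r 0≤r r<x
  where
  t e Q N₁ N₂ : ℕ
  t  = suc j + suc c
  e  = Exponent.e c j t≥ ε 0<ε
  Q  = suc (suc j * e)
  N₁ = proj₁ (deficiency-threshold j e)
  N₂ = proj₁ (maxMinDegree-exists t)

-- With t = j + 1 + (c + 1) the exponent 1 - (1 + ε) / (t - c - 1 + ε) becomes j / (j + 1 + ε), and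
-- t ≥ c + 3 becomes j = `suc i`.
shift-elim : ∀ c (P : ∀ t → c + 3 ≤ t → Set) → (∀ i t≥ → P (suc (suc i) + suc c) t≥) → ∀ t t≥ → P t t≥
shift-elim c P base t t≥ with t ∸ (c + 3) | m∸n+n≡m t≥
... | i | eq with trans (sym eq) (regroup i c)
  where
  regroup : ∀ i c → i + (c + 3) ≡ suc (suc i) + suc c
  regroup = solve-∀
... | refl = base i t≥

-- Stated for a variable c in order not to unfold 10 ^ 391.
deficiency-bound′ : ∀ c → 2 ^ 1290 ≤ c → 11 ≤ c → (t : ℕ) (t≥ : c + 3 ≤ t) (ε : ℝ) (0<ε : 0ℝ < ε) →
  ∃ λ N → ∀ n → N ≤ n → ∃ λ s → IsDeficiency t n s × Power≤ n (exponent c t t≥ ε 0<ε) s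
deficiency-bound′ c 2^1290≤c 11≤c = shift-elim c
  (λ t t≥ → ∀ ε 0<ε → ∃ λ N → ∀ n → N ≤ n → ∃ λ s → IsDeficiency t n s × Power≤ n (exponent c t t≥ ε 0<ε) s)
  (λ i → deficiency-bound c (suc i) 2^1290≤c 11≤c)

mainTheorem3 : (t : ℕ) (t≥ : 10 ^ 391 + 3 ≤ t) (ε : ℝ) (0<ε : 0ℝ < ε) →
    ∃ λ N → ∀ n → N ≤ n →
    ∃ λ s → IsDeficiency t n s × Power≤ n (exponent (10 ^ 391) t t≥ ε 0<ε) s
mainTheorem3 = deficiency-bound′ (10 ^ 391) (≤ᵇ⇒≤ (2 ^ 1290) (10 ^ 391) tt) (≤ᵇ⇒≤ 11 (10 ^ 391) tt)
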